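{- Let $p$ be an odd prime and $r\ge3$ an integer with $p\nmid r$. Let $\mathcal{M}_1,\dots,\mathcal{M}_m,\mathcal{N}_1,\dots,\mathcal{N}_n$ be irreducible rotary augmented PX maps of length $r$ such that $\mathcal{M}_i\not\cong\mathcal{M}_j$ for $i\ne j$ and $\mathcal{N}_i\not\cong\mathcal{N}_j$ for $i\ne j$. Then $\mathcal{M}_1\times\cdots\times\mathcal{M}_m\cong\mathcal{N}_1\times\cdots\times\mathcal{N}_n$ if and only if $m=n$ and there is a permutation $\sigma$ of $\{1,\dots,n\}$ with $\mathcal{M}_i\cong\mathcal{N}_{\sigma(i)}$ for all $i$.
   Context: A map is rotary if the surface is orientable and the group of orientation-preserving automorphisms acts transitively (hence regularly) on arcs. For a group $G$ and $\rho,\tau\in G$ with $|\tau|=2$, $G=\langle\rho,\tau\rangle$, $\mathsf{RotaMap}(G,\rho,\tau)$ is the map with vertices the cosets of $\langle\rho\rangle$, edges the cosets of $\langle\tau\rangle$, faces the cosets of $\langle\rho\tau\rangle$, incidence being nonempty intersection; every rotary map is isomorphic to one of this form. For $\mathcal{M}_i=\mathsf{RotaMap}(G_i,\rho_i,\tau_i)$, the direct product $\prod_i\mathcal{M}_i$ is $\mathsf{RotaMap}(H,(\rho_i)_i,(\tau_i)_i)$ where $H=\langle(\rho_i)_i,(\tau_i)_i\rangle\le\prod_iG_i$. The Praeger–Xu graph $\mathrm{C}(p,r,s)$ ($s\ge1$) has vertex set $\mathbb{Z}_r\times\mathbb{Z}_p^s$, with $(i,x_0,\dots,x_{s-1})$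 adjacent to $(i+1,x_1,\dots,x_s)$. The augmented PX graph $\mathrm{C}^*(p,r,s,\delta)$ is $\mathrm{C}(p,r,s)$ if $s\ge1$; the $r$-cycle with each adjacent pair joined by $p$ parallel edges if $(s,\delta)=(0,1)$; the cycle $\mathrm{C}_{pr}$ if $(s,\delta)=(0,-1)$; its length is $r$. An augmented PX map of length $r$ has such a graph of length $r$ as underlying graph; it is irreducible if its orientation-preserving automorphism group is isomorphic to $\mathbb{Z}_p^d\rtimes_\psi\mathrm{D}_{2r}$ with $\psi$ an irreducible representation over $\mathbb{F}_p$ of the dihedral group $\mathrm{D}_{2r}$ of order $2r$. -}

module Defs where

open import Level using (0ℓ)
open import Data.Nat using (ℕ; zero; suc; _+_; _*_; _∸_; NonZero; _≤_)
open import Data.Nat.DivMod using (_mod_)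
import Data.Nat.Properties
open import Data.Integer using (ℤ; +_; -[1+_])
open import Data.Fin using (Fin; toℕ)
open import Data.Bool using (Bool; true; false; _xor_; if_then_else_)
open import Data.Vec using (Vec; []; _∷_; map; zipWith; foldr′; replicate; tail)
open import Data.List using (List; []; _∷_)
open import Data.Product using (Σ; _×_; _,_; ∃; ∃-syntax)
open import Data.Sum using (_⊎_)
open import Relation.Binary.PropositionalEquality using (_≡_; _≢_)
open import Relation.Nullary using (¬_)
open import Algebra.Bundles using (Group)

record Ops : Set₁ where
  field
    Carrier : Set
    _≈_     : Carrier → Carrier → Set
    _∙_     : Carrier → Carrier → Carrier
    ε       : Carrier
    _⁻¹     : Carrier → Carrier

groupOps : Group 0ℓ 0ℓ → Ops
groupOps G = record
  { Carrier = Group.Carrier G ; _≈_ = Group._≈_ G ; _∙_ = Group._∙_ G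
  ; ε = Group.ε G ; _⁻¹ = Group._⁻¹ G }

prodOps : {m : ℕ} → (Fin m → Ops) → Ops
prodOps {m} O = record
  { Carrier = (i : Fin m) → Ops.Carrier (O i)
  ; _≈_ = λ x y → (i : Fin m) → Ops._≈_ (O i) (x i) (y i)
  ; _∙_ = λ x y i → Ops._∙_ (O i) (x i) (y i)
  ; ε = λ i → Ops.ε (O i)
  ; _⁻¹ = λ x i → Ops._⁻¹ (O i) (x i) }

-- Words in ρ, ρ⁻¹, τ : they represent exactly the elements of ⟨ρ,τ⟩

data Letter : Set where
  rho rhoInv tau : Letter

Word : Set
Word = List Letter

module _ (O : Ops) where
  open Ops O

  powℕ : Carrier → ℕ → Carrier
  powℕ x zero    = ε
  powℕ x (suc n) = x ∙ powℕ x n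

  powℤ : Carrier → ℤ → Carrier
  powℤ x (+ n)     = powℕ x n
  powℤ x -[1+ n ] = (powℕ x (suc n)) ⁻¹

  eval : Carrier → Carrier → Word → Carrier
  eval ρ τ []           = ε
  eval ρ τ (rho ∷ w)    = ρ ∙ eval ρ τ w
  eval ρ τ (rhoInv ∷ w) = (ρ ⁻¹) ∙ eval ρ τ w
  eval ρ τ (tau ∷ w)    = τ ∙ eval ρ τ w

  sameCoset : Carrier → Carrier → Carrier → Set
  sameCoset a g h = Σ ℤ λ k → ((g ⁻¹) ∙ h) ≈ powℤ a k

  meet : Carrier → Carrier → Carrier → Carrier → Set
  meet a g b h = Σ ℤ λ i → Σ ℤ λ j → (g ∙ powℤ a i) ≈ (h ∙ powℤ b j)

  IsRotaData : Carrier → Carrier → Set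
  IsRotaData ρ τ = ((τ ∙ τ) ≈ ε) × ¬ (τ ≈ ε) × (∀ x → ∃[ w ] (eval ρ τ w ≈ x))

record MapStr : Set₁ where
  field
    V E F : Set
    _≈V_  : V → V → Set
    _≈E_  : E → E → Set
    _≈F_  : F → F → Set
    IVE   : V → E → Set
    IVF   : V → F → Set
    IEF   : E → F → Set

-- RotaMap(H,ρ,τ) with H = ⟨ρ,τ⟩ inside the ambient group O.
-- Elements of H are represented by words; vertices, edges, faces are the
-- cosets of ⟨ρ⟩, ⟨τ⟩, ⟨ρτ⟩ (a coset g⟨a⟩ represented by g, identified
-- when equal); incidence is nonempty intersection.
RotaMap : (O : Ops) → Ops.Carrier O → Ops.Carrier O → MapStr
RotaMap O ρ τ = record
  { V = Word ; E = Word ; F = Word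
  ; _≈V_ = λ u w → sameCoset O ρ (ev u) (ev w)
  ; _≈E_ = λ u w → sameCoset O τ (ev u) (ev w)
  ; _≈F_ = λ u w → sameCoset O ρτ (ev u) (ev w)
  ; IVE = λ u w → meet O ρ (ev u) τ (ev w)
  ; IVF = λ u w → meet O ρ (ev u) ρτ (ev w)
  ; IEF = λ u w → meet O τ (ev u) ρτ (ev w) }
  where
  ev = eval O ρ τ
  ρτ = Ops._∙_ O ρ τ

record SetIso {A B : Set} (_≈A_ : A → A → Set) (_≈B_ : B → B → Set) : Set where
  field
    to      : A → B
    from    : B → A
    to-cong   : ∀ {x y} → x ≈A y → to x ≈B to y
    from-cong : ∀ {x y} → x ≈B y → from x ≈A from y
    to-from : ∀ b → to (from b) ≈B b
    from-to : ∀ a → from (to a) ≈A a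

record MapIso (M N : MapStr) : Set where
  module M = MapStr M
  module N = MapStr N
  field
    isoV : SetIso M._≈V_ N._≈V_
    isoE : SetIso M._≈E_ N._≈E_
    isoF : SetIso M._≈F_ N._≈F_
  fV = SetIso.to isoV
  fE = SetIso.to isoE
  fF = SetIso.to isoF
  field
    presVE : ∀ v e → (M.IVE v e → N.IVE (fV v) (fE e)) × (N.IVE (fV v) (fE e) → M.IVE v e)
    presVF : ∀ v f → (M.IVF v f → N.IVF (fV v) (fF f)) × (N.IVF (fV v) (fF f) → M.IVF v f)
    presEF : ∀ e f → (M.IEF e f → N.IEF (fE e) (fF f)) × (N.IEF (fE e) (fF f) → M.IEF e f)

record Graph : Set₁ where
  field
    Vt Ed : Set
    _≈V_  : Vt → Vt → Set
    _≈E_  : Ed → Ed → Set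
    Inc   : Vt → Ed → Set

underlyingGraph : MapStr → Graph
underlyingGraph M = record
  { Vt = MapStr.V M ; Ed = MapStr.E M ; _≈V_ = MapStr._≈V_ M
  ; _≈E_ = MapStr._≈E_ M ; Inc = MapStr.IVE M }

record GraphIso (X Y : Graph) : Set where
  module X = Graph X
  module Y = Graph Y
  field
    isoV : SetIso X._≈V_ Y._≈V_
    isoE : SetIso X._≈E_ Y._≈E_
    presInc : ∀ v e → (X.Inc v e → Y.Inc (SetIso.to isoV v) (SetIso.to isoE e))
                    × (Y.Inc (SetIso.to isoV v) (SetIso.to isoE e) → X.Inc v e)

addF : ∀ {n} .{{_ : NonZero n}} → Fin n → Fin n → Fin n
addF {n} a b = (toℕ a + toℕ b) mod n

mulF : ∀ {n} .{{_ : NonZero n}} → Fin n → Fin n → Fin n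
mulF {n} a b = (toℕ a * toℕ b) mod n

negF : ∀ {n} .{{_ : NonZero n}} → Fin n → Fin n
negF {n} a = (n ∸ toℕ a) mod n

zeroF : ∀ {n} .{{_ : NonZero n}} → Fin n
zeroF {n} = 0 mod n

oneF : ∀ {n} .{{_ : NonZero n}} → Fin n
oneF {n} = 1 mod n

initV : ∀ {A : Set} {n} → Vec A (suc n) → Vec A n
initV (x ∷ [])     = []
initV (x ∷ y ∷ ys) = x ∷ initV (y ∷ ys)

data Sign : Set where
  plus minus : Sign

-- C(p,r,s): vertices (i, x₀…x_{s-1}); an edge is (i, x₀…x_s), joining
-- (i, x₀…x_{s-1}) and (i+1, x₁…x_s).  For s = 0 this is the r-cycle with
-- every edge replaced by p parallel edges.
PXgraph : (p r s : ℕ) .{{_ : NonZero r}} → Graph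
PXgraph p r s = record
  { Vt = Fin r × Vec (Fin p) s
  ; Ed = Fin r × Vec (Fin p) (suc s)
  ; _≈V_ = _≡_ ; _≈E_ = _≡_
  ; Inc = λ { (i , x) (j , y) → (i ≡ j × x ≡ initV y) ⊎ (i ≡ addF j oneF × x ≡ tail y) } }

cycleGraph : (n : ℕ) .{{_ : NonZero n}} → Graph
cycleGraph n = record
  { Vt = Fin n ; Ed = Fin n ; _≈V_ = _≡_ ; _≈E_ = _≡_
  ; Inc = λ v e → (v ≡ e) ⊎ (v ≡ addF e oneF) }

AugPX : (p r s : ℕ) → Sign → .{{_ : NonZero p}} .{{_ : NonZero r}} → Graph
AugPX p r zero    minus = cycleGraph (p * r) {{Data.Nat.Properties.m*n≢0 p r}}
AugPX p r zero    plus  = PXgraph p r zero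
AugPX p r (suc s) δ     = PXgraph p r (suc s)

-- Dihedral group D_{2r}: (k, false) = a^k, (k, true) = a^k b, with bab = a⁻¹

Dih : ℕ → Set
Dih r = Fin r × Bool

dmul : ∀ {r} .{{_ : NonZero r}} → Dih r → Dih r → Dih r
dmul (k , e) (l , f) = addF k (if e then negF l else l) , (e xor f)

did : ∀ {r} .{{_ : NonZero r}} → Dih r
did = zeroF , false

VecF : ℕ → ℕ → Set
VecF p d = Vec (Fin p) d

Mat : ℕ → ℕ → Set
Mat p d = Vec (Vec (Fin p) d) d

module _ {p : ℕ} .{{_ : NonZero p}} where
  dot : ∀ {d} → VecF p d → VecF p d → Fin p
  dot u v = foldr′ addF zeroF (zipWith mulF u v)

  mulMV : ∀ {d} → Mat p d → VecF p d → VecF p d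
  mulMV M v = map (λ row → dot row v) M

  addV : ∀ {d} → VecF p d → VecF p d → VecF p d
  addV = zipWith addF

  scaleV : ∀ {d} → Fin p → VecF p d → VecF p d
  scaleV c = map (mulF c)

  zeroV : ∀ {d} → VecF p d
  zeroV {d} = replicate d zeroF

record Rep (p r d : ℕ) .{{_ : NonZero p}} .{{_ : NonZero r}} : Set where
  field
    ψ      : Dih r → Mat p d
    ψ-id   : ∀ v → mulMV (ψ did) v ≡ v
    ψ-hom  : ∀ g h v → mulMV (ψ (dmul g h)) v ≡ mulMV (ψ g) (mulMV (ψ h) v)

module _ {p r d : ℕ} .{{_ : NonZero p}} .{{_ : NonZero r}} (R : Rep p r d) where
  open Rep R

  IsSubspace : (VecF p d → Set) → Set
  IsSubspace W = W zeroV × (∀ u v → W u → W v → W (addV u v))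
                         × (∀ c v → W v → W (scaleV c v))

  IsInvariant : (VecF p d → Set) → Set
  IsInvariant W = ∀ g v → W v → W (mulMV (ψ g) v)

  Irreducible : Set₁
  Irreducible = (1 ≤ d) × ¬ (Σ (VecF p d → Set) λ W → IsSubspace W × IsInvariant W
                              × (∃[ v ] (W v × v ≢ zeroV)) × (∃[ v ] ¬ W v))

  SDP : Set
  SDP = VecF p d × Dih r

  sdmul : SDP → SDP → SDP
  sdmul (v , g) (w , h) = addV v (mulMV (ψ g) w) , dmul g h

  record GroupIsoSDP (G : Group 0ℓ 0ℓ) : Set where
    open Group G
    field
      φ      : Carrier → SDP
      φ-cong : ∀ {x y} → x ≈ y → φ x ≡ φ y
      φ-inj  : ∀ {x y} → φ x ≡ φ y → x ≈ y
      φ-surj : ∀ t → ∃[ x ] (φ x ≡ t)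
      φ-hom  : ∀ x y → φ (x ∙ y) ≡ sdmul (φ x) (φ y)

module _ (p r : ℕ) .{{_ : NonZero p}} .{{_ : NonZero r}}
         (G : Group 0ℓ 0ℓ) (ρ τ : Group.Carrier G) where

  IsAugPXMap : Set
  IsAugPXMap = Σ ℕ λ s → Σ Sign λ δ →
    GraphIso (underlyingGraph (RotaMap (groupOps G) ρ τ)) (AugPX p r s δ)

  -- Aut⁺(RotaMap(G,ρ,τ)) = G ≅ 𝔽_p^d ⋊_ψ D_{2r}, ψ irreducible
  IsIrreducibleGroup : Set₁
  IsIrreducibleGroup = Σ ℕ λ d → Σ (Rep p r d) λ R → Irreducible R × GroupIsoSDP R G

  IrredAugPXMap : Set₁
  IrredAugPXMap = IsAugPXMap × IsIrreducibleGroup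

{-# OPTIONS --safe #-}

-- A rotary map is determined by the kernel K of the evaluation of words in ρ and τ,
-- and a product of maps by the intersection of the kernels.  Comparing |ρ| with the
-- valency shows that ρ and τ are reflections modulo V = 𝔽_p^d.  Hence all kernels lie in
-- one normal subgroup N of the group of words, with quotient D_{2r}, and N/K is an
-- irreducible module for D_{2r}, generated by u = ρ² and t = (ρτ)^r.
--
-- The reflection ρ fixes u, and if u ≠ 0 in N/K then 2t lies in the submodule generated
-- by u.  So K is determined by the set of those q in 𝔽_p[a + a⁻¹], a = ρτ, with q u = 0
-- in N/K.  As q commutes with the action, this set is a prime ideal, and a prime ideal
-- that contains a finite intersection of ideals contains one of them.  If u = 0 in N/K,
-- then a acts trivially and ρ as −1, and there is only one such K.  This gives the
-- unique factorisation on the level of kernels.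
--
-- Replacing ρ by ρ⁻¹ only negates u, so every kernel is invariant under taking the mirror
-- image.  An isomorphism of maps can be followed along flags as soon as ⟨ρ⟩ ∩ ⟨ρτ⟩ = 1, a
-- condition visible in the incidences, and then the kernels are equal or mirror images,
-- hence equal.  If ⟨ρ⟩ ∩ ⟨ρτ⟩ ≠ 1, then V is central and u ≠ 0, and again there is only one
-- such K.
module Submission where

open import Defs
open import Level using (0ℓ)
open import Data.Nat as ℕ using (ℕ; zero; suc; NonZero; _≤_; _∸_; pred; s≤s; z≤n; nonTrivial⇒n>1)
import Data.Nat.Properties as ℕₚ
open import Data.Nat.DivMod using (_%_; _/_; _mod_; m≡m%n+[m/n]*n; m<n⇒m%n≡m; %-distribˡ-+; m%n%n≡m%n; n%n≡0; m*n%n≡0)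
open import Data.Nat.Divisibility using (_∣_; divides; _∣?_; ∣⇒≤; m%n≡0⇒n∣m)
open import Data.Nat.Primality using (Prime; prime⇒irreducible; prime⇒nonTrivial)
open import Data.Nat.Coprimality using (Coprime; coprime-Bézout; coprime-divisor)
open import Data.Nat.GCD using (module Bézout)
open import Data.Integer using (ℤ; +_; -[1+_])
open import Data.Bool as Bool using (Bool; true; false; not; _xor_; if_then_else_)
open import Data.Fin as Fin using (Fin; zero; suc; toℕ)
import Data.Fin.Properties as Finₚ
open import Data.List as List using (List; []; _∷_; _++_; [_])
import Data.List.Properties as Listₚ
open import Data.Vec as Vec using (Vec; []; _∷_)
import Data.Vec.Properties as Vecₚ
open import Data.Product using (Σ; Σ-syntax; _×_; _,_; proj₁; proj₂; ∃; ∃-syntax)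
import Data.Product.Properties as Productₚ
open import Data.Sum using (_⊎_; inj₁; inj₂; fromInj₁; fromInj₂; [_,_]′)
open import Data.Empty using (⊥; ⊥-elim)
open import Data.Unit using (⊤; tt)
open import Function.Bundles using (_⇔_; _↔_; Inverse; mk⇔; mk↔ₛ′)
open import Relation.Binary.PropositionalEquality as ≡ using (_≡_; _≢_)
open import Relation.Nullary using (¬_; Dec; yes; no; contradiction; ¬?; _×-dec_)
open import Algebra.Bundles using (Group; AbelianGroup)
import Algebra.Properties.Group as GroupProperties
import Algebra.Properties.CommutativeSemigroup as CommutativeSemigroupProperties
import Relation.Binary.Reasoning.Setoid as SetoidReasoning
import Relation.Binary.Reflection as Reflect

-- Equations in groups

-- Neither the group generated by (ρᵢ)ᵢ and (τᵢ)ᵢ nor a quotient N/K is formed: elements are words,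
-- and two groups are compared by bringing a word into one normal form valid in both.
--
-- The obstacle inside N/K is that an element y of the group ring of ⟨a⟩ does not commute with the
-- reflection, so its kernel need not be a submodule. The symmetrisation y + ȳ, where ȳ has the
-- exponents of y negated, commutes with the whole action. Nothing is lost by it: y u = 0 as soon as
-- the symmetrisations of all aʲy kill u. This step and the use of 2t in place of t are possible
-- because p is odd.
--
-- Irreducibility is available only as a refutation, since submodules are arbitrary predicates. It
-- yields equations because equality in the groups is decidable, and two kernels are shown to be
-- equal or separated by a search through the coefficient vectors in 𝔽_pʳ.
--
-- The underlying graph serves to exclude that ρ is a rotation of D_{2r}. In that case r would
-- divide |ρ|, which is the valency 2 or 2p, against r ≥ 3 and p ∤ r.

infixr 7 _⊗_

data Expr (n : ℕ) : Set where
  var : Fin n → Expr n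
  one : Expr n
  _⊗_ : Expr n → Expr n → Expr n
  inv : Expr n → Expr n

module Reduction {n : ℕ} where

  push : Bool → Fin n → List (Bool × Fin n) → List (Bool × Fin n)
  push s i [] = (s , i) ∷ []
  push s i ((s′ , j) ∷ l) with i Fin.≟ j
  push true  i ((true  , j) ∷ l) | yes _ = (true , i) ∷ (true , j) ∷ l
  push true  i ((false , j) ∷ l) | yes _ = l
  push false i ((true  , j) ∷ l) | yes _ = l
  push false i ((false , j) ∷ l) | yes _ = (false , i) ∷ (false , j) ∷ l
  push s     i ((s′    , j) ∷ l) | no  _ = (s , i) ∷ (s′ , j) ∷ l

  -- The Boolean is the exponent ±1 under which the expression is read, and the list accumulates
  -- what stands to its right, so flattening and free reduction take a single pass.
  reduce : Bool → Expr n → List (Bool × Fin n) → List (Bool × Fin n)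
  reduce s     (var i) l = push s i l
  reduce s     one     l = l
  reduce true  (e ⊗ f) l = reduce true e (reduce true f l)
  reduce false (e ⊗ f) l = reduce false f (reduce false e l)
  reduce s     (inv e) l = reduce (not s) e l

module GroupSolver (G : Group 0ℓ 0ℓ) where
  open Group G
  open GroupProperties G
  open SetoidReasoning setoid
  open Reduction

  ⟦_⟧ : ∀ {n} → Expr n → Vec Carrier n → Carrier
  ⟦ var i ⟧ γ = Vec.lookup γ i
  ⟦ one   ⟧ γ = ε
  ⟦ e ⊗ f ⟧ γ = ⟦ e ⟧ γ ∙ ⟦ f ⟧ γ
  ⟦ inv e ⟧ γ = (⟦ e ⟧ γ) ⁻¹

  sgn : Bool → Carrier → Carrier
  sgn true  x = x
  sgn false x = x ⁻¹

  ⟦_⟧ᴸ : ∀ {n} → List (Bool × Fin n) → Vec Carrier n → Carrier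
  ⟦ [] ⟧ᴸ γ = ε
  ⟦ (s , i) ∷ l ⟧ᴸ γ = sgn s (Vec.lookup γ i) ∙ ⟦ l ⟧ᴸ γ

  ⟦_⇓⟧ : ∀ {n} → Expr n → Vec Carrier n → Carrier
  ⟦ e ⇓⟧ = ⟦ reduce true e [] ⟧ᴸ

  push-correct : ∀ {n} s i l (γ : Vec Carrier n) → ⟦ push s i l ⟧ᴸ γ ≈ sgn s (Vec.lookup γ i) ∙ ⟦ l ⟧ᴸ γ
  push-correct s i [] γ = refl
  push-correct s i ((s′ , j) ∷ l) γ with i Fin.≟ j
  push-correct true  i ((true  , j) ∷ l) γ | yes _ = refl
  push-correct true  i ((false , .i) ∷ l) γ | yes ≡.refl = sym (\\-leftDividesˡ _ _)
  push-correct false i ((true  , .i) ∷ l) γ | yes ≡.refl = sym (\\-leftDividesʳ _ _)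
  push-correct false i ((false , j) ∷ l) γ | yes _ = refl
  push-correct s     i ((s′    , j) ∷ l) γ | no  _ = refl

  reduce-correct : ∀ {n} s (e : Expr n) l (γ : Vec Carrier n) → ⟦ reduce s e l ⟧ᴸ γ ≈ sgn s (⟦ e ⟧ γ) ∙ ⟦ l ⟧ᴸ γ
  reduce-correct s (var i) l γ = push-correct s i l γ
  reduce-correct true one l γ = sym (identityˡ _)
  reduce-correct false one l γ = sym (trans (∙-congʳ ε⁻¹≈ε) (identityˡ _))
  reduce-correct true (e ⊗ f) l γ =
    trans (reduce-correct true e _ γ) (trans (∙-congˡ (reduce-correct true f l γ)) (sym (assoc _ _ _)))
  reduce-correct false (e ⊗ f) l γ =
    trans (reduce-correct false f _ γ) (trans (∙-congˡ (reduce-correct false e l γ))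
      (trans (sym (assoc _ _ _)) (∙-congʳ (sym (⁻¹-anti-homo-∙ _ _)))))
  reduce-correct true (inv e) l γ = reduce-correct false e l γ
  reduce-correct false (inv e) l γ = trans (reduce-correct true e l γ) (∙-congʳ (sym (⁻¹-involutive _)))

  correct : ∀ {n} (e : Expr n) γ → ⟦ e ⇓⟧ γ ≈ ⟦ e ⟧ γ
  correct e γ = trans (reduce-correct true e [] γ) (identityʳ _)

  open Reflect setoid var ⟦_⟧ ⟦_⇓⟧ correct public using (solve; _⊜_)

-- Powers, conjugation and values of words

module Powers (G : Group 0ℓ 0ℓ) where
  open Group G
  open GroupProperties G
  open SetoidReasoning setoid
  open GroupSolver G

  infixr 9 _^_
  _^_ : Carrier → ℕ → Carrier
  _^_ = powℕ (groupOps G)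

  ^-cong : ∀ {x y} n → x ≈ y → x ^ n ≈ y ^ n
  ^-cong zero    e = refl
  ^-cong (suc n) e = ∙-cong e (^-cong n e)

  ^-+ : ∀ x m n → x ^ (m ℕ.+ n) ≈ x ^ m ∙ x ^ n
  ^-+ x zero    n = sym (identityˡ _)
  ^-+ x (suc m) n = trans (∙-congˡ (^-+ x m n)) (sym (assoc _ _ _))

  ^-* : ∀ x m n → x ^ (m ℕ.* n) ≈ (x ^ n) ^ m
  ^-* x zero    n = refl
  ^-* x (suc m) n = trans (^-+ x n (m ℕ.* n)) (∙-congˡ (^-* x m n))

  ε^ : ∀ n → ε ^ n ≈ ε
  ε^ zero    = refl
  ε^ (suc n) = trans (identityˡ _) (ε^ n)

  ^-commute : ∀ {x y} n → x ∙ y ≈ y ∙ x → x ^ n ∙ y ≈ y ∙ x ^ n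
  ^-commute zero e = trans (identityˡ _) (sym (identityʳ _))
  ^-commute {x} {y} (suc n) e = begin
    (x ∙ x ^ n) ∙ y ≈⟨ assoc _ _ _ ⟩
    x ∙ (x ^ n ∙ y) ≈⟨ ∙-congˡ (^-commute n e) ⟩
    x ∙ (y ∙ x ^ n) ≈⟨ assoc _ _ _ ⟨
    (x ∙ y) ∙ x ^ n ≈⟨ ∙-congʳ e ⟩
    (y ∙ x) ∙ x ^ n ≈⟨ assoc _ _ _ ⟩
    y ∙ (x ∙ x ^ n) ∎

  ^-multiple : ∀ x m n → x ^ n ≈ ε → x ^ (m ℕ.* n) ≈ ε
  ^-multiple x m n e = trans (^-* x m n) (trans (^-cong m e) (ε^ m))

  ^-% : ∀ x k n .{{_ : NonZero n}} → x ^ n ≈ ε → x ^ (k % n) ≈ x ^ k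
  ^-% x k n e = begin
    x ^ (k % n)                         ≈⟨ identityʳ _ ⟨
    x ^ (k % n) ∙ ε                     ≈⟨ ∙-congˡ (^-multiple x (k / n) n e) ⟨
    x ^ (k % n) ∙ x ^ (k / n ℕ.* n)     ≈⟨ ^-+ x (k % n) (k / n ℕ.* n) ⟨
    x ^ (k % n ℕ.+ k / n ℕ.* n)         ≡⟨ ≡.cong (x ^_) (m≡m%n+[m/n]*n k n) ⟨
    x ^ k ∎

  ⁻¹-power : ∀ {x} M → x ^ suc M ≈ ε → x ⁻¹ ≈ x ^ M
  ⁻¹-power M e = sym (inverseʳ-unique _ _ e)

  powℤ-power : ∀ {x} M → x ^ suc M ≈ ε → ∀ k → ∃[ n ] powℤ (groupOps G) x k ≈ x ^ n
  powℤ-power M e (+ n) = n , refl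
  -- As x^(M+1) = 1, the exponent -1 may be replaced by M, hence -(n + 1) by M (n + 1).
  powℤ-power {x} M e -[1+ n ] = M ℕ.* suc n , (begin
    (x ^ suc n) ⁻¹     ≈⟨ ⁻¹-power M eq ⟩
    (x ^ suc n) ^ M    ≈⟨ ^-* x M (suc n) ⟨
    x ^ (M ℕ.* suc n)  ∎)
    where
    eq : (x ^ suc n) ^ suc M ≈ ε
    eq = begin
      (x ^ suc n) ^ suc M   ≈⟨ ^-* x (suc M) (suc n) ⟨
      x ^ (suc M ℕ.* suc n) ≡⟨ ≡.cong (x ^_) (ℕₚ.*-comm (suc M) (suc n)) ⟩
      x ^ (suc n ℕ.* suc M) ≈⟨ ^-multiple x (suc n) (suc M) e ⟩
      ε ∎

  conj : Carrier → Carrier → Carrier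
  conj g x = g ∙ x ∙ g ⁻¹

  conj-cong : ∀ {g h x y} → g ≈ h → x ≈ y → conj g x ≈ conj h y
  conj-cong e f = ∙-cong (∙-cong e f) (⁻¹-cong e)

  conj-∙ : ∀ g x y → conj g (x ∙ y) ≈ conj g x ∙ conj g y
  conj-∙ = solve 3 (λ g x y → ((g ⊗ x ⊗ y) ⊗ inv g) ⊜ (((g ⊗ x) ⊗ inv g) ⊗ ((g ⊗ y) ⊗ inv g))) refl

  conj-conj : ∀ g h x → conj g (conj h x) ≈ conj (g ∙ h) x
  conj-conj = solve 3 (λ g h x → ((g ⊗ ((h ⊗ x) ⊗ inv h)) ⊗ inv g) ⊜ (((g ⊗ h) ⊗ x) ⊗ inv (g ⊗ h))) refl

  conj-commute : ∀ {g x} → g ∙ x ≈ x ∙ g → conj g x ≈ x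
  conj-commute {g} {x} e = trans (∙-congʳ e) (//-rightDividesʳ g x)

module Evaluation (G : Group 0ℓ 0ℓ) (ρ τ : Group.Carrier G) where
  open Group G
  open GroupProperties G
  open SetoidReasoning setoid
  open Powers G

  ev : Word → Carrier
  ev = eval (groupOps G) ρ τ

  ev-++ : ∀ v w → ev (v ++ w) ≈ ev v ∙ ev w
  ev-++ [] w = sym (identityˡ _)
  ev-++ (rho ∷ v) w = trans (∙-congˡ (ev-++ v w)) (sym (assoc _ _ _))
  ev-++ (rhoInv ∷ v) w = trans (∙-congˡ (ev-++ v w)) (sym (assoc _ _ _))
  ev-++ (tau ∷ v) w = trans (∙-congˡ (ev-++ v w)) (sym (assoc _ _ _))

powW : Word → ℕ → Word
powW w zero    = []
powW w (suc n) = w ++ powW w n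

-- Inverse in ⟨ρ, τ ∣ τ²⟩.
invL : Letter → Letter
invL rho    = rhoInv
invL rhoInv = rho
invL tau    = tau

invW : Word → Word
invW []      = []
invW (x ∷ w) = invW w ++ [ invL x ]

module Evaluation′ (G : Group 0ℓ 0ℓ) (ρ τ : Group.Carrier G) (τ² : Group._≈_ G (Group._∙_ G τ τ) (Group.ε G)) where
  open Group G
  open GroupProperties G
  open SetoidReasoning setoid
  open Powers G
  open Evaluation G ρ τ public

  ev-powW : ∀ w n → ev (powW w n) ≈ ev w ^ n
  ev-powW w zero    = refl
  ev-powW w (suc n) = trans (ev-++ w _) (∙-congˡ (ev-powW w n))

  evL : Letter → Carrier
  evL x = ev [ x ]

  ev-∷ : ∀ x w → ev (x ∷ w) ≈ evL x ∙ ev w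
  ev-∷ x w = ev-++ [ x ] w

  evL-inv : ∀ x → evL (invL x) ≈ evL x ⁻¹
  evL-inv rho = sym (trans (⁻¹-cong (identityʳ _)) (sym (identityʳ _)))
  evL-inv rhoInv = trans (identityʳ _) (sym (trans (⁻¹-cong (identityʳ _)) (⁻¹-involutive _)))
  evL-inv tau = inverseˡ-unique _ _ (trans (∙-cong (identityʳ _) (identityʳ _)) τ²)

  ev-inv : ∀ w → ev (invW w) ≈ ev w ⁻¹
  ev-inv [] = sym ε⁻¹≈ε
  ev-inv (x ∷ w) = begin
    ev (invW w ++ [ invL x ])  ≈⟨ ev-++ (invW w) _ ⟩
    ev (invW w) ∙ evL (invL x) ≈⟨ ∙-cong (ev-inv w) (evL-inv x) ⟩
    ev w ⁻¹ ∙ evL x ⁻¹         ≈⟨ ⁻¹-anti-homo-∙ _ _ ⟨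
    (evL x ∙ ev w) ⁻¹          ≈⟨ ⁻¹-cong (ev-∷ x w) ⟨
    ev (x ∷ w) ⁻¹ ∎

  τ⁻¹ : τ ⁻¹ ≈ τ
  τ⁻¹ = sym (inverseˡ-unique _ _ τ²)

-- Modules over dihedral groups

prime-coprime : ∀ {p k} → Prime p → ¬ p ∣ k → Coprime k p
prime-coprime pp p∤k (d∣k , d∣p) with prime⇒irreducible pp d∣p
... | inj₁ d≡1 = d≡1
... | inj₂ ≡.refl = contradiction d∣k p∤k

module Torsion (G : Group 0ℓ 0ℓ) where
  open Group G
  open Powers G

  coprime-torsion : ∀ {k n x} → Coprime k n → x ^ n ≈ ε → x ^ k ≈ ε → x ≈ ε
  coprime-torsion {k} {n} {x} c eₙ eₖ with coprime-Bézout c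
  ... | Bézout.+- a b eq = trans (sym (identityʳ x)) (trans (∙-congˡ (sym (^-multiple x b n eₙ)))
          (trans (reflexive (≡.cong (x ^_) eq)) (^-multiple x a k eₖ)))
  ... | Bézout.-+ a b eq = trans (sym (identityʳ x)) (trans (∙-congˡ (sym (^-multiple x a k eₖ)))
          (trans (reflexive (≡.cong (x ^_) eq)) (^-multiple x b n eₙ)))

  prime-torsion : ∀ {p k x} → Prime p → ¬ p ∣ k → x ^ p ≈ ε → x ^ k ≈ ε → x ≈ ε
  prime-torsion pp p∤k = coprime-torsion (prime-coprime pp p∤k)

iterate : {X : Set} → (X → X) → ℕ → X → X
iterate f zero    x = x
iterate f (suc i) x = f (iterate f i x)

-- A module over 𝔽_p[D_{2r}], written multiplicatively; A and B are the
-- actions of a rotation and of a reflection.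
record DihedralModule (p r : ℕ) : Set₁ where
  field
    𝕍 : AbelianGroup 0ℓ 0ℓ
  open AbelianGroup 𝕍
  open Powers group
  field
    A B      : Carrier → Carrier
    A-cong   : ∀ {x y} → x ≈ y → A x ≈ A y
    B-cong   : ∀ {x y} → x ≈ y → B x ≈ B y
    A-∙      : ∀ x y → A (x ∙ y) ≈ A x ∙ A y
    B-∙      : ∀ x y → B (x ∙ y) ≈ B x ∙ B y
    A-period : ∀ x → iterate A r x ≈ x
    B-period : ∀ x → B (B x) ≈ x
    ABA      : ∀ x → A (B (A x)) ≈ B x
    torsion  : ∀ x → x ^ p ≈ ε

module DihedralModuleProperties {p r : ℕ} .{{_ : NonZero r}} (M : DihedralModule p r) where
  open DihedralModule M
  open AbelianGroup 𝕍
  open Powers group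
  open GroupProperties group
  open CommutativeSemigroupProperties commutativeSemigroup using (interchange)
  open SetoidReasoning setoid

  A-ε : A ε ≈ ε
  A-ε = identityʳ-unique _ _ (trans (sym (A-∙ ε ε)) (A-cong (identityˡ ε)))

  B-ε : B ε ≈ ε
  B-ε = identityʳ-unique _ _ (trans (sym (B-∙ ε ε)) (B-cong (identityˡ ε)))

  Aⁿ : ℕ → Carrier → Carrier
  Aⁿ = iterate A

  Aⁿ-cong : ∀ i {x y} → x ≈ y → Aⁿ i x ≈ Aⁿ i y
  Aⁿ-cong zero    e = e
  Aⁿ-cong (suc i) e = A-cong (Aⁿ-cong i e)

  Aⁿ-∙ : ∀ i x y → Aⁿ i (x ∙ y) ≈ Aⁿ i x ∙ Aⁿ i y
  Aⁿ-∙ zero    x y = refl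
  Aⁿ-∙ (suc i) x y = trans (A-cong (Aⁿ-∙ i x y)) (A-∙ _ _)

  Aⁿ-+ : ∀ i j x → Aⁿ (i ℕ.+ j) x ≡ Aⁿ i (Aⁿ j x)
  Aⁿ-+ zero    j x = ≡.refl
  Aⁿ-+ (suc i) j x = ≡.cong A (Aⁿ-+ i j x)

  Aⁿ-A : ∀ i x → Aⁿ i (A x) ≡ A (Aⁿ i x)
  Aⁿ-A zero x = ≡.refl
  Aⁿ-A (suc i) x = ≡.cong A (Aⁿ-A i x)

  Ā : Carrier → Carrier
  Ā = Aⁿ (pred r)

  AĀ : ∀ x → A (Ā x) ≈ x
  AĀ x = trans (reflexive (≡.cong (λ n → Aⁿ n x) (ℕₚ.suc-pred r))) (A-period x)

  ĀA : ∀ x → Ā (A x) ≈ x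
  ĀA x = trans (reflexive (Aⁿ-A (pred r) x)) (AĀ x)

  AB : ∀ x → A (B x) ≈ B (Ā x)
  AB x = trans (A-cong (B-cong (sym (AĀ x)))) (ABA (Ā x))

  BA : ∀ x → B (A x) ≈ Ā (B x)
  BA x = trans (sym (ĀA _)) (Aⁿ-cong (pred r) (ABA x))

  -- Exponents stay natural: A^(r-1) is the inverse of A, so `i * pred r` plays the part of -i.
  BAⁿ : ∀ i x → B (Aⁿ i x) ≈ Aⁿ (i ℕ.* pred r) (B x)
  BAⁿ zero x = refl
  BAⁿ (suc i) x = begin
    B (A (Aⁿ i x))                          ≈⟨ BA _ ⟩
    Ā (B (Aⁿ i x))                          ≈⟨ Aⁿ-cong (pred r) (BAⁿ i x) ⟩
    Aⁿ (pred r) (Aⁿ (i ℕ.* pred r) (B x))   ≡⟨ Aⁿ-+ (pred r) (i ℕ.* pred r) (B x) ⟨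
    Aⁿ (pred r ℕ.+ i ℕ.* pred r) (B x)      ∎

  -- The action of the element Σ_{i∈y} aⁱ of the group ring.
  Y : List ℕ → Carrier → Carrier
  Y []      x = ε
  Y (i ∷ y) x = Aⁿ i x ∙ Y y x

  Y-cong : ∀ y {x x′} → x ≈ x′ → Y y x ≈ Y y x′
  Y-cong []      e = refl
  Y-cong (i ∷ y) e = ∙-cong (Aⁿ-cong i e) (Y-cong y e)

  Y-∙ : ∀ y x x′ → Y y (x ∙ x′) ≈ Y y x ∙ Y y x′
  Y-∙ []      x x′ = sym (identityˡ ε)
  Y-∙ (i ∷ y) x x′ = trans (∙-cong (Aⁿ-∙ i x x′) (Y-∙ y x x′)) (interchange _ _ _ _)

  Y-++ : ∀ y z x → Y (y ++ z) x ≈ Y y x ∙ Y z x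
  Y-++ []      z x = sym (identityˡ _)
  Y-++ (i ∷ y) z x = trans (∙-congˡ (Y-++ y z x)) (sym (assoc _ _ _))

  Y-A : ∀ y x → Y y (A x) ≈ A (Y y x)
  Y-A []      x = sym A-ε
  Y-A (i ∷ y) x = trans (∙-cong (reflexive (Aⁿ-A i x)) (Y-A y x)) (sym (A-∙ _ _))

  Y-Aⁿ : ∀ i y x → Y y (Aⁿ i x) ≈ Aⁿ i (Y y x)
  Y-Aⁿ zero    y x = refl
  Y-Aⁿ (suc i) y x = trans (Y-A y _) (A-cong (Y-Aⁿ i y x))

  Aⁿ-ε : ∀ i → Aⁿ i ε ≈ ε
  Aⁿ-ε zero    = refl
  Aⁿ-ε (suc i) = trans (A-cong (Aⁿ-ε i)) A-ε

  Y-shift : ∀ j y x → Y (List.map (j ℕ.+_) y) x ≈ Aⁿ j (Y y x)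
  Y-shift j []      x = sym (Aⁿ-ε j)
  Y-shift j (i ∷ y) x = trans (∙-cong (reflexive (Aⁿ-+ j i x)) (Y-shift j y x)) (sym (Aⁿ-∙ j _ _))

  B-Y : ∀ y x → B (Y y x) ≈ Y (List.map (ℕ._* pred r) y) (B x)
  B-Y []      x = B-ε
  B-Y (i ∷ y) x = trans (B-∙ _ _) (∙-cong (BAⁿ i x) (B-Y y x))

  -- The action of y + ȳ, since conjugation by B negates the exponents of y. Written this way, B
  -- just exchanges the two summands.
  Q : List ℕ → Carrier → Carrier
  Q y x = Y y x ∙ B (Y y (B x))

  Q-cong : ∀ y {x x′} → x ≈ x′ → Q y x ≈ Q y x′
  Q-cong y e = ∙-cong (Y-cong y e) (B-cong (Y-cong y (B-cong e)))

  Q-∙ : ∀ y x x′ → Q y (x ∙ x′) ≈ Q y x ∙ Q y x′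
  Q-∙ y x x′ = trans (∙-cong (Y-∙ y x x′) (trans (B-cong (trans (Y-cong y (B-∙ x x′)) (Y-∙ y _ _))) (B-∙ _ _)))
                     (interchange _ _ _ _)

  Q-ε : ∀ y → Q y ε ≈ ε
  Q-ε y = identityʳ-unique _ _ (trans (sym (Q-∙ y ε ε)) (Q-cong y (identityˡ ε)))

  Q-⁻¹ : ∀ y x → Q y (x ⁻¹) ≈ Q y x ⁻¹
  Q-⁻¹ y x = inverseʳ-unique _ _ (trans (sym (Q-∙ y x (x ⁻¹))) (trans (Q-cong y (inverseʳ x)) (Q-ε y)))

  Q-A : ∀ y x → Q y (A x) ≈ A (Q y x)
  Q-A y x = trans (∙-cong (Y-A y x) (begin
    B (Y y (B (A x)))      ≈⟨ B-cong (Y-cong y (BA x)) ⟩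
    B (Y y (Ā (B x)))      ≈⟨ B-cong (Y-Aⁿ (pred r) y (B x)) ⟩
    B (Ā (Y y (B x)))      ≈⟨ AB _ ⟨
    A (B (Y y (B x)))      ∎)) (sym (A-∙ _ _))

  Q-B : ∀ y x → Q y (B x) ≈ B (Q y x)
  Q-B y x = begin
    Y y (B x) ∙ B (Y y (B (B x))) ≈⟨ ∙-congˡ (B-cong (Y-cong y (B-period x))) ⟩
    Y y (B x) ∙ B (Y y x)         ≈⟨ comm _ _ ⟩
    B (Y y x) ∙ Y y (B x)         ≈⟨ ∙-congˡ (B-period _) ⟨
    B (Y y x) ∙ B (B (Y y (B x))) ≈⟨ B-∙ _ _ ⟨
    B (Q y x)                     ∎

  -- The right-hand side depends on y through `Y y x` alone, so the vanishing of `Q` for all shifts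
  -- of y is a condition that can be stated for any element of the module.
  Q-shift : ∀ j y x → B x ≈ x → Q (List.map (j ℕ.+_) y) x ≈ Aⁿ j (Y y x) ∙ B (Aⁿ j (Y y x))
  Q-shift j y x Bx = ∙-cong (Y-shift j y x) (B-cong (trans (Y-cong (List.map (j ℕ.+_) y) Bx) (Y-shift j y x)))

  Y-trivial : ∀ y x → A x ≈ x → Y y x ≈ x ^ List.length y
  Y-trivial []      x Ax = refl
  Y-trivial (i ∷ y) x Ax = ∙-cong (fix i) (Y-trivial y x Ax)
    where
    fix : ∀ i → Aⁿ i x ≈ x
    fix zero    = refl
    fix (suc i) = trans (A-cong (fix i)) Ax

  -- On trivial vectors y + ȳ acts as the integer 2 · length y, which does not depend on the module.
  Q-trivial : ∀ y x → A x ≈ x → B x ≈ x → Q y x ≈ x ^ (List.length y ℕ.+ List.length y)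
  Q-trivial y x Ax Bx = trans (∙-cong (Y-trivial y x Ax)
      (trans (B-cong (trans (Y-cong y Bx) (Y-trivial y x Ax))) (B^ (List.length y))))
      (sym (^-+ x (List.length y) (List.length y)))
    where
    B^ : ∀ n → B (x ^ n) ≈ x ^ n
    B^ zero    = B-ε
    B^ (suc n) = trans (B-∙ _ _) (∙-cong Bx (B^ n))

  Q-Aⁿ : ∀ y i x → Q y (Aⁿ i x) ≈ Aⁿ i (Q y x)
  Q-Aⁿ y zero    x = refl
  Q-Aⁿ y (suc i) x = trans (Q-A y _) (A-cong (Q-Aⁿ y i x))

  Q-Y : ∀ y z x → Q y (Y z x) ≈ Y z (Q y x)
  Q-Y y []      x = Q-ε y
  Q-Y y (i ∷ z) x = trans (Q-∙ y _ _) (∙-cong (Q-Aⁿ y i x) (Q-Y y z x))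

  Q-comm : ∀ y z x → Q y (Q z x) ≈ Q z (Q y x)
  Q-comm y z x = trans (Q-∙ y _ _) (∙-cong (Q-Y y z x)
    (trans (Q-B y _) (B-cong (trans (Q-Y y z (B x)) (Y-cong z (Q-B y x))))))

  Qs : ∀ {n} → (Fin n → List ℕ) → Carrier → Carrier
  Qs {zero}  ys x = x
  Qs {suc n} ys x = Q (ys zero) (Qs (λ i → ys (suc i)) x)

  Q-Qs : ∀ {n} y (ys : Fin n → List ℕ) x → Q y (Qs ys x) ≈ Qs ys (Q y x)
  Q-Qs {zero}  y ys x = refl
  Q-Qs {suc n} y ys x = trans (Q-comm y (ys zero) _) (Q-cong (ys zero) (Q-Qs y (λ i → ys (suc i)) x))

  Qs-cong : ∀ {n} (ys : Fin n → List ℕ) {x x′} → x ≈ x′ → Qs ys x ≈ Qs ys x′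
  Qs-cong {zero}  ys e = e
  Qs-cong {suc n} ys e = Q-cong (ys zero) (Qs-cong (λ i → ys (suc i)) e)

  Qs-ε : ∀ {n} (ys : Fin n → List ℕ) → Qs ys ε ≈ ε
  Qs-ε {zero}  ys = refl
  Qs-ε {suc n} ys = trans (Q-cong (ys zero) (Qs-ε (λ i → ys (suc i)))) (Q-ε (ys zero))

  -- The operators commute, so the one that kills x may be applied first.
  Qs-vanish : ∀ {n} (ys : Fin n → List ℕ) j x → Q (ys j) x ≈ ε → Qs ys x ≈ ε
  Qs-vanish ys zero    x e = trans (Q-Qs (ys zero) (λ i → ys (suc i)) x) (trans (Qs-cong (λ i → ys (suc i)) e) (Qs-ε (λ i → ys (suc i))))
  Qs-vanish ys (suc j) x e = trans (Q-cong (ys zero) (Qs-vanish (λ i → ys (suc i)) j x e)) (Q-ε (ys zero))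

toℕ-mod : ∀ m n .{{_ : NonZero n}} → toℕ (m mod n) ≡ m % n
toℕ-mod m n = Finₚ.toℕ-fromℕ< _

-- As Aʳ = 1 and p x = 0, a list of exponents acts through r coefficients modulo p. So the operators
-- `Q y` form a finite family, over which existence can be decided.
module FiniteCoefficients {p : ℕ} .{{_ : NonZero p}} where

  fromVec : ∀ {k} → Vec (Fin p) k → List ℕ
  fromVec []      = []
  fromVec (c ∷ n) = List.replicate (toℕ c) 0 ++ List.map suc (fromVec n)

  increment : ∀ {k} → Fin k → Vec (Fin p) k → Vec (Fin p) k
  increment zero    (c ∷ n) = (suc (toℕ c) mod p) ∷ n
  increment (suc i) (c ∷ n) = c ∷ increment i n

  toVec : ∀ {r} .{{_ : NonZero r}} → List ℕ → Vec (Fin p) r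
  toVec {r} []      = Vec.replicate r (0 mod p)
  toVec {r} (i ∷ y) = increment (i mod r) (toVec y)

  module _ {r : ℕ} .{{_ : NonZero r}} (M : DihedralModule p r) where
    open DihedralModule M
    open AbelianGroup 𝕍
    open Powers group
    open DihedralModuleProperties M
    open SetoidReasoning setoid

    Aⁿ-multiple : ∀ q x → Aⁿ (q ℕ.* r) x ≈ x
    Aⁿ-multiple zero    x = refl
    Aⁿ-multiple (suc q) x = trans (reflexive (Aⁿ-+ r (q ℕ.* r) x)) (trans (A-period _) (Aⁿ-multiple q x))

    Aⁿ-% : ∀ x k → Aⁿ (k % r) x ≈ Aⁿ k x
    Aⁿ-% x k = begin
      Aⁿ (k % r) x                        ≈⟨ Aⁿ-cong (k % r) (Aⁿ-multiple (k / r) x) ⟨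
      Aⁿ (k % r) (Aⁿ (k / r ℕ.* r) x)     ≡⟨ Aⁿ-+ (k % r) (k / r ℕ.* r) x ⟨
      Aⁿ (k % r ℕ.+ k / r ℕ.* r) x        ≡⟨ ≡.cong (λ n → Aⁿ n x) (m≡m%n+[m/n]*n k r) ⟨
      Aⁿ k x ∎

    Y-replicate : ∀ c x → Y (List.replicate c 0) x ≈ x ^ c
    Y-replicate zero    x = refl
    Y-replicate (suc c) x = ∙-congˡ (Y-replicate c x)

    Y-fromVec : ∀ {k} c (n : Vec (Fin p) k) x → Y (fromVec (c ∷ n)) x ≈ x ^ toℕ c ∙ A (Y (fromVec n) x)
    Y-fromVec c n x = trans (Y-++ (List.replicate (toℕ c) 0) _ x) (∙-cong (Y-replicate (toℕ c) x) (Y-shift 1 (fromVec n) x))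

    Y-increment : ∀ {k} i (n : Vec (Fin p) k) x → Y (fromVec (increment i n)) x ≈ Aⁿ (toℕ i) x ∙ Y (fromVec n) x
    Y-increment zero (c ∷ n) x = begin
      Y (fromVec ((suc (toℕ c) mod p) ∷ n)) x             ≈⟨ Y-fromVec (suc (toℕ c) mod p) n x ⟩
      x ^ toℕ (suc (toℕ c) mod p) ∙ A (Y (fromVec n) x)   ≡⟨ ≡.cong (λ k → x ^ k ∙ A (Y (fromVec n) x)) (toℕ-mod (suc (toℕ c)) p) ⟩
      x ^ (suc (toℕ c) % p) ∙ A (Y (fromVec n) x)         ≈⟨ ∙-congʳ (^-% x (suc (toℕ c)) p (torsion x)) ⟩
      (x ∙ x ^ toℕ c) ∙ A (Y (fromVec n) x)               ≈⟨ assoc _ _ _ ⟩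
      x ∙ (x ^ toℕ c ∙ A (Y (fromVec n) x))               ≈⟨ ∙-congˡ (Y-fromVec c n x) ⟨
      x ∙ Y (fromVec (c ∷ n)) x ∎
    Y-increment (suc i) (c ∷ n) x = begin
      Y (fromVec (c ∷ increment i n)) x                     ≈⟨ Y-fromVec c (increment i n) x ⟩
      x ^ toℕ c ∙ A (Y (fromVec (increment i n)) x)         ≈⟨ ∙-congˡ (trans (A-cong (Y-increment i n x)) (A-∙ _ _)) ⟩
      x ^ toℕ c ∙ (Aⁿ (suc (toℕ i)) x ∙ A (Y (fromVec n) x)) ≈⟨ assoc _ _ _ ⟨
      (x ^ toℕ c ∙ Aⁿ (suc (toℕ i)) x) ∙ A (Y (fromVec n) x) ≈⟨ ∙-congʳ (comm _ _) ⟩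
      (Aⁿ (suc (toℕ i)) x ∙ x ^ toℕ c) ∙ A (Y (fromVec n) x) ≈⟨ assoc _ _ _ ⟩
      Aⁿ (suc (toℕ i)) x ∙ (x ^ toℕ c ∙ A (Y (fromVec n) x)) ≈⟨ ∙-congˡ (Y-fromVec c n x) ⟨
      Aⁿ (suc (toℕ i)) x ∙ Y (fromVec (c ∷ n)) x ∎

    Y-zeros : ∀ k x → Y (fromVec (Vec.replicate k (0 mod p))) x ≈ ε
    Y-zeros zero    x = refl
    Y-zeros (suc k) x = trans (Y-fromVec (0 mod p) (Vec.replicate k (0 mod p)) x)
      (trans (∙-cong (trans (reflexive (≡.cong (x ^_) (toℕ-mod 0 p))) (^-% x 0 p (torsion x))) (trans (A-cong (Y-zeros k x)) A-ε)) (identityˡ ε))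

    Y-toVec : ∀ y x → Y (fromVec (toVec {r} y)) x ≈ Y y x
    Y-toVec []      x = Y-zeros r x
    Y-toVec (i ∷ y) x = trans (Y-increment (i mod r) (toVec y) x)
      (∙-cong (trans (reflexive (≡.cong (λ n → Aⁿ n x) (toℕ-mod i r))) (Aⁿ-% x i)) (Y-toVec y x))

    Q-toVec : ∀ y x → Q (fromVec (toVec {r} y)) x ≈ Q y x
    Q-toVec y x = ∙-cong (Y-toVec y x) (B-cong (Y-toVec y (B x)))

anyVec? : ∀ {p k} {P : Vec (Fin p) k → Set} → (∀ n → Dec (P n)) → Dec (∃ P)
anyVec? {k = zero} P? with P? []
... | yes q = yes ([] , q)
... | no ¬q = no λ { ([] , q) → ¬q q }
anyVec? {k = suc k} P? with Finₚ.any? (λ c → anyVec? (λ n → P? (c ∷ n)))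
... | yes (c , n , q) = yes (c ∷ n , q)
... | no ¬q = no λ { (c ∷ n , q) → ¬q (c , n , q) }

-- Normal forms of words

-- A group G with a pair ρ, τ and an elementary abelian normal p-subgroup V,
-- modulo which ρ and τ are involutions whose product has order dividing r;
-- sg is the sign of the dihedral quotient.
record Pre (p r : ℕ) : Set₁ where
  field
    G : Group 0ℓ 0ℓ
  open Group G
  open Powers G
  field
    ρ τ    : Carrier
    _≟_    : ∀ x y → Dec (x ≈ y)
    τ²     : τ ∙ τ ≈ ε
    V      : Carrier → Set
    V-resp : ∀ {x y} → x ≈ y → V x → V y
    V-ε    : V ε
    V-∙    : ∀ {x y} → V x → V y → V (x ∙ y)
    V-⁻¹   : ∀ {x} → V x → V (x ⁻¹)
    V-conj : ∀ g {x} → V x → V (conj g x)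
    V-comm : ∀ {x y} → V x → V y → x ∙ y ≈ y ∙ x
    V-tors : ∀ {x} → V x → x ^ p ≈ ε
    sg     : Carrier → Bool
    sg-cong : ∀ {x y} → x ≈ y → sg x ≡ sg y
    sg-∙   : ∀ x y → sg (x ∙ y) ≡ sg x xor sg y
    sg-V   : ∀ {x} → V x → sg x ≡ false
    sg-ρ   : sg ρ ≡ true
    sg-τ   : sg τ ≡ true
    ρ²∈V   : V (ρ ∙ ρ)
    aʳ∈V   : V ((ρ ∙ τ) ^ r)

  a : Carrier
  a = ρ ∙ τ

  open Evaluation′ G ρ τ τ² public using (ev; ev-++; ev-powW; ev-inv; τ⁻¹; ev-∷)

uW aW āW : Word
uW = rho ∷ rho ∷ []
aW = rho ∷ tau ∷ []
āW = tau ∷ rhoInv ∷ []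

-- Word counterparts of A and B. With `sumY` and `sumQ` they allow an operator found in one module
-- to be evaluated in all the groups at once.
conjA conjB : Word → Word
conjA w = aW ++ w ++ āW
conjB w = rho ∷ w ++ [ rhoInv ]

sumY : List ℕ → Word → Word
sumY []      w = []
sumY (i ∷ y) w = iterate conjA i w ++ sumY y w

sumQ : List ℕ → Word → Word
sumQ y w = sumY y w ++ conjB (sumY y (conjB w))

-- The exponents i in τ aᵏ τ = (∏ᵢ aⁱ ρ² a⁻ⁱ) a⁻ᵏ.
twist : ℕ → ℕ → List ℕ
twist r zero    = []
twist r (suc k) = List.map (pred r ℕ.+_) (0 ∷ twist r k)

tauW : Bool → Word
tauW false = []
tauW true  = [ tau ]

nfW : List ℕ → ℕ → Bool → Word
nfW y k e = sumY y uW ++ powW aW k ++ tauW e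

module PreProperties {p r : ℕ} .{{_ : NonZero p}} .{{_ : NonZero r}} (P : Pre p r) where
  open Pre P public
  open Group G
  open GroupProperties G
  open GroupSolver G
  open SetoidReasoning setoid
  open Powers G

  𝕍 : AbelianGroup 0ℓ 0ℓ
  𝕍 = record
    { Carrier = Σ Carrier V
    ; _≈_ = λ x y → proj₁ x ≈ proj₁ y
    ; _∙_ = λ x y → proj₁ x ∙ proj₁ y , V-∙ (proj₂ x) (proj₂ y)
    ; ε = ε , V-ε
    ; _⁻¹ = λ x → proj₁ x ⁻¹ , V-⁻¹ (proj₂ x)
    ; isAbelianGroup = record
      { isGroup = record
        { isMonoid = record
          { isSemigroup = record
            { isMagma = record
              { isEquivalence = record { refl = refl ; sym = sym ; trans = trans }
              ; ∙-cong = ∙-cong }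
            ; assoc = λ x y z → assoc (proj₁ x) (proj₁ y) (proj₁ z) }
          ; identity = (λ x → identityˡ (proj₁ x)) , (λ x → identityʳ (proj₁ x)) }
        ; inverse = (λ x → inverseˡ (proj₁ x)) , (λ x → inverseʳ (proj₁ x))
        ; ⁻¹-cong = ⁻¹-cong }
      ; comm = λ x y → V-comm (proj₂ x) (proj₂ y) } }

  module 𝕍 = AbelianGroup 𝕍
  module 𝕍^ = Powers 𝕍.group

  proj-^ : ∀ x n → proj₁ (x 𝕍^.^ n) ≡ proj₁ x ^ n
  proj-^ x zero    = ≡.refl
  proj-^ x (suc n) = ≡.cong (proj₁ x ∙_) (proj-^ x n)

  conj-V : ∀ {g x} → V g → V x → conj g x ≈ x
  conj-V vg vx = conj-commute (V-comm vg vx)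

  A B : 𝕍.Carrier → 𝕍.Carrier
  A (x , v) = conj a x , V-conj a v
  B (x , v) = conj ρ x , V-conj ρ v

  iterate-A : ∀ i x → proj₁ (iterate A i x) ≈ conj (a ^ i) (proj₁ x)
  iterate-A zero (x , v) = sym (solve 1 (λ x → ((one ⊗ x) ⊗ inv one) ⊜ x) refl x)
  iterate-A (suc i) x = trans (conj-cong refl (iterate-A i x)) (conj-conj _ _ _)

  u : 𝕍.Carrier
  u = ρ ∙ ρ , ρ²∈V

  -- The factor behind ρ is a conjugate of ρ² and lies in V, which is abelian. Hence aρa and ρ act
  -- alike on V, which is the dihedral relation ABA = B.
  aρa : a ∙ (ρ ∙ a) ≈ ρ ∙ conj τ (ρ ∙ ρ)
  aρa = trans (solve 2 (λ ρ τ → ((ρ ⊗ τ) ⊗ ρ ⊗ ρ ⊗ τ) ⊜ (ρ ⊗ ((τ ⊗ ρ ⊗ ρ) ⊗ τ))) refl ρ τ)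
              (∙-congˡ (∙-congˡ (sym τ⁻¹)))

  module-V : DihedralModule p r
  module-V = record
    { 𝕍 = 𝕍 ; A = A ; B = B
    ; A-cong = conj-cong refl ; B-cong = conj-cong refl
    ; A-∙ = λ x y → conj-∙ _ _ _ ; B-∙ = λ x y → conj-∙ _ _ _
    ; A-period = λ x → trans (iterate-A r x) (conj-V aʳ∈V (proj₂ x))
    ; B-period = λ x → trans (conj-conj _ _ _) (conj-V ρ²∈V (proj₂ x))
    ; ABA = λ x → trans (conj-cong refl (conj-conj _ _ _)) (trans (conj-conj _ _ _)
        (trans (conj-cong aρa refl) (trans (sym (conj-conj _ _ _))
          (conj-cong refl (conj-V (V-conj τ ρ²∈V) (proj₂ x))))))
    ; torsion = λ x → trans (reflexive (proj-^ x p)) (V-tors (proj₂ x)) }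

  open DihedralModule module-V public using (A-cong; B-cong; A-∙; B-∙; B-period; torsion)
  open DihedralModuleProperties module-V public

  Bu : B u 𝕍.≈ u
  Bu = solve 1 (λ ρ → ((ρ ⊗ ρ ⊗ ρ) ⊗ inv ρ) ⊜ (ρ ⊗ ρ)) refl ρ

  conj-τ : ∀ x → conj τ (proj₁ x) ≈ proj₁ (B (A x))
  conj-τ (x , v) = begin
    conj τ x                   ≈⟨ B-period (conj τ x , V-conj τ v) ⟨
    conj ρ (conj ρ (conj τ x)) ≈⟨ conj-cong refl (conj-conj _ _ _) ⟩
    conj ρ (conj a x)          ∎

  sg-ε : sg ε ≡ false
  sg-ε = sg-V V-ε

  sg-a : sg a ≡ false
  sg-a = ≡.trans (sg-∙ ρ τ) (≡.cong₂ _xor_ sg-ρ sg-τ)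

  sg-^ : ∀ {x} n → sg x ≡ false → sg (x ^ n) ≡ false
  sg-^ zero e = sg-ε
  sg-^ {x} (suc n) e = ≡.trans (sg-∙ x (x ^ n)) (≡.cong₂ _xor_ e (sg-^ n e))

  a-order : a ^ (p ℕ.* r) ≈ ε
  a-order = trans (^-* a p r) (V-tors aʳ∈V)

  private instance
    pr≢0 : NonZero (p ℕ.* r)
    pr≢0 = ℕₚ.m*n≢0 p r

  a-order′ : a ^ suc (pred (p ℕ.* r)) ≈ ε
  a-order′ = trans (reflexive (≡.cong (a ^_) (ℕₚ.suc-pred (p ℕ.* r)))) a-order

  ρ-order : ρ ^ (p ℕ.* 2) ≈ ε
  ρ-order = trans (^-* ρ p 2) (trans (^-cong p (∙-congˡ (identityʳ ρ))) (V-tors ρ²∈V))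

  τ^ : Bool → Carrier
  τ^ false = ε
  τ^ true  = τ

  -- Modulo the normal closure of ρ², made up of products of the aⁱρ²a⁻ⁱ, the group ⟨ρ, τ⟩ is
  -- dihedral with elements aᵏ and aᵏτ.
  record NormalForm (g : Carrier) : Set where
    constructor normalForm
    field
      y  : List ℕ
      k  : ℕ
      e  : Bool
      nf : g ≈ proj₁ (Y y u) ∙ (a ^ k ∙ τ^ e)

  NF-resp : ∀ {g h} → h ≈ g → NormalForm g → NormalForm h
  NF-resp h≈g (normalForm y k e nf) = normalForm y k e (trans h≈g nf)

  NF-U : ∀ z {g} → NormalForm g → NormalForm (proj₁ (Y z u) ∙ g)
  NF-U z (normalForm y k e nf) = normalForm (z ++ y) k e
    (trans (∙-congˡ nf) (trans (sym (assoc _ _ _)) (∙-congʳ (sym (Y-++ z y u)))))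

  conj-shift : ∀ g x y → g ∙ (x ∙ y) ≈ conj g x ∙ (g ∙ y)
  conj-shift = solve 3 (λ g x y → (g ⊗ x ⊗ y) ⊜ (((g ⊗ x) ⊗ inv g) ⊗ (g ⊗ y))) refl

  NF-a : ∀ {g} → NormalForm g → NormalForm (a ∙ g)
  NF-a (normalForm y k e nf) = normalForm (List.map suc y) (suc k) e (trans (∙-congˡ nf)
    (trans (conj-shift _ _ _) (∙-cong (sym (Y-shift 1 y u)) (sym (assoc _ _ _)))))

  NF-a^ : ∀ n {g} → NormalForm g → NormalForm (a ^ n ∙ g)
  NF-a^ zero    f = NF-resp (identityˡ _) f
  NF-a^ (suc n) f = NF-resp (assoc _ _ _) (NF-a (NF-a^ n f))

  NF-a⁻¹ : ∀ {g} → NormalForm g → NormalForm (a ⁻¹ ∙ g)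
  NF-a⁻¹ f = NF-resp (∙-congʳ (⁻¹-power (pred (p ℕ.* r)) a-order′)) (NF-a^ (pred (p ℕ.* r)) f)

  Y-u : proj₁ (Y [ 0 ] u) ≈ ρ ∙ ρ
  Y-u = identityʳ _

  τa : τ ∙ a ≈ a ⁻¹ ∙ ((ρ ∙ ρ) ∙ τ)
  τa = trans (∙-congʳ (sym τ⁻¹))
    (solve 2 (λ ρ τ → (inv τ ⊗ ρ ⊗ τ) ⊜ (inv (ρ ⊗ τ) ⊗ ((ρ ⊗ ρ) ⊗ τ))) refl ρ τ)

  -- Each a that τ passes becomes a⁻¹ and leaves a factor ρ² behind.
  NF-τa : ∀ k e → NormalForm (τ ∙ (a ^ k ∙ τ^ e))
  NF-τa zero false = normalForm [] 0 true (solve 1 (λ τ → (τ ⊗ one ⊗ one) ⊜ (one ⊗ one ⊗ τ)) refl τ)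
  NF-τa zero true  = normalForm [] 0 false (trans (∙-congˡ (identityˡ τ)) (trans τ² (solve 0 (one ⊜ (one ⊗ one ⊗ one)) refl)))
  NF-τa (suc k) e  = NF-resp eq (NF-a⁻¹ (NF-U [ 0 ] (NF-τa k e)))
    where
    eq : τ ∙ ((a ∙ a ^ k) ∙ τ^ e) ≈ a ⁻¹ ∙ (proj₁ (Y [ 0 ] u) ∙ (τ ∙ (a ^ k ∙ τ^ e)))
    eq = begin
      τ ∙ ((a ∙ a ^ k) ∙ τ^ e)                         ≈⟨ solve 4 (λ t a x y → (t ⊗ ((a ⊗ x) ⊗ y)) ⊜ ((t ⊗ a) ⊗ (x ⊗ y))) refl _ _ _ _ ⟩
      (τ ∙ a) ∙ (a ^ k ∙ τ^ e)                         ≈⟨ ∙-congʳ τa ⟩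
      (a ⁻¹ ∙ ((ρ ∙ ρ) ∙ τ)) ∙ (a ^ k ∙ τ^ e)          ≈⟨ solve 4 (λ a u t x → ((a ⊗ (u ⊗ t)) ⊗ x) ⊜ (a ⊗ u ⊗ t ⊗ x)) refl _ _ _ _ ⟩
      a ⁻¹ ∙ ((ρ ∙ ρ) ∙ (τ ∙ (a ^ k ∙ τ^ e)))          ≈⟨ ∙-congˡ (∙-congʳ (sym Y-u)) ⟩
      a ⁻¹ ∙ (proj₁ (Y [ 0 ] u) ∙ (τ ∙ (a ^ k ∙ τ^ e))) ∎

  conj-τ-Y : ∀ y → conj τ (proj₁ (Y y u)) ≈ proj₁ (Y (List.map (ℕ._* pred r) (List.map suc y)) u)
  conj-τ-Y y = begin
    conj τ (proj₁ (Y y u))                             ≈⟨ conj-τ (Y y u) ⟩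
    proj₁ (B (A (Y y u)))                              ≈⟨ conj-cong refl (Y-shift 1 y u) ⟨
    proj₁ (B (Y (List.map suc y) u))                   ≈⟨ B-Y (List.map suc y) u ⟩
    proj₁ (Y (List.map (ℕ._* pred r) (List.map suc y)) (B u)) ≈⟨ Y-cong (List.map (ℕ._* pred r) (List.map suc y)) {B u} {u} Bu ⟩
    proj₁ (Y (List.map (ℕ._* pred r) (List.map suc y)) u)     ∎

  NF-τ : ∀ {g} → NormalForm g → NormalForm (τ ∙ g)
  NF-τ (normalForm y k e nf) = NF-resp
    (trans (∙-congˡ nf) (trans (conj-shift _ _ _) (∙-congʳ (conj-τ-Y y))))
    (NF-U (List.map (ℕ._* pred r) (List.map suc y)) (NF-τa k e))

  NF-word : ∀ w → NormalForm (ev w)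
  NF-word [] = normalForm [] 0 false (solve 0 (one ⊜ (one ⊗ one ⊗ one)) refl)
  -- `rho` is read as aτ and `rhoInv` as τa⁻¹, so multiplication by a, a⁻¹ and τ is all that is
  -- required.
  NF-word (rho ∷ w) = NF-resp (trans (∙-congʳ (trans (sym (//-rightDividesʳ τ ρ)) (∙-congˡ τ⁻¹))) (assoc _ _ _)) (NF-a (NF-τ (NF-word w)))
  NF-word (rhoInv ∷ w) = NF-resp
    (solve 3 (λ ρ τ g → (inv ρ ⊗ g) ⊜ (τ ⊗ (inv (ρ ⊗ τ) ⊗ g))) refl ρ τ (ev w))
    (NF-τ (NF-a⁻¹ (NF-word w)))
  NF-word (tau ∷ w) = NF-τ (NF-word w)

  NF-V : ∀ {g} (f : NormalForm g) → V g → NormalForm.e f ≡ false × V (a ^ NormalForm.k f)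
  NF-V {g} (normalForm y k e nf) vg = e-false e ≡.refl , V-resp (a^k e ≡.refl) vh
    where
    vh : V (a ^ k ∙ τ^ e)
    vh = V-resp (trans (∙-congˡ nf) (\\-leftDividesʳ _ _)) (V-∙ (V-⁻¹ (proj₂ (Y y u))) vg)
    e-false : ∀ e′ → e ≡ e′ → e ≡ false
    e-false false e≡ = e≡
    e-false true ≡.refl with () ← ≡.trans (≡.sym (≡.trans (sg-∙ (a ^ k) τ) (≡.cong₂ _xor_ (sg-^ k sg-a) sg-τ))) (sg-V vh)
    a^k : ∀ e′ → e ≡ e′ → a ^ k ∙ τ^ e ≈ a ^ k
    a^k false ≡.refl = identityʳ _
    a^k true e≡ with () ← ≡.trans (≡.sym (e-false true e≡)) e≡

  t : 𝕍.Carrier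
  t = a ^ r , aʳ∈V

  At : A t 𝕍.≈ t
  At = conj-commute (sym (^-commute r refl))

  conj-ā : ∀ x → conj (a ⁻¹) (proj₁ x) ≈ proj₁ (Ā x)
  conj-ā x = trans (conj-cong refl (sym (AĀ x))) (solve 2 (λ a x → ((inv a ⊗ ((a ⊗ x) ⊗ inv a)) ⊗ inv (inv a)) ⊜ x) refl a (proj₁ (Ā x)))

  τaτ : ∀ k → conj τ (a ^ k) ≈ proj₁ (Y (twist r k) u) ∙ (a ^ k) ⁻¹
  τaτ zero = solve 1 (λ τ → ((τ ⊗ one) ⊗ inv τ) ⊜ (one ⊗ inv one)) refl τ
  τaτ (suc k) = begin
    conj τ (a ∙ a ^ k)                                     ≈⟨ conj-∙ _ _ _ ⟩
    conj τ a ∙ conj τ (a ^ k)                              ≈⟨ ∙-cong (∙-congʳ τa) (τaτ k) ⟩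
    ((a ⁻¹ ∙ ((ρ ∙ ρ) ∙ τ)) ∙ τ ⁻¹) ∙ (proj₁ (Y (twist r k) u) ∙ (a ^ k) ⁻¹)
      ≈⟨ solve 5 (λ a u t y x → (((inv a ⊗ (u ⊗ t)) ⊗ inv t) ⊗ (y ⊗ inv x)) ⊜ (((inv a ⊗ (u ⊗ y)) ⊗ inv (inv a)) ⊗ inv (x ⊗ a))) refl a _ τ _ _ ⟩
    conj (a ⁻¹) ((ρ ∙ ρ) ∙ proj₁ (Y (twist r k) u)) ∙ (a ^ k ∙ a) ⁻¹ ≈⟨ ∙-cong (conj-ā (Y (0 ∷ twist r k) u)) (⁻¹-cong (^-commute k refl)) ⟩
    proj₁ (Ā (Y (0 ∷ twist r k) u)) ∙ (a ∙ a ^ k) ⁻¹             ≈⟨ ∙-congʳ (Y-shift (pred r) (0 ∷ twist r k) u) ⟨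
    proj₁ (Y (twist r (suc k)) u) ∙ (a ∙ a ^ k) ⁻¹ ∎

  -- Conjugation by τ, which acts as BA, inverts aʳ up to conjugates of ρ². This relation ties t to
  -- u.
  BAt∙t : (B (A t) 𝕍.∙ t) 𝕍.≈ Y (twist r r) u
  BAt∙t = trans (∙-congʳ (trans (sym (conj-τ t)) (τaτ r))) (//-rightDividesˡ _ _)

  _⊩_ : Word → 𝕍.Carrier → Set
  w ⊩ x = ev w ≈ proj₁ x

  ev-āW : ev āW ≈ a ⁻¹
  ev-āW = trans (∙-congʳ (sym τ⁻¹)) (solve 2 (λ ρ τ → (inv τ ⊗ inv ρ ⊗ one) ⊜ inv (ρ ⊗ τ)) refl ρ τ)

  ev-aW : ev aW ≈ a
  ev-aW = ∙-congˡ (identityʳ τ)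

  ⊩-u : uW ⊩ u
  ⊩-u = ∙-congˡ (identityʳ ρ)

  ⊩-A : ∀ {w x} → w ⊩ x → conjA w ⊩ A x
  ⊩-A {w} e = trans (ev-++ aW (w ++ āW)) (trans (∙-cong ev-aW (trans (ev-++ w āW) (∙-cong e ev-āW))) (sym (assoc _ _ _)))

  ⊩-B : ∀ {w x} → w ⊩ x → conjB w ⊩ B x
  ⊩-B {w} e = trans (∙-congˡ (trans (ev-++ w [ rhoInv ]) (∙-cong e (identityʳ _)))) (sym (assoc _ _ _))

  ⊩-Aⁿ : ∀ i {w x} → w ⊩ x → iterate conjA i w ⊩ Aⁿ i x
  ⊩-Aⁿ zero    e = e
  ⊩-Aⁿ (suc i) {w} {x} e = ⊩-A {iterate conjA i w} {Aⁿ i x} (⊩-Aⁿ i e)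

  ⊩-∙ : ∀ {w w′ x x′} → w ⊩ x → w′ ⊩ x′ → (w ++ w′) ⊩ (x 𝕍.∙ x′)
  ⊩-∙ {w} {w′} e e′ = trans (ev-++ w w′) (∙-cong e e′)

  ⊩-Y : ∀ y {w x} → w ⊩ x → sumY y w ⊩ Y y x
  ⊩-Y []      e = refl
  ⊩-Y (i ∷ y) {w} {x} e = ⊩-∙ {iterate conjA i w} {sumY y w} {Aⁿ i x} {Y y x} (⊩-Aⁿ i e) (⊩-Y y e)

  ⊩-Q : ∀ y {w x} → w ⊩ x → sumQ y w ⊩ Q y x
  ⊩-Q y {w} {x} e = ⊩-∙ {sumY y w} {conjB (sumY y (conjB w))} {Y y x} {B (Y y (B x))} (⊩-Y y e)
    (⊩-B {sumY y (conjB w)} {Y y (B x)} (⊩-Y y {conjB w} {B x} (⊩-B {w} {x} e)))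

  ⊩-t : powW aW r ⊩ t
  ⊩-t = trans (ev-powW aW r) (^-cong r ev-aW)

  ev-nfW : ∀ y k e → ev (nfW y k e) ≈ proj₁ (Y y u) ∙ (a ^ k ∙ τ^ e)
  ev-nfW y k e = trans (ev-++ (sumY y uW) _) (∙-cong (⊩-Y y {uW} {u} ⊩-u)
    (trans (ev-++ (powW aW k) (tauW e)) (∙-cong (trans (ev-powW aW k) (^-cong k ev-aW)) (ev-tauW e))))
    where
    ev-tauW : ∀ e → ev (tauW e) ≈ τ^ e
    ev-tauW false = refl
    ev-tauW true  = identityʳ τ

-- Irreducible groups

prodGroup : ∀ {m} → (Fin m → Group 0ℓ 0ℓ) → Group 0ℓ 0ℓ
prodGroup {m} G = record
  { Carrier = (i : Fin m) → Group.Carrier (G i)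
  ; _≈_ = λ x y → (i : Fin m) → Group._≈_ (G i) (x i) (y i)
  ; _∙_ = λ x y i → Group._∙_ (G i) (x i) (y i)
  ; ε = λ i → Group.ε (G i)
  ; _⁻¹ = λ x i → Group._⁻¹ (G i) (x i)
  ; isGroup = record
    { isMonoid = record
      { isSemigroup = record
        { isMagma = record
          { isEquivalence = record
            { refl = λ i → Group.refl (G i)
            ; sym = λ e i → Group.sym (G i) (e i)
            ; trans = λ e f i → Group.trans (G i) (e i) (f i) }
          ; ∙-cong = λ e f i → Group.∙-cong (G i) (e i) (f i) }
        ; assoc = λ x y z i → Group.assoc (G i) (x i) (y i) (z i) }
      ; identity = (λ x i → Group.identityˡ (G i) (x i)) , (λ x i → Group.identityʳ (G i) (x i)) }
    ; inverse = (λ x i → Group.inverseˡ (G i) (x i)) , (λ x i → Group.inverseʳ (G i) (x i))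
    ; ⁻¹-cong = λ e i → Group.⁻¹-cong (G i) (e i) } }

module _ {m : ℕ} (O : Fin m → Ops) where

  eval-prod : ∀ ρ τ w i → eval (prodOps O) ρ τ w i ≡ eval (O i) (ρ i) (τ i) w
  eval-prod ρ τ []           i = ≡.refl
  eval-prod ρ τ (rho ∷ w)    i = ≡.cong (Ops._∙_ (O i) (ρ i)) (eval-prod ρ τ w i)
  eval-prod ρ τ (rhoInv ∷ w) i = ≡.cong (Ops._∙_ (O i) _) (eval-prod ρ τ w i)
  eval-prod ρ τ (tau ∷ w)    i = ≡.cong (Ops._∙_ (O i) (τ i)) (eval-prod ρ τ w i)

  powℕ-prod : ∀ x n i → powℕ (prodOps O) x n i ≡ powℕ (O i) (x i) n
  powℕ-prod x zero    i = ≡.refl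
  powℕ-prod x (suc n) i = ≡.cong (Ops._∙_ (O i) (x i)) (powℕ-prod x n i)

prodPre : ∀ {p r m} → (Fin (suc m) → Pre p r) → Pre p r
prodPre {p} {r} P = record
  { G = prodGroup (λ i → Pre.G (P i))
  ; ρ = λ i → Pre.ρ (P i)
  ; τ = λ i → Pre.τ (P i)
  ; _≟_ = λ x y → Finₚ.all? (λ i → Pre._≟_ (P i) (x i) (y i))
  ; τ² = λ i → Pre.τ² (P i)
  ; V = λ x → ∀ i → Pre.V (P i) (x i)
  ; V-resp = λ e v i → Pre.V-resp (P i) (e i) (v i)
  ; V-ε = λ i → Pre.V-ε (P i)
  ; V-∙ = λ v w i → Pre.V-∙ (P i) (v i) (w i)
  ; V-⁻¹ = λ v i → Pre.V-⁻¹ (P i) (v i)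
  ; V-conj = λ g v i → Pre.V-conj (P i) (g i) (v i)
  ; V-comm = λ v w i → Pre.V-comm (P i) (v i) (w i)
  ; V-tors = λ {x} v i → ≡.subst (λ z → Group._≈_ (Pre.G (P i)) z (Group.ε (Pre.G (P i))))
               (≡.sym (powℕ-prod (λ i → groupOps (Pre.G (P i))) x p i)) (Pre.V-tors (P i) (v i))
  -- On values of words the signs of all factors agree, so that of the first one serves; this is why
  -- the family is indexed by `Fin (suc m)`.
  ; sg = λ x → Pre.sg (P zero) (x zero)
  ; sg-cong = λ e → Pre.sg-cong (P zero) (e zero)
  ; sg-∙ = λ x y → Pre.sg-∙ (P zero) (x zero) (y zero)
  ; sg-V = λ v → Pre.sg-V (P zero) (v zero)
  ; sg-ρ = Pre.sg-ρ (P zero)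
  ; sg-τ = Pre.sg-τ (P zero)
  ; ρ²∈V = λ i → Pre.ρ²∈V (P i)
  ; aʳ∈V = λ i → ≡.subst (Pre.V (P i)) (≡.sym (powℕ-prod (λ i → groupOps (Pre.G (P i))) _ r i)) (Pre.aʳ∈V (P i)) }

-- The semidirect product without its matrices: `ord` makes the quotient by V all of D_{2r}, and
-- `irr` has no scalars since multiples over 𝔽_p are sums. It concludes with ⊥ because membership in
-- W need not be decidable.
record Irr (p r : ℕ) .{{_ : NonZero p}} .{{_ : NonZero r}} : Set₁ where
  field
    pre : Pre p r
  open PreProperties pre
  open Group G using (_≈_)
  open Powers G using (_^_)
  field
    ord     : ∀ k → V (a ^ k) → r ∣ k
    gen     : ∀ x → ∃[ w ] ev w ≈ x
    nontriv : ∃[ x ] ¬ (x 𝕍.≈ 𝕍.ε)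
    irr     : (W : 𝕍.Carrier → Set) → (∀ {x y} → x 𝕍.≈ y → W x → W y) → W 𝕍.ε →
              (∀ x y → W x → W y → W (x 𝕍.∙ y)) → (∀ x → W x → W (A x)) → (∀ x → W x → W (B x)) →
              ∀ x → W x → ¬ (x 𝕍.≈ 𝕍.ε) → ∀ y → ¬ W y → ⊥

module _ {p r : ℕ} .{{_ : NonZero p}} .{{_ : NonZero r}} where

  -- The normal form is computed once, in the direct product of the two groups, so that both share
  -- y, k and e.
  module CommonNormalForm (P P′ : Pre p r) where
    private
      module K = PreProperties P
      module L = PreProperties P′
      module KG = Group K.G
      module LG = Group L.G
      open Powers K.G using () renaming (_^_ to _^K_)
      open Powers L.G using () renaming (_^_ to _^L_)

      pair : Fin 2 → Pre p r
      pair zero    = P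
      pair (suc _) = P′

      module PQ = PreProperties (prodPre pair)

      O : Fin 2 → Ops
      O i = groupOps (Pre.G (pair i))

    ev-pair₁ : ∀ w → PQ.ev w zero ≡ K.ev w
    ev-pair₁ w = eval-prod O _ _ w zero

    ev-pair₂ : ∀ w → PQ.ev w (suc zero) ≡ L.ev w
    ev-pair₂ w = eval-prod O _ _ w (suc zero)

    commonNF : ∀ w → Σ[ y ∈ List ℕ ] Σ[ k ∈ ℕ ] Σ[ e ∈ Bool ]
               (K.ev w KG.≈ K.ev (nfW y k e)) × (L.ev w LG.≈ L.ev (nfW y k e))
    commonNF w = y , k , e ,
      ≡.subst₂ KG._≈_ (ev-pair₁ w) (ev-pair₁ (nfW y k e)) (eq zero) ,
      ≡.subst₂ LG._≈_ (ev-pair₂ w) (ev-pair₂ (nfW y k e)) (eq (suc zero))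
      where
      open PQ.NormalForm (PQ.NF-word w)
      eq : Group._≈_ PQ.G (PQ.ev w) (PQ.ev (nfW y k e))
      eq = Group.trans PQ.G nf (Group.sym PQ.G (PQ.ev-nfW y k e))

    module _ (ord : ∀ k → K.V (K.a ^K k) → r ∣ k) where

      -- The sign excludes τ from the normal form of a word with value in V, and `ord` turns aᵏ into
      -- a power of t.
      commonV : ∀ w → K.V (K.ev w) → Σ[ y ∈ List ℕ ] Σ[ m ∈ ℕ ]
                (K.ev w KG.≈ proj₁ (K.Y y K.u K.𝕍.∙ (K.t K.𝕍^.^ m))) × (L.ev w LG.≈ proj₁ (L.Y y L.u L.𝕍.∙ (L.t L.𝕍^.^ m)))
      commonV w v with commonNF w
      ... | y , k , e , eqK , eqL with K.NF-V (K.normalForm y k e (KG.trans eqK (K.ev-nfW y k e))) v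
      ... | ≡.refl , vk with ord k vk
      ... | divides m ≡.refl = y , m ,
        KG.trans eqK (KG.trans (K.ev-nfW y k e) (KG.∙-congˡ (KG.trans (KG.identityʳ _)
          (KG.trans (Powers.^-* K.G K.a m r) (KG.reflexive (≡.sym (K.proj-^ K.t m))))))) ,
        LG.trans eqL (LG.trans (L.ev-nfW y k e) (LG.∙-congˡ (LG.trans (LG.identityʳ _)
          (LG.trans (Powers.^-* L.G L.a m r) (LG.reflexive (≡.sym (L.proj-^ L.t m)))))))

      V-transfer : ∀ w → K.V (K.ev w) → L.V (L.ev w)
      V-transfer w v with commonV w v
      ... | y , m , _ , eqL = L.V-resp (LG.sym eqL) (proj₂ (L.Y y L.u L.𝕍.∙ (L.t L.𝕍^.^ m)))

-- Irreducible modules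

multiple : ℕ → List ℕ → List ℕ
multiple zero    y = []
multiple (suc m) y = y ++ multiple m y

-- The exponents of 2 (y u + m t) as a combination of rotates of u alone, with `twist r r` standing
-- for 2t.
double : ℕ → List ℕ → ℕ → List ℕ
double r y m = (y ++ y) ++ multiple m (twist r r)

odd-prime∤2 : ∀ {p} → Prime p → p ≢ 2 → ¬ p ∣ 2
odd-prime∤2 {p} pp p≢2 p∣2 = p≢2 (ℕₚ.≤-antisym (∣⇒≤ p∣2) (nonTrivial⇒n>1 p {{prime⇒nonTrivial pp}}))

module IrreducibleModule {p r : ℕ} .{{_ : NonZero r}} (pp : Prime p) (p≢2 : p ≢ 2) (M : DihedralModule p r) where
  open DihedralModule M
  open DihedralModuleProperties M
  open AbelianGroup 𝕍
  open Powers group using (_^_; ^-cong)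
  open CommutativeSemigroupProperties commutativeSemigroup using (interchange)
  open SetoidReasoning setoid

  half : ∀ x → x ∙ x ≈ ε → x ≈ ε
  half x e = Torsion.prime-torsion group {k = 2} pp (odd-prime∤2 pp p≢2) (torsion x) (trans (∙-congˡ (identityʳ x)) e)

  Y-multiple : ∀ m y x → Y (multiple m y) x ≈ Y y x ^ m
  Y-multiple zero    y x = refl
  Y-multiple (suc m) y x = trans (Y-++ y (multiple m y) x) (∙-congˡ (Y-multiple m y x))

  ^-square : ∀ x m → x ^ m ∙ x ^ m ≈ (x ∙ x) ^ m
  ^-square x zero    = identityˡ ε
  ^-square x (suc m) = trans (interchange x (x ^ m) x (x ^ m)) (∙-congˡ (^-square x m))

  Q-vanish : ∀ y x → B x ≈ x → Y y x ≈ ε → ∀ j → Q (List.map (j ℕ.+_) y) x ≈ ε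
  Q-vanish y x Bx Yx j = begin
    Q (List.map (j ℕ.+_) y) x        ≈⟨ Q-shift j y x Bx ⟩
    Aⁿ j (Y y x) ∙ B (Aⁿ j (Y y x))  ≈⟨ ∙-cong AʲYx (B-cong AʲYx) ⟩
    ε ∙ B ε                          ≈⟨ identityˡ (B ε) ⟩
    B ε                              ≈⟨ B-ε ⟩
    ε                                ∎
    where
    AʲYx : Aⁿ j (Y y x) ≈ ε
    AʲYx = trans (Aⁿ-cong j Yx) (Aⁿ-ε j)

  module _ (_≟_ : ∀ x y → Dec (x ≈ y))
           (irr : (W : Carrier → Set) → (∀ {x y} → x ≈ y → W x → W y) → W ε →
                  (∀ x y → W x → W y → W (x ∙ y)) → (∀ x → W x → W (A x)) → (∀ x → W x → W (B x)) →
                  ∀ x → W x → ¬ (x ≈ ε) → ∀ y → ¬ W y → ⊥) where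

    stable : ∀ {x y} → ¬ ¬ (x ≈ y) → x ≈ y
    stable {x} {y} f with x ≟ y
    ... | yes e = e
    ... | no ¬e = contradiction ¬e f

    -- The fixed points of A form a submodule: if Az = z, then A(Bz) = A(B(Az)) = Bz.
    fixed-by-A : ∀ x → ¬ (x ≈ ε) → A x ≈ x → ∀ y → A y ≈ y
    fixed-by-A x x≉ε Ax y = stable λ Ay≉y → irr (λ z → A z ≈ z)
      (λ e f → trans (A-cong (sym e)) (trans f e))
      A-ε
      (λ z z′ f f′ → trans (A-∙ z z′) (∙-cong f f′))
      (λ z f → A-cong f)
      (λ z f → trans (A-cong (B-cong (sym f))) (ABA z))
      x Ax x≉ε y Ay≉y

    fixed-by-B : (∀ y → A y ≈ y) → ∀ x → ¬ (x ≈ ε) → B x ≈ x → ∀ y → B y ≈ y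
    fixed-by-B A-fixed x x≉ε Bx y = stable λ By≉y → irr (λ z → B z ≈ z)
      (λ e f → trans (B-cong (sym e)) (trans f e))
      B-ε
      (λ z z′ f f′ → trans (B-∙ z z′) (∙-cong f f′))
      (λ z f → trans (B-cong (A-fixed z)) (trans f (sym (A-fixed z))))
      (λ z f → B-cong f)
      x Bx x≉ε y By≉y

    -- Schur's lemma: `Q y` commutes with A and B, so its kernel is a submodule, and u lies outside
    -- it.
    Q-injective : ∀ y u → ¬ (Q y u ≈ ε) → ∀ x → Q y x ≈ ε → x ≈ ε
    Q-injective y u Qu≉ε x Qx = stable λ x≉ε → irr (λ z → Q y z ≈ ε)
      (λ e f → trans (Q-cong y (sym e)) f)
      (Q-ε y)
      (λ z z′ f f′ → trans (Q-∙ y z z′) (trans (∙-cong f f′) (identityˡ ε)))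
      (λ z f → trans (Q-A y z) (trans (A-cong f) A-ε))
      (λ z f → trans (Q-B y z) (trans (B-cong f) B-ε))
      x Qx x≉ε u Qu≉ε

    module _ (u : Carrier) (Bu : B u ≈ u) (u≉ε : ¬ (u ≈ ε)) where

      -- The x all of whose rotations are negated by B form a submodule, which does not contain u.
      Y-detect : ∀ y → (∀ j → Q (List.map (j ℕ.+_) y) u ≈ ε) → Y y u ≈ ε
      Y-detect y Qs≈ε = stable λ Yu≉ε → irr (λ z → ∀ j → Aⁿ j z ∙ B (Aⁿ j z) ≈ ε)
        (λ e f j → trans (sym (∙-cong (Aⁿ-cong j e) (B-cong (Aⁿ-cong j e)))) (f j))
        (λ j → trans (∙-cong (Aⁿ-ε j) (trans (B-cong (Aⁿ-ε j)) B-ε)) (identityˡ ε))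
        (λ z z′ f f′ j → trans (∙-cong (Aⁿ-∙ j z z′) (trans (B-cong (Aⁿ-∙ j z z′)) (B-∙ _ _)))
          (trans (interchange _ _ _ _) (trans (∙-cong (f j) (f′ j)) (identityˡ ε))))
        (λ z f j → ≡.subst (λ q → q ∙ B q ≈ ε) (≡.sym (Aⁿ-A j z)) (f (suc j)))
        -- Aʲ B = B A⁻ʲ, so the condition on Bz at j is the one on z at -j.
        (λ z f j → begin
          Aⁿ j (B z) ∙ B (Aⁿ j (B z))                        ≈⟨ ∙-congʳ (B-period _) ⟨
          B (B (Aⁿ j (B z))) ∙ B (Aⁿ j (B z))                ≈⟨ ∙-cong (B-cong (BAⁿB j z)) (BAⁿB j z) ⟩
          B (Aⁿ (j ℕ.* pred r) z) ∙ Aⁿ (j ℕ.* pred r) z      ≈⟨ comm _ _ ⟩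
          Aⁿ (j ℕ.* pred r) z ∙ B (Aⁿ (j ℕ.* pred r) z)      ≈⟨ f (j ℕ.* pred r) ⟩
          ε                                                  ∎)
        (Y y u) (λ j → trans (sym (Q-shift j y u Bu)) (Qs≈ε j)) Yu≉ε
        -- For u the condition at j = 0 reads u + Bu = 2u = 0.
        u (λ f → u≉ε (half u (trans (∙-congˡ (sym Bu)) (f 0))))
        where
        BAⁿB : ∀ j z → B (Aⁿ j (B z)) ≈ Aⁿ (j ℕ.* pred r) z
        BAⁿB j z = trans (BAⁿ j (B z)) (Aⁿ-cong (j ℕ.* pred r) (B-period z))

      module _ (t : Carrier) (At : A t ≈ t) {s : List ℕ} (BAt∙t : B (A t) ∙ t ≈ Y s u) where

        -- If t ≠ 1 then the action is trivial, as t and u are fixed by A and by B respectively.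
        t∙t : t ∙ t ≈ Y s u
        t∙t with t ≟ ε
        ... | yes t≈ε = begin
          t ∙ t        ≈⟨ ∙-congʳ t≈ε ⟩
          ε ∙ t        ≈⟨ ∙-congʳ (trans (B-cong (trans At t≈ε)) B-ε) ⟨
          B (A t) ∙ t  ≈⟨ BAt∙t ⟩
          Y s u        ∎
        ... | no t≉ε = begin
          t ∙ t        ≈⟨ ∙-congʳ (trans (B-cong At) (fixed-by-B (fixed-by-A t t≉ε At) u u≉ε Bu t)) ⟨
          B (A t) ∙ t  ≈⟨ BAt∙t ⟩
          Y s u        ∎

        square-double : ∀ y m → (Y y u ∙ t ^ m) ∙ (Y y u ∙ t ^ m) ≈ Y ((y ++ y) ++ multiple m s) u
        square-double y m = begin
          (Y y u ∙ t ^ m) ∙ (Y y u ∙ t ^ m)    ≈⟨ interchange _ _ _ _ ⟩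
          (Y y u ∙ Y y u) ∙ (t ^ m ∙ t ^ m)    ≈⟨ ∙-cong (sym (Y-++ y y u)) (trans (^-square t m) (^-cong m t∙t)) ⟩
          Y (y ++ y) u ∙ Y s u ^ m             ≈⟨ ∙-congˡ (Y-multiple m s u) ⟨
          Y (y ++ y) u ∙ Y (multiple m s) u    ≈⟨ Y-++ (y ++ y) (multiple m s) u ⟨
          Y ((y ++ y) ++ multiple m s) u       ∎

module IrrProperties {p r : ℕ} .{{_ : NonZero p}} .{{_ : NonZero r}} (pp : Prime p) (p≢2 : p ≢ 2) (K : Irr p r) where
  open Irr K public using (pre; ord; gen; nontriv; irr)
  open PreProperties pre public
  private module I = IrreducibleModule pp p≢2 module-V
  open I public using (half)

  _≟ⱽ_ : ∀ x y → Dec (x 𝕍.≈ y)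
  x ≟ⱽ y = proj₁ x ≟ proj₁ y

  fixed-by-A : ∀ x → ¬ (x 𝕍.≈ 𝕍.ε) → A x 𝕍.≈ x → ∀ y → A y 𝕍.≈ y
  fixed-by-A = I.fixed-by-A _≟ⱽ_ irr

  fixed-by-B : (∀ y → A y 𝕍.≈ y) → ∀ x → ¬ (x 𝕍.≈ 𝕍.ε) → B x 𝕍.≈ x → ∀ y → B y 𝕍.≈ y
  fixed-by-B = I.fixed-by-B _≟ⱽ_ irr

  Q-injective : ∀ y → ¬ (Q y u 𝕍.≈ 𝕍.ε) → ∀ x → Q y x 𝕍.≈ 𝕍.ε → x 𝕍.≈ 𝕍.ε
  Q-injective y = I.Q-injective _≟ⱽ_ irr y u

  Q-vanish : ∀ y → Y y u 𝕍.≈ 𝕍.ε → ∀ j → Q (List.map (j ℕ.+_) y) u 𝕍.≈ 𝕍.ε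
  Q-vanish y = I.Q-vanish y u Bu

  Y-detect : ¬ (u 𝕍.≈ 𝕍.ε) → ∀ y → (∀ j → Q (List.map (j ℕ.+_) y) u 𝕍.≈ 𝕍.ε) → Y y u 𝕍.≈ 𝕍.ε
  Y-detect = I.Y-detect _≟ⱽ_ irr u Bu

  t∙t : ¬ (u 𝕍.≈ 𝕍.ε) → (t 𝕍.∙ t) 𝕍.≈ Y (twist r r) u
  t∙t u≉ε = I.t∙t _≟ⱽ_ irr u Bu u≉ε t At {twist r r} BAt∙t

  square-double : ¬ (u 𝕍.≈ 𝕍.ε) → ∀ y m →
    ((Y y u 𝕍.∙ (t 𝕍^.^ m)) 𝕍.∙ (Y y u 𝕍.∙ (t 𝕍^.^ m))) 𝕍.≈ Y (double r y m) u
  square-double u≉ε = I.square-double _≟ⱽ_ irr u Bu u≉ε t At {twist r r} BAt∙t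

-- Comparing kernels

module Comparison {p r : ℕ} .{{_ : NonZero p}} .{{_ : NonZero r}} (pp : Prime p) (p≢2 : p ≢ 2) where

  SameKernel : Irr p r → Irr p r → Set
  SameKernel K L = ∀ w → (K.ev w KG.≈ KG.ε → L.ev w LG.≈ LG.ε) × (L.ev w LG.≈ LG.ε → K.ev w KG.≈ KG.ε)
    where
    module K = PreProperties (Irr.pre K)
    module L = PreProperties (Irr.pre L)
    module KG = Group K.G
    module LG = Group L.G

  -- Witnesses that the kernel of K does not contain that of L; they are of a
  -- form that can be combined over several L.
  Separated : Irr p r → Irr p r → Set
  Separated K L = (K.u K.𝕍.≈ K.𝕍.ε × ¬ (L.u L.𝕍.≈ L.𝕍.ε))
                ⊎ (¬ (K.u K.𝕍.≈ K.𝕍.ε) × ∃[ y ] (L.Q y L.u L.𝕍.≈ L.𝕍.ε × ¬ (K.Q y K.u K.𝕍.≈ K.𝕍.ε)))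
    where
    module K = PreProperties (Irr.pre K)
    module L = PreProperties (Irr.pre L)

  module _ (K : Irr p r) where
    private
      module K = IrrProperties pp p≢2 K
      module KG = Group K.G
    open CommonNormalForm K.pre K.pre

    Y-u≈ε : K.u K.𝕍.≈ K.𝕍.ε → ∀ y → K.Y y K.u K.𝕍.≈ K.𝕍.ε
    Y-u≈ε u≈ε y = KG.trans (K.Y-cong y {K.u} {K.𝕍.ε} u≈ε) (GroupProperties.identityʳ-unique K.𝕍.group (K.Y y K.𝕍.ε) (K.Y y K.𝕍.ε)
      (KG.trans (KG.sym (K.Y-∙ y K.𝕍.ε K.𝕍.ε)) (K.Y-cong y {K.𝕍.ε K.𝕍.∙ K.𝕍.ε} {K.𝕍.ε} (KG.identityˡ KG.ε))))

    -- V is spanned by the rotates of u together with t, and V is not 0.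
    t-nontrivial : K.u K.𝕍.≈ K.𝕍.ε → ¬ (K.t K.𝕍.≈ K.𝕍.ε)
    t-nontrivial u≈ε t≈ε with K.nontriv
    ... | (x , v) , x≉ε with K.gen x
    ... | w , ew with commonV K.ord w (K.V-resp (KG.sym ew) v)
    ... | y , m , eq , _ = x≉ε (KG.trans (KG.sym ew) (KG.trans eq (KG.trans (KG.∙-cong (Y-u≈ε u≈ε y)
            (KG.trans (K.𝕍^.^-cong {K.t} {K.𝕍.ε} m t≈ε) (K.𝕍^.ε^ m))) (KG.identityˡ KG.ε))))

  module _ (K L : Irr p r) where
    private
      module K = IrrProperties pp p≢2 K
      module L = IrrProperties pp p≢2 L
      module KG = Group K.G
      module LG = Group L.G

    -- When u = 0 in both groups, a word with value in V takes the value tᵐ with the same m in each,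
    -- and t has order p in each; so the value is trivial exactly when p ∣ m.
    kernel-⊆-u≈ε : K.u K.𝕍.≈ K.𝕍.ε → L.u L.𝕍.≈ L.𝕍.ε → ∀ w → K.ev w KG.≈ KG.ε → L.ev w LG.≈ LG.ε
    kernel-⊆-u≈ε uK uL w e with CommonNormalForm.commonV K.pre L.pre K.ord w (K.V-resp (KG.sym e) K.V-ε)
    ... | y , m , eqK , eqL = LG.trans eqL (LG.trans (LG.∙-cong (Y-u≈ε L uL y) tᵐL) (LG.identityˡ LG.ε))
      where
      tᵐ : (K.t K.𝕍^.^ m) K.𝕍.≈ K.𝕍.ε
      tᵐ = KG.trans (KG.sym (KG.identityˡ _)) (KG.trans (KG.∙-congʳ (KG.sym (Y-u≈ε K uK y))) (KG.trans (KG.sym eqK) e))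
      tᵐL : (L.t L.𝕍^.^ m) L.𝕍.≈ L.𝕍.ε
      tᵐL with p ∣? m
      ... | yes (divides q ≡.refl) = L.𝕍^.^-multiple L.t q p (L.torsion L.t)
      ... | no p∤m = contradiction (Torsion.prime-torsion K.𝕍.group {k = m} {x = K.t} pp p∤m (K.torsion K.t) tᵐ) (t-nontrivial K uK)

  module _ (K L : Irr p r) where
    private
      module K = IrrProperties pp p≢2 K
      module L = IrrProperties pp p≢2 L
      module KG = Group K.G
      module LG = Group L.G
    open FiniteCoefficients {p}

    module _ (uK : ¬ (K.u K.𝕍.≈ K.𝕍.ε)) (uL : ¬ (L.u L.𝕍.≈ L.𝕍.ε))
             (sub : ∀ y → L.Q y L.u L.𝕍.≈ L.𝕍.ε → K.Q y K.u K.𝕍.≈ K.𝕍.ε) where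

      -- Doubling turns the value into some y u, which is trivial exactly when `Q` of every shift of
      -- y kills u. This condition passes from L to K by `sub`, and the doubling can be undone as p
      -- is odd.
      kernel-⊇ : ∀ w → L.ev w LG.≈ LG.ε → K.ev w KG.≈ KG.ε
      kernel-⊇ w e with CommonNormalForm.commonV L.pre K.pre L.ord w (L.V-resp (LG.sym e) L.V-ε)
      ... | y , m , eqL , eqK = KG.trans eqK (K.half (K.Y y K.u K.𝕍.∙ (K.t K.𝕍^.^ m)) (KG.trans (K.square-double uK y m)
              (K.Y-detect uK z λ j → sub (List.map (j ℕ.+_) z) (L.Q-vanish z Yz j))))
        where
        z = double r y m
        Yz : L.Y z L.u L.𝕍.≈ L.𝕍.ε
        Yz = LG.trans (LG.sym (L.square-double uL y m)) (LG.trans (LG.∙-cong xε xε) (LG.identityˡ LG.ε))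
          where xε = LG.trans (LG.sym eqL) e

      -- The values in L of the words in the kernel of K form a submodule. If it is not 0,
      -- irreducibility refutes that it misses u. But a word v in the kernel of K with the value of
      -- ρ² in L agrees with ρ² in K as well, by `kernel-⊇`, which makes u trivial in K.
      kernel-⊆ : ∀ w → K.ev w KG.≈ KG.ε → L.ev w LG.≈ LG.ε
      kernel-⊆ w e with L.ev w L.≟ LG.ε
      ... | yes q = q
      ... | no ¬q = ⊥-elim (L.irr (λ x → ∃[ v ] (L.ev v LG.≈ proj₁ x × K.ev v KG.≈ KG.ε))
            (λ { x≈y (v , f , g) → v , LG.trans f x≈y , g })
            ([] , LG.refl , KG.refl)
            (λ { x y (v , f , g) (v′ , f′ , g′) → v ++ v′ , LG.trans (L.ev-++ v v′) (LG.∙-cong f f′) ,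
                 KG.trans (K.ev-++ v v′) (KG.trans (KG.∙-cong g g′) (KG.identityˡ KG.ε)) })
            (λ { x (v , f , g) → conjA v , L.⊩-A {v} {x} f , KG.trans (K.⊩-A {v} {K.𝕍.ε} g) K.A-ε })
            (λ { x (v , f , g) → conjB v , L.⊩-B {v} {x} f , KG.trans (K.⊩-B {v} {K.𝕍.ε} g) K.B-ε })
            (L.ev w , CommonNormalForm.V-transfer K.pre L.pre K.ord w (K.V-resp (KG.sym e) K.V-ε))
            (w , LG.refl , e) ¬q L.u
            λ { (v , f , g) → uK (u∈K v f g) })
        where
        u∈K : ∀ v → L.ev v LG.≈ proj₁ L.u → K.ev v KG.≈ KG.ε → K.u K.𝕍.≈ K.𝕍.ε
        u∈K v f g = KG.trans (KG.sym (KG.trans (KG.∙-congˡ (KG.identityʳ _)) KG.refl)) (begin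
          K.ev uW                             ≈⟨ KG.identityˡ _ ⟨
          KG.ε KG.∙ K.ev uW                   ≈⟨ KG.∙-congʳ (kernel-⊇ (v ++ invW uW) eqL) ⟨
          K.ev (v ++ invW uW) KG.∙ K.ev uW    ≈⟨ KG.∙-congʳ (KG.trans (K.ev-++ v (invW uW)) (KG.∙-congˡ (K.ev-inv uW))) ⟩
          (K.ev v KG.∙ K.ev uW KG.⁻¹) KG.∙ K.ev uW ≈⟨ GroupProperties.//-rightDividesˡ K.G _ _ ⟩
          K.ev v                              ≈⟨ g ⟩
          KG.ε ∎)
          where
          open SetoidReasoning KG.setoid
          eqL : L.ev (v ++ invW uW) LG.≈ LG.ε
          eqL = LG.trans (L.ev-++ v (invW uW)) (LG.trans (LG.∙-cong f (LG.trans (L.ev-inv uW) (LG.⁻¹-cong L.⊩-u))) (LG.inverseʳ _))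

    compare : SameKernel K L ⊎ Separated K L
    compare with K.u K.≟ⱽ K.𝕍.ε | L.u L.≟ⱽ L.𝕍.ε
    ... | yes uK | yes uL = inj₁ λ w → kernel-⊆-u≈ε K L uK uL w , kernel-⊆-u≈ε L K uL uK w
    ... | yes uK | no  uL = inj₂ (inj₁ (uK , uL))
    -- `Q [ 0 ]` is doubling, which kills u in L and not in K.
    ... | no  uK | yes uL = inj₂ (inj₂ (uK , [ 0 ] , Q₀L , λ q → uK (K.half K.u (KG.trans (KG.sym Q₀K) q))))
      where
      Q₀K : K.Q [ 0 ] K.u K.𝕍.≈ (K.u K.𝕍.∙ K.u)
      Q₀K = KG.∙-cong (KG.identityʳ _) (KG.trans (K.B-cong {K.Y [ 0 ] (K.B K.u)} {K.B K.u} (KG.identityʳ _)) (K.B-period K.u))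
      Q₀L : L.Q [ 0 ] L.u L.𝕍.≈ L.𝕍.ε
      Q₀L = LG.trans (L.Q-cong [ 0 ] {L.u} {L.𝕍.ε} uL) (L.Q-ε [ 0 ])
    ... | no  uK | no  uL with anyVec? {p} {r} separates?
      where
      Sep : Vec (Fin p) r → Set
      Sep n = L.Q (fromVec n) L.u L.𝕍.≈ L.𝕍.ε × ¬ (K.Q (fromVec n) K.u K.𝕍.≈ K.𝕍.ε)
      separates? : ∀ n → Dec (Sep n)
      separates? n = (L.Q (fromVec n) L.u L.≟ⱽ L.𝕍.ε) ×-dec ¬? (K.Q (fromVec n) K.u K.≟ⱽ K.𝕍.ε)
    ... | yes (n , s) = inj₂ (inj₂ (uK , fromVec n , s))
    ... | no ¬s = inj₁ λ w → kernel-⊆ uK uL sub w , kernel-⊇ uK uL sub w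
      where
      sub : ∀ y → L.Q y L.u L.𝕍.≈ L.𝕍.ε → K.Q y K.u K.𝕍.≈ K.𝕍.ε
      sub y q with K.Q y K.u K.≟ⱽ K.𝕍.ε
      ... | yes q′ = q′
      ... | no ¬q  = contradiction (toVec y , LG.trans (Q-toVec L.module-V y L.u) q ,
        λ q′ → ¬q (KG.trans (KG.sym (Q-toVec K.module-V y K.u)) q′)) ¬s

-- Mirror images, and intersections of kernels

sumQs : ∀ {n} → (Fin n → List ℕ) → Word → Word
sumQs {zero}  ys w = w
sumQs {suc n} ys w = sumQ (ys zero) (sumQs (λ i → ys (suc i)) w)

∃⊎∀ : ∀ {n} {P Q : Fin n → Set} → (∀ i → P i ⊎ Q i) → ∃ P ⊎ (∀ i → Q i)
∃⊎∀ {zero} f = inj₂ λ ()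
∃⊎∀ {suc n} f with f zero | ∃⊎∀ (λ i → f (suc i))
... | inj₁ q | _             = inj₁ (zero , q)
... | inj₂ _ | inj₁ (i , q)  = inj₁ (suc i , q)
... | inj₂ q | inj₂ g        = inj₂ λ { zero → q ; (suc i) → g i }

flipL : Letter → Letter
flipL rho    = rhoInv
flipL rhoInv = rho
flipL tau    = tau

flipW : Word → Word
flipW = List.map flipL

module _ {p r : ℕ} .{{_ : NonZero p}} .{{_ : NonZero r}} where

  module Mirror (P : Pre p r) where
    open PreProperties P
    open Group G
    open GroupProperties G
    open GroupSolver G
    open Powers G

    a′ : Carrier
    a′ = ρ ⁻¹ ∙ τ

    a′-a : a′ ≈ (ρ ∙ ρ) ⁻¹ ∙ a
    a′-a = solve 2 (λ ρ τ → (inv ρ ⊗ τ) ⊜ (inv (ρ ⊗ ρ) ⊗ (ρ ⊗ τ))) refl ρ τ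

    -- Since a′ = ρ⁻²a, the mirror image has the same rotations modulo V, and so the same action on
    -- V.
    a′-power : ∀ k → ∃[ v ] (V v × a′ ^ k ≈ v ∙ a ^ k)
    a′-power zero = ε , V-ε , sym (identityˡ ε)
    a′-power (suc k) with a′-power k
    ... | v , Vv , e = (ρ ∙ ρ) ⁻¹ ∙ conj a v , V-∙ (V-⁻¹ ρ²∈V) (V-conj a Vv) ,
      trans (∙-cong a′-a e) (solve 4 (λ u a v x → ((u ⊗ a) ⊗ (v ⊗ x)) ⊜ ((u ⊗ ((a ⊗ v) ⊗ inv a)) ⊗ (a ⊗ x))) refl _ a v _)

    sg-ρ⁻¹ : sg (ρ ⁻¹) ≡ true
    sg-ρ⁻¹ with sg (ρ ⁻¹) | ≡.trans (≡.sym (≡.trans (sg-∙ ρ (ρ ⁻¹)) (≡.cong (_xor sg (ρ ⁻¹)) sg-ρ))) (≡.trans (sg-cong (inverseʳ ρ)) sg-ε)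
    ... | true  | _  = ≡.refl
    ... | false | ()

    mirrorPre : Pre p r
    mirrorPre = record
      { G = G ; ρ = ρ ⁻¹ ; τ = τ ; _≟_ = _≟_ ; τ² = τ² ; V = V ; V-resp = V-resp ; V-ε = V-ε
      ; V-∙ = V-∙ ; V-⁻¹ = V-⁻¹ ; V-conj = V-conj ; V-comm = V-comm ; V-tors = V-tors
      ; sg = sg ; sg-cong = sg-cong ; sg-∙ = sg-∙ ; sg-V = sg-V ; sg-ρ = sg-ρ⁻¹ ; sg-τ = sg-τ
      ; ρ²∈V = V-resp (⁻¹-anti-homo-∙ ρ ρ) (V-⁻¹ ρ²∈V)
      ; aʳ∈V = V-resp (sym (proj₂ (proj₂ (a′-power r)))) (V-∙ (proj₁ (proj₂ (a′-power r))) aʳ∈V) }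

    module P′ = PreProperties mirrorPre

    ev-flip : ∀ w → P′.ev (flipW w) ≈ ev w
    ev-flip []           = refl
    ev-flip (rho ∷ w)    = ∙-cong (⁻¹-involutive ρ) (ev-flip w)
    ev-flip (rhoInv ∷ w) = ∙-congˡ (ev-flip w)
    ev-flip (tau ∷ w)    = ∙-congˡ (ev-flip w)

    mirror-A : ∀ x → P′.A x 𝕍.≈ A x
    mirror-A (x , v) = trans (conj-cong a′-a refl) (trans (sym (conj-conj _ _ _)) (conj-V (V-⁻¹ ρ²∈V) (V-conj a v)))

    mirror-B : ∀ x → P′.B x 𝕍.≈ B x
    mirror-B (x , v) = trans (conj-cong refl (sym (B-period (x , v))))
      (solve 2 (λ ρ y → ((inv ρ ⊗ ((ρ ⊗ y) ⊗ inv ρ)) ⊗ inv (inv ρ)) ⊜ y) refl ρ _)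

    mirror-Aⁿ : ∀ i x → P′.Aⁿ i x 𝕍.≈ Aⁿ i x
    mirror-Aⁿ zero    x = refl
    mirror-Aⁿ (suc i) x = trans (P′.A-cong {P′.Aⁿ i x} {Aⁿ i x} (mirror-Aⁿ i x)) (mirror-A (Aⁿ i x))

    mirror-Y : ∀ y x → P′.Y y x 𝕍.≈ Y y x
    mirror-Y []      x = refl
    mirror-Y (i ∷ y) x = ∙-cong (mirror-Aⁿ i x) (mirror-Y y x)

    mirror-Q : ∀ y x → P′.Q y x 𝕍.≈ Q y x
    mirror-Q y x = ∙-cong (mirror-Y y x) (trans (mirror-B (P′.Y y (P′.B x)))
      (B-cong {P′.Y y (P′.B x)} {Y y (B x)} (trans (mirror-Y y (P′.B x)) (Y-cong y {P′.B x} {B x} (mirror-B x)))))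

    mirror-u : P′.u 𝕍.≈ u 𝕍.⁻¹
    mirror-u = sym (⁻¹-anti-homo-∙ ρ ρ)

  mirror : Irr p r → Irr p r
  mirror K = record
    { pre = mirrorPre
    ; ord = λ k v → ord k (V-resp (trans (∙-congˡ (proj₂ (proj₂ (a′-power k)))) (\\-leftDividesʳ _ _))
              (V-∙ (V-⁻¹ (proj₁ (proj₂ (a′-power k)))) v))
    ; gen = λ x → flipW (proj₁ (gen x)) , trans (ev-flip (proj₁ (gen x))) (proj₂ (gen x))
    ; nontriv = nontriv
    ; irr = λ W W-resp W-ε W-∙ W-A W-B → irr W W-resp W-ε W-∙
        (λ x w → W-resp (mirror-A x) (W-A x w)) (λ x w → W-resp (mirror-B x) (W-B x w)) }
    where
    open Irr K
    open PreProperties pre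
    open Group G
    open GroupProperties G
    open Mirror pre

module Covering {p r : ℕ} .{{_ : NonZero p}} .{{_ : NonZero r}} (pp : Prime p) (p≢2 : p ≢ 2) where
  open Comparison {p} {r} pp p≢2

  module _ (K : Irr p r) {n : ℕ} (L : Fin n → Irr p r) where
    private
      module K = IrrProperties pp p≢2 K
      module KG = Group K.G
      module L (j : Fin n) = IrrProperties pp p≢2 (L j)
      module LG (j : Fin n) = Group (L.G j)

    ⊩-Qs : (P : Pre p r) → let module P = PreProperties P in ∀ {n} (ys : Fin n → List ℕ) → sumQs ys uW P.⊩ P.Qs ys P.u
    ⊩-Qs P {zero}  ys = PreProperties.⊩-u P
    ⊩-Qs P {suc n} ys = PreProperties.⊩-Q P (ys zero) {sumQs (λ i → ys (suc i)) uW} {PreProperties.Qs P (λ i → ys (suc i)) (PreProperties.u P)} (⊩-Qs P (λ i → ys (suc i)))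

    -- This is the primeness of the annihilator of u: an operator that does not kill u is injective.
    Qs-nontrivial : ¬ (K.u K.𝕍.≈ K.𝕍.ε) → ∀ {n} (ys : Fin n → List ℕ) → (∀ j → ¬ (K.Q (ys j) K.u K.𝕍.≈ K.𝕍.ε)) → ¬ (K.Qs ys K.u K.𝕍.≈ K.𝕍.ε)
    Qs-nontrivial u≉ε {zero}  ys f = u≉ε
    Qs-nontrivial u≉ε {suc n} ys f e = Qs-nontrivial u≉ε (λ i → ys (suc i)) (λ j → f (suc j))
      (K.Q-injective (ys zero) (f zero) (K.Qs (λ i → ys (suc i)) K.u) e)

    module _ (cover : ∀ w → (∀ j → Group._≈_ (L.G j) (L.ev j w) (Group.ε (L.G j))) → K.ev w KG.≈ KG.ε) where

      -- If u ≠ 0 in K, the product of the separating operators, applied to ρ² as a word, is trivial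
      -- in every `L j` but not in K.
      separated⇒⊥ : (∀ j → Separated K (L j)) → ⊥
      separated⇒⊥ sep with K.u K.≟ⱽ K.𝕍.ε
      ... | yes uK = t-nontrivial K uK (K.half K.t t²)
        where
        w : Word
        -- The word expresses that 2t equals the combination `twist r r` of rotates of u. This holds
        -- wherever u ≠ 0, but in K it would say 2t = 0.
        w = (powW aW r ++ powW aW r) ++ invW (sumY (twist r r) uW)
        ev-w : (P : Pre p r) → let module P = PreProperties P in
               Group._≈_ P.G (P.ev w) (proj₁ ((P.t P.𝕍.∙ P.t) P.𝕍.∙ (P.Y (twist r r) P.u P.𝕍.⁻¹)))
        ev-w P = G.trans (P.ev-++ (powW aW r ++ powW aW r) _) (G.∙-cong (P.⊩-∙ {powW aW r} {powW aW r} {P.t} {P.t} P.⊩-t P.⊩-t)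
          (G.trans (P.ev-inv (sumY (twist r r) uW)) (G.⁻¹-cong (P.⊩-Y (twist r r) {uW} {P.u} P.⊩-u))))
          where
          module P = PreProperties P
          module G = Group P.G
        w∈L : ∀ j → Group._≈_ (L.G j) (L.ev j w) (Group.ε (L.G j))
        w∈L j with sep j
        ... | inj₁ (_ , uL) = LG.trans j (ev-w (L.pre j)) (GroupProperties.x≈y⇒x∙y⁻¹≈ε (L.G j) (L.t∙t j uL))
        ... | inj₂ (¬uK , _) = contradiction uK ¬uK
        t² : (K.t K.𝕍.∙ K.t) K.𝕍.≈ K.𝕍.ε
        t² = KG.trans (GroupProperties.x∙y⁻¹≈ε⇒x≈y K.G _ _ (KG.trans (KG.sym (ev-w K.pre)) (cover w w∈L))) (Y-u≈ε K uK (twist r r))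
      ... | no ¬uK = Qs-nontrivial ¬uK ys sepK (KG.trans (KG.sym (⊩-Qs K.pre ys)) (cover (sumQs ys uW)
              λ j → LG.trans j (⊩-Qs (L.pre j) ys) (L.Qs-vanish j ys j (L.u j) (sepL j))))
        where
        pick : ∀ j → ∃[ y ] (L.𝕍._≈_ j (L.Q j y (L.u j)) (L.𝕍.ε j) × ¬ (K.Q y K.u K.𝕍.≈ K.𝕍.ε))
        pick j with sep j
        ... | inj₁ (uK , _) = contradiction uK ¬uK
        ... | inj₂ (_ , s)  = s
        ys : Fin n → List ℕ
        ys j = proj₁ (pick j)
        sepL = λ j → proj₁ (proj₂ (pick j))
        sepK = λ j → proj₂ (proj₂ (pick j))

      covered : ∃[ j ] SameKernel K (L j)
      covered with ∃⊎∀ (λ j → compare K (L j))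
      ... | inj₁ q = q
      ... | inj₂ s = ⊥-elim (separated⇒⊥ s)

  -- Operators are additive, so they kill -u exactly when they kill u, and nothing can separate K
  -- from its mirror image.
  mirror-same : ∀ K → SameKernel K (mirror K)
  mirror-same K with compare K (mirror K)
  ... | inj₁ s = s
  ... | inj₂ (inj₁ (uK , uL)) = contradiction (trans mirror-u (trans (⁻¹-cong uK) (GroupProperties.ε⁻¹≈ε G))) uL
    where
    open PreProperties (Irr.pre K)
    open Group G
    open Mirror (Irr.pre K)
  ... | inj₂ (inj₂ (uK , y , qL , qK)) = contradiction (trans (sym (⁻¹-involutive _))
          (trans (⁻¹-cong (trans (sym (Q-⁻¹ y u)) (trans (sym (Q-cong y {P′.u} {u 𝕍.⁻¹} mirror-u)) (trans (sym (mirror-Q y P′.u)) qL)))) ε⁻¹≈ε)) qK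
    where
    open PreProperties (Irr.pre K)
    open Group G
    open GroupProperties G
    open Mirror (Irr.pre K)

  Central : Irr p r → Set
  Central K = (∀ x → A x 𝕍.≈ x) × (∀ x → B x 𝕍.≈ x) × ¬ (u 𝕍.≈ 𝕍.ε)
    where
    open PreProperties (Irr.pre K)

  -- Here `Q y` multiplies u by 2 · length y, and the result is 0 exactly when p divides this
  -- number, in K and in L alike.
  central-same : ∀ K L → Central K → Central L → SameKernel K L
  central-same K L (AK , BK , uK) (AL , BL , uL) with compare K L
  ... | inj₁ s = s
  ... | inj₂ (inj₁ (uK′ , _)) = contradiction uK′ uK
  ... | inj₂ (inj₂ (_ , y , qL , qK)) = ⊥-elim (vanish (p ∣? (l ℕ.+ l)))
    where
    module K = PreProperties (Irr.pre K)
    module L = PreProperties (Irr.pre L)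
    l = List.length y
    vanish : Dec (p ∣ (l ℕ.+ l)) → ⊥
    vanish (yes (divides q e)) = qK (Group.trans K.G (K.Q-trivial y K.u (AK K.u) (BK K.u))
      (≡.subst (λ n → (K.u K.𝕍^.^ n) K.𝕍.≈ K.𝕍.ε) (≡.sym e) (K.𝕍^.^-multiple K.u q p (K.torsion K.u))))
    vanish (no p∤) = uL (Torsion.prime-torsion L.𝕍.group {k = l ℕ.+ l} {x = L.u} pp p∤ (L.torsion L.u)
      (Group.trans L.G (Group.sym L.G (L.Q-trivial y L.u (AL L.u) (BL L.u))) qL))

-- Recovering the kernel from the map

module Cosets (G : Group 0ℓ 0ℓ) (x : Group.Carrier G) (M : ℕ) (order : Group._≈_ G (powℕ (groupOps G) x (suc M)) (Group.ε G)) where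
  open Group G
  open GroupProperties G
  open Powers G

  infix 4 _~_
  -- `sameCoset` with natural exponents; nothing is lost, as x has finite order.
  _~_ : Carrier → Carrier → Set
  g ~ h = ∃[ n ] h ≈ g ∙ x ^ n

  fromSameCoset : ∀ {g h} → sameCoset (groupOps G) x g h → g ~ h
  fromSameCoset {g} {h} (k , e) with powℤ-power M order k
  ... | n , f = n , trans (sym (\\-leftDividesˡ g h)) (∙-congˡ (trans e f))

  toSameCoset : ∀ {g h} → g ~ h → sameCoset (groupOps G) x g h
  toSameCoset {g} {h} (n , e) = + n , trans (∙-congˡ e) (\\-leftDividesʳ g _)

  ~-refl : ∀ {g h} → g ≈ h → g ~ h
  ~-refl e = 0 , trans (sym e) (sym (identityʳ _))

  ~-sym : ∀ {g h} → g ~ h → h ~ g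
  -- `-[1+ pred n ]` is -n for positive n; the power computed for n = 0 is discarded.
  ~-sym {g} {h} (n , e) with powℤ-power M order -[1+ pred n ]
  ~-sym {g} {h} (zero  , e) | _ = 0 , trans (trans (sym (identityʳ g)) (sym e)) (sym (identityʳ h))
  ~-sym {g} {h} (suc n , e) | k , f = k , trans (sym (//-rightDividesʳ (x ^ suc n) g)) (∙-cong (sym e) f)

  ~-trans : ∀ {g h k} → g ~ h → h ~ k → g ~ k
  ~-trans (m , e) (n , f) = m ℕ.+ n , trans f (trans (∙-congʳ e) (trans (assoc _ _ _) (∙-congˡ (sym (^-+ x m n)))))

  ~-step : ∀ g → g ~ g ∙ x
  ~-step g = 1 , ∙-congˡ (sym (identityʳ x))

  sameCoset-sym : ∀ {g h} → sameCoset (groupOps G) x g h → sameCoset (groupOps G) x h g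
  sameCoset-sym s = toSameCoset (~-sym (fromSameCoset s))

module _ (G : Group 0ℓ 0ℓ) where
  open Group G
  open Powers G

  meet-elim : ∀ {x y g h} → (∀ k → ∃[ n ] powℤ (groupOps G) x k ≈ x ^ n) → (∀ k → ∃[ n ] powℤ (groupOps G) y k ≈ y ^ n) →
              meet (groupOps G) x g y h → ∃[ z ] ((∃[ n ] z ≈ g ∙ x ^ n) × (∃[ n ] z ≈ h ∙ y ^ n))
  meet-elim fx fy (i , j , e) = _ , (proj₁ (fx i) , ∙-congˡ (proj₂ (fx i))) , (proj₁ (fy j) , trans e (∙-congˡ (proj₂ (fy j))))

  meet-resp : ∀ x M (o : x ^ suc M ≈ ε) y N (o′ : y ^ suc N ≈ ε) {g g′ h h′} →
              sameCoset (groupOps G) x g g′ → sameCoset (groupOps G) y h h′ →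
              meet (groupOps G) x g y h → meet (groupOps G) x g′ y h′
  meet-resp x M o y N o′ {g} {g′} {h} {h′} s s′ m with meet-elim {x} {y} {g} {h} (powℤ-power M o) (powℤ-power N o′) m
  ... | z , g~z , h~z with X.~-trans (X.~-sym (X.fromSameCoset s)) g~z | Y.~-trans (Y.~-sym (Y.fromSameCoset s′)) h~z
    where
    module X = Cosets G x M o
    module Y = Cosets G y N o′
  ... | i , e | j , e′ = + i , + j , trans (sym e) e′

module _ {A B : Set} {_≈A_ : A → A → Set} {_≈B_ : B → B → Set} where

  SetIso-sym : SetIso _≈A_ _≈B_ → SetIso _≈B_ _≈A_
  SetIso-sym f = record
    { to = from ; from = to ; to-cong = from-cong ; from-cong = to-cong ; to-from = from-to ; from-to = to-from }
    where
    open SetIso f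

-- The kernel on words is the intersection of those of irreducible groups: a single
-- irreducible group or a product of several.
record Semi (p r : ℕ) .{{_ : NonZero p}} .{{_ : NonZero r}} : Set₁ where
  field
    pre : Pre p r
  open PreProperties pre
  open Group G using (_≈_)
  open Powers G using (_^_)
  field
    ord  : ∀ k → V (a ^ k) → r ∣ k
    {m}  : ℕ
    C    : Fin m → Irr p r
  module Comp (i : Fin m) = PreProperties (Irr.pre (C i))
  field
    comp⁺ : ∀ w w′ → ev w ≈ ev w′ → ∀ i → Group._≈_ (Comp.G i) (Comp.ev i w) (Comp.ev i w′)
    comp⁻ : ∀ w w′ → (∀ i → Group._≈_ (Comp.G i) (Comp.ev i w) (Comp.ev i w′)) → ev w ≈ ev w′

  rotaMap : MapStr
  rotaMap = RotaMap (groupOps G) ρ τ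

module _ {p r : ℕ} .{{_ : NonZero p}} .{{_ : NonZero r}} where

  module Rotary (P : Pre p r) (ord : ∀ k → Pre.V P (Powers._^_ (Pre.G P) (Pre.a P) k) → r ∣ k) (3≤r : 3 ≤ r) where
    open PreProperties P public
    open Group G
    open GroupProperties G
    open GroupSolver G
    open Powers G

    private instance
      p2≢0 : NonZero (p ℕ.* 2)
      p2≢0 = ℕₚ.m*n≢0 p 2
      pr≢0 : NonZero (p ℕ.* r)
      pr≢0 = ℕₚ.m*n≢0 p r

    ρ-order′ : ρ ^ suc (pred (p ℕ.* 2)) ≈ ε
    ρ-order′ = trans (reflexive (≡.cong (ρ ^_) (ℕₚ.suc-pred (p ℕ.* 2)))) ρ-order

    τ-order : τ ^ 2 ≈ ε
    τ-order = trans (∙-congˡ (identityʳ τ)) τ²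

    module Vx = Cosets G ρ (pred (p ℕ.* 2)) ρ-order′
    module Ed = Cosets G τ 1 τ-order
    module Fc = Cosets G a (pred (p ℕ.* r)) a-order′

    ∤ : ∀ {k} .{{_ : NonZero k}} → k ≤ 2 → ¬ V (a ^ k)
    ∤ k≤2 v = ℕₚ.<⇒≱ 3≤r (ℕₚ.≤-trans (∣⇒≤ (ord _ v)) k≤2)

    Ed-cases : ∀ {g h} → g Ed.~ h → h ≈ g ⊎ h ≈ g ∙ τ
    Ed-cases {g} {h} (n , e) = go n h e
      where
      go : ∀ n h → h ≈ g ∙ τ ^ n → h ≈ g ⊎ h ≈ g ∙ τ
      go zero          h e = inj₁ (trans e (identityʳ g))
      go (suc zero)    h e = inj₂ (trans e (∙-congˡ (identityʳ τ)))
      go (suc (suc n)) h e = go n h (trans e (∙-congˡ (trans (sym (assoc _ _ _)) (trans (∙-congʳ τ²) (identityˡ _)))))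

    -- Otherwise a commutes with τ, while τ a τ = a⁻¹ modulo V.
    τ∉⟨ρ⟩ : ∀ n → ¬ (τ ≈ ρ ^ n)
    τ∉⟨ρ⟩ n e = ∤ {2} ℕₚ.≤-refl (V-resp eq ρ²∈V)
      where
      open SetoidReasoning setoid
      comm : ρ ∙ τ ≈ τ ∙ ρ
      comm = trans (∙-congˡ e) (trans (sym (^-commute n refl)) (∙-congʳ (sym e)))
      eq : ρ ∙ ρ ≈ a ^ 2
      eq = begin
        ρ ∙ ρ               ≈⟨ ∙-congˡ (identityˡ ρ) ⟨
        ρ ∙ (ε ∙ ρ)         ≈⟨ ∙-congˡ (∙-congʳ τ²) ⟨
        ρ ∙ ((τ ∙ τ) ∙ ρ)   ≈⟨ ∙-congˡ (assoc _ _ _) ⟩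
        ρ ∙ (τ ∙ (τ ∙ ρ))   ≈⟨ ∙-congˡ (∙-congˡ comm) ⟨
        ρ ∙ (τ ∙ (ρ ∙ τ))   ≈⟨ solve 2 (λ ρ τ → (ρ ⊗ τ ⊗ ρ ⊗ τ) ⊜ ((ρ ⊗ τ) ⊗ (ρ ⊗ τ) ⊗ one)) refl ρ τ ⟩
        a ^ 2               ∎

    ⟨a⟩-sign : ∀ {x} n → x ≈ a ^ n → sg x ≡ false
    ⟨a⟩-sign n e = ≡.trans (sg-cong e) (sg-^ n sg-a)

    τ∉⟨a⟩ : ∀ n → ¬ (τ ≈ a ^ n)
    τ∉⟨a⟩ n e with () ← ≡.trans (≡.sym sg-τ) (⟨a⟩-sign n e)

    ρ≉τ : ¬ (ρ ≈ τ)
    ρ≉τ e = ∤ {1} (s≤s z≤n) (V-resp (trans (sym (trans (∙-congʳ e) τ²)) (sym (identityʳ a))) V-ε)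

    ρ≉ε : ¬ (ρ ≈ ε)
    ρ≉ε e with () ← ≡.trans (≡.sym sg-ρ) (⟨a⟩-sign 0 e)

    -- There are no loops. With the next two lemmas: τ changes vertex and face, and ρ changes the
    -- edge. This excludes the wrong alternative whenever a flag is followed.
    vertex-step : ∀ g → ¬ (g Vx.~ g ∙ τ)
    vertex-step g (n , e) = τ∉⟨ρ⟩ n (∙-cancelˡ g _ _ e)

    face-step : ∀ g → ¬ (g Fc.~ g ∙ τ)
    face-step g (n , e) = τ∉⟨a⟩ n (∙-cancelˡ g _ _ e)

    edge-step : ∀ g → ¬ (g Ed.~ g ∙ ρ)
    edge-step g e with Ed-cases e
    ... | inj₁ q = ρ≉ε (∙-cancelˡ g _ _ (trans q (sym (identityʳ g))))
    ... | inj₂ q = ρ≉τ (∙-cancelˡ g _ _ q)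

    Degenerate Nondegenerate : Set
    Degenerate = ∃[ i ] ∃[ j ] (ρ ^ i ≈ a ^ j × ¬ (ρ ^ i ≈ ε))
    Nondegenerate = ∀ i j → ρ ^ i ≈ a ^ j → ρ ^ i ≈ ε

    degenerate? : Degenerate ⊎ Nondegenerate
    degenerate? with Finₚ.any? {p ℕ.* 2} (λ i → Finₚ.any? {p ℕ.* r} (λ j → ((ρ ^ toℕ i) ≟ (a ^ toℕ j)) ×-dec ¬? ((ρ ^ toℕ i) ≟ ε)))
    ... | yes (i , j , q) = inj₁ (toℕ i , toℕ j , q)
    ... | no ¬q = inj₂ nondegenerate
      where
      nondegenerate : Nondegenerate
      nondegenerate i j e with (ρ ^ i) ≟ ε
      ... | yes f = f
      ... | no ¬f = contradiction (i mod (p ℕ.* 2) , j mod (p ℕ.* r) , trans eqρ (trans e (sym eqa)) , λ f → ¬f (trans (sym eqρ) f)) ¬q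
        where
        eqρ : ρ ^ toℕ (i mod (p ℕ.* 2)) ≈ ρ ^ i
        eqρ = trans (reflexive (≡.cong (ρ ^_) (toℕ-mod i (p ℕ.* 2)))) (^-% ρ i (p ℕ.* 2) ρ-order)
        eqa : a ^ toℕ (j mod (p ℕ.* r)) ≈ a ^ j
        eqa = trans (reflexive (≡.cong (a ^_) (toℕ-mod j (p ℕ.* r)))) (^-% a j (p ℕ.* r) a-order)

    -- Flags of the map in the orientation o (false for the mirror image): the flag
    -- at g has the vertex g⟨ρ⟩, the edge g⟨τ⟩ and the face (face o g)⟨ρτ⟩.
    ρ* : Bool → Carrier
    ρ* true  = ρ
    ρ* false = ρ ⁻¹

    face : Bool → Carrier → Carrier
    face true  g = g
    face false g = g ∙ τ

    face-cong : ∀ o {g h} → g ≈ h → face o g ≈ face o h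
    face-cong true  e = e
    face-cong false e = ∙-congʳ e

    powρ = powℤ-power (pred (p ℕ.* 2)) ρ-order′
    powτ = powℤ-power 1 τ-order
    powa = powℤ-power (pred (p ℕ.* r)) a-order′

    gττ : ∀ g → (g ∙ τ) ∙ τ ≈ g
    gττ g = trans (assoc _ _ _) (trans (∙-congˡ τ²) (identityʳ g))

    vertex-on-edge : ∀ {v e g} → meet (groupOps G) ρ v τ e → e Ed.~ g → v Vx.~ g ⊎ v Vx.~ g ∙ τ
    vertex-on-edge {v} {e} {g} m e~g with meet-elim G powρ powτ m
    ... | z , v~z , e~z with Ed-cases (Ed.~-trans (Ed.~-sym e~g) e~z)
    ... | inj₁ q = inj₁ (Vx.~-trans v~z (Vx.~-refl q))
    ... | inj₂ q = inj₂ (Vx.~-trans v~z (Vx.~-refl q))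

    face-on-edge : ∀ o {e f g} → meet (groupOps G) τ e a f → e Ed.~ g → f Fc.~ face o g ⊎ f Fc.~ face o (g ∙ τ)
    face-on-edge o {e} {f} {g} m e~g with meet-elim G powτ powa m
    ... | z , e~z , f~z with o | Ed-cases (Ed.~-trans (Ed.~-sym e~g) e~z)
    ... | true  | inj₁ q = inj₁ (Fc.~-trans f~z (Fc.~-refl q))
    ... | true  | inj₂ q = inj₂ (Fc.~-trans f~z (Fc.~-refl q))
    ... | false | inj₁ q = inj₂ (Fc.~-trans f~z (Fc.~-refl (trans q (sym (gττ g)))))
    ... | false | inj₂ q = inj₁ (Fc.~-trans f~z (Fc.~-refl q))

    -- Turning about the vertex and crossing the new edge walks along the face. With the turn ρ⁻¹
    -- this is the face on the other side of the edge, hence the shift by τ in `face false`.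
    face-turn : ∀ o g → face o ((g ∙ ρ* o) ∙ τ) Fc.~ face o g
    face-turn true  g = Fc.~-sym (Fc.~-trans (Fc.~-step g) (Fc.~-refl (sym (assoc _ _ _))))
    face-turn false g = Fc.~-trans (Fc.~-step _) (Fc.~-refl (trans (∙-congʳ (gττ _))
      (solve 3 (λ g ρ τ → ((g ⊗ inv ρ) ⊗ ρ ⊗ τ) ⊜ (g ⊗ τ)) refl g ρ τ)))

    vertex-turn : ∀ o g → g ∙ ρ* o Vx.~ g
    vertex-turn true  g = Vx.~-sym (Vx.~-step g)
    vertex-turn false g = Vx.~-trans (Vx.~-step _) (Vx.~-refl (//-rightDividesˡ ρ g))

    module _ (nd : Nondegenerate) where

      -- ρⁱ⁻¹ = (ρⁱτ)a⁻¹ lies in ⟨ρ⟩ ∩ ⟨a⟩. The exponents M and N below stand for -1.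
      ρⁱτ : ∀ i j → ρ ^ i ∙ τ ≈ a ^ j → ρ ^ i ≈ ρ
      ρⁱτ i j e = begin
        ρ ^ i                   ≈⟨ \\-leftDividesˡ ρ (ρ ^ i) ⟨
        ρ ∙ (ρ ⁻¹ ∙ ρ ^ i)      ≈⟨ ∙-congˡ (∙-congʳ (⁻¹-power M ρ-order′)) ⟩
        ρ ∙ (ρ ^ M ∙ ρ ^ i)     ≈⟨ ∙-congˡ (^-+ ρ M i) ⟨
        ρ ∙ ρ ^ (M ℕ.+ i)       ≈⟨ ∙-congˡ (nd (M ℕ.+ i) (j ℕ.+ N) eq) ⟩
        ρ ∙ ε                   ≈⟨ identityʳ ρ ⟩
        ρ                       ∎
        where
        open SetoidReasoning setoid
        M = pred (p ℕ.* 2)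
        N = pred (p ℕ.* r)
        eq : ρ ^ (M ℕ.+ i) ≈ a ^ (j ℕ.+ N)
        eq = begin
          ρ ^ (M ℕ.+ i)            ≡⟨ ≡.cong (ρ ^_) (ℕₚ.+-comm M i) ⟩
          ρ ^ (i ℕ.+ M)            ≈⟨ ^-+ ρ i M ⟩
          ρ ^ i ∙ ρ ^ M            ≈⟨ ∙-congˡ (⁻¹-power M ρ-order′) ⟨
          ρ ^ i ∙ ρ ⁻¹             ≈⟨ solve 3 (λ x ρ τ → (x ⊗ inv ρ) ⊜ ((x ⊗ τ) ⊗ inv (ρ ⊗ τ))) refl (ρ ^ i) ρ τ ⟩
          (ρ ^ i ∙ τ) ∙ a ⁻¹       ≈⟨ ∙-cong e (⁻¹-power N a-order′) ⟩
          a ^ j ∙ a ^ N            ≈⟨ ^-+ a j N ⟨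
          a ^ (j ℕ.+ N)            ∎

      -- Relative to g, an edge on both cells is ρⁱ⟨τ⟩ with ρⁱ or ρⁱτ in ⟨a⟩, or in τ⟨a⟩ for the
      -- mirrored orientation. The trivial intersection leaves only the two edges of the corner.
      corner : ∀ o {v e f g} → meet (groupOps G) ρ v τ e → meet (groupOps G) τ e a f → v Vx.~ g → f Fc.~ face o g →
               e Ed.~ g ⊎ e Ed.~ g ∙ ρ* o
      corner o {v} {e} {f} {g} mve mef v~g f~g with meet-elim G powρ powτ mve | meet-elim G powτ powa mef
      ... | x , v~x , e~x | y , e~y , f~y
        with Vx.~-trans (Vx.~-sym v~g) v~x | Fc.~-trans (Fc.~-sym f~g) f~y
      ... | i , x≈ | j , y≈ with o | Ed-cases (Ed.~-trans (Ed.~-sym e~x) e~y)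
      ... | true | inj₁ y≈x = inj₁ (Ed.~-trans e~x (Ed.~-refl (trans x≈ (trans (∙-congˡ (nd i j
              (∙-cancelˡ g _ _ (trans (sym x≈) (trans (sym y≈x) y≈))))) (identityʳ g)))))
      ... | true | inj₂ y≈xτ = inj₂ (Ed.~-trans e~x (Ed.~-refl (trans x≈ (∙-congˡ (ρⁱτ i j
              (∙-cancelˡ g _ _ (trans (sym (assoc _ _ _)) (trans (∙-congʳ (sym x≈)) (trans (sym y≈xτ) y≈)))))))))
      -- Here ρⁱ = τaʲ, and multiplication by ρ on the left makes the right-hand side aʲ⁺¹.
      ... | false | inj₁ y≈x = inj₂ (Ed.~-trans e~x (Ed.~-refl (trans x≈ (∙-congˡ
              (inverseʳ-unique ρ (ρ ^ i) (nd (suc i) (suc j) (trans (∙-congˡ (∙-cancelˡ g _ _ (trans (sym x≈) (trans (sym y≈x) (trans y≈ (assoc _ _ _))))))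
                (sym (assoc _ _ _)))))))))
      ... | false | inj₂ y≈xτ = inj₁ (Ed.~-trans e~x (Ed.~-refl (trans x≈ (trans (∙-congˡ (∙-cancelˡ ρ _ _
              (trans (ρⁱτ (suc i) (suc j) (trans (assoc _ _ _) (trans (∙-congˡ (∙-cancelˡ g _ _ (trans (sym (assoc _ _ _)) (trans (∙-congʳ (sym x≈)) (trans (sym y≈xτ) (trans y≈ (assoc _ _ _)))))))
                (sym (assoc _ _ _))))) (sym (identityʳ ρ))))) (identityʳ g)))))

orientL : Bool → Letter → Letter
orientL true  x = x
orientL false x = flipL x

orient : Bool → Word → Word
orient o = List.map (orientL o)

module FlagTransport {p r : ℕ} .{{_ : NonZero p}} .{{_ : NonZero r}} (3≤r : 3 ≤ r) (P Q : Semi p r)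
                     (iso : MapIso (Semi.rotaMap P) (Semi.rotaMap Q)) where
  private
    module P = Rotary (Semi.pre P) (Semi.ord P) 3≤r
    module Q = Rotary (Semi.pre Q) (Semi.ord Q) 3≤r
    module PG = Group P.G
    module QG = Group Q.G
    open Powers P.G using () renaming (_^_ to _^P_)
    open Powers Q.G using () renaming (_^_ to _^Q_)
  open MapIso iso using (isoV; isoE; isoF; fV; fE; fF; presVE; presEF)

  V-cong : ∀ v w → P.ev v P.Vx.~ P.ev w → Q.ev (fV v) Q.Vx.~ Q.ev (fV w)
  V-cong v w e = Q.Vx.fromSameCoset (SetIso.to-cong isoV {v} {w} (P.Vx.toSameCoset e))

  E-cong : ∀ v w → P.ev v P.Ed.~ P.ev w → Q.ev (fE v) Q.Ed.~ Q.ev (fE w)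
  E-cong v w e = Q.Ed.fromSameCoset (SetIso.to-cong isoE {v} {w} (P.Ed.toSameCoset e))

  F-cong : ∀ v w → P.ev v P.Fc.~ P.ev w → Q.ev (fF v) Q.Fc.~ Q.ev (fF w)
  F-cong v w e = Q.Fc.fromSameCoset (SetIso.to-cong isoF {v} {w} (P.Fc.toSameCoset e))

  V-inj : ∀ v w → Q.ev (fV v) Q.Vx.~ Q.ev (fV w) → P.ev v P.Vx.~ P.ev w
  V-inj v w e = P.Vx.~-trans (P.Vx.~-sym (P.Vx.fromSameCoset (SetIso.from-to isoV v)))
    (P.Vx.~-trans (P.Vx.fromSameCoset (SetIso.from-cong isoV {fV v} {fV w} (Q.Vx.toSameCoset e))) (P.Vx.fromSameCoset (SetIso.from-to isoV w)))

  E-inj : ∀ v w → Q.ev (fE v) Q.Ed.~ Q.ev (fE w) → P.ev v P.Ed.~ P.ev w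
  E-inj v w e = P.Ed.~-trans (P.Ed.~-sym (P.Ed.fromSameCoset (SetIso.from-to isoE v)))
    (P.Ed.~-trans (P.Ed.fromSameCoset (SetIso.from-cong isoE {fE v} {fE w} (Q.Ed.toSameCoset e))) (P.Ed.fromSameCoset (SetIso.from-to isoE w)))

  F-inj : ∀ v w → Q.ev (fF v) Q.Fc.~ Q.ev (fF w) → P.ev v P.Fc.~ P.ev w
  F-inj v w e = P.Fc.~-trans (P.Fc.~-sym (P.Fc.fromSameCoset (SetIso.from-to isoF v)))
    (P.Fc.~-trans (P.Fc.fromSameCoset (SetIso.from-cong isoF {fF v} {fF w} (Q.Fc.toSameCoset e))) (P.Fc.fromSameCoset (SetIso.from-to isoF w)))

  VE : ∀ v e i j → P.ev v PG.∙ P.ρ ^P i PG.≈ P.ev e PG.∙ P.τ ^P j → meet (groupOps Q.G) Q.ρ (Q.ev (fV v)) Q.τ (Q.ev (fE e))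
  VE v e i j q = proj₁ (presVE v e) (+ i , + j , q)

  EF : ∀ e f i j → P.ev e PG.∙ P.τ ^P i PG.≈ P.ev f PG.∙ P.a ^P j → meet (groupOps Q.G) Q.τ (Q.ev (fE e)) Q.a (Q.ev (fF f))
  EF e f i j q = proj₁ (presEF e f) (+ i , + j , q)

  -- The isomorphism is given on cells only; g is the group element that locates the image of the
  -- flag at w, and it has to be followed letter by letter.
  record Flag (o : Bool) (w : Word) (g : QG.Carrier) : Set where
    constructor flag
    field
      onV : Q.ev (fV w) Q.Vx.~ g
      onE : Q.ev (fE w) Q.Ed.~ g
      onF : Q.ev (fF w) Q.Fc.~ Q.face o g

  Flag-resp : ∀ {o w w′ g g′} → P.ev w PG.≈ P.ev w′ → g QG.≈ g′ → Flag o w g → Flag o w′ g′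
  Flag-resp {o} {w} {w′} e f (flag v d c) = flag
    (Q.Vx.~-trans (V-cong w′ w (P.Vx.~-refl (PG.sym e))) (Q.Vx.~-trans v (Q.Vx.~-refl f)))
    (Q.Ed.~-trans (E-cong w′ w (P.Ed.~-refl (PG.sym e))) (Q.Ed.~-trans d (Q.Ed.~-refl f)))
    (Q.Fc.~-trans (F-cong w′ w (P.Fc.~-refl (PG.sym e))) (Q.Fc.~-trans c (Q.Fc.~-refl (Q.face-cong o f))))

  -- The image of the base face lies on one of the two sides of the image edge, and the side decides
  -- the orientation.
  base : ∃[ o ] ∃[ g ] Flag o [] g
  base with meet-elim Q.G Q.powρ Q.powτ (VE [] [] 0 0 PG.refl)
  ... | g , v~g , e~g with Q.face-on-edge true (EF [] [] 0 0 PG.refl) e~g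
  ... | inj₁ f~g  = true  , g , flag v~g e~g f~g
  ... | inj₂ f~gτ = false , g , flag v~g e~g f~gτ

  ev-τ : ∀ w → P.ev (w ++ [ tau ]) PG.≈ P.ev w PG.∙ P.τ
  ev-τ w = PG.trans (P.ev-++ w [ tau ]) (PG.∙-congˡ (PG.identityʳ P.τ))

  ev-ρ : ∀ w → P.ev (w ++ [ rho ]) PG.≈ P.ev w PG.∙ P.ρ
  ev-ρ w = PG.trans (P.ev-++ w [ rho ]) (PG.∙-congˡ (PG.identityʳ P.ρ))

  -- An edge has two faces. The one across is the image of the face beyond τ, which differs from the
  -- face at w, so this side is left.
  face-step : ∀ {o} w g → Q.ev (fE w) Q.Ed.~ g → Q.ev (fF (w ++ [ tau ])) Q.Fc.~ Q.face o (g QG.∙ Q.τ) → Q.ev (fF w) Q.Fc.~ Q.face o g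
  face-step {o} w g e c = fromInj₁
    (λ q → ⊥-elim (P.face-step (P.ev w) (P.Fc.~-trans (F-inj w (w ++ [ tau ]) (Q.Fc.~-trans q (Q.Fc.~-sym c))) (P.Fc.~-refl (ev-τ w)))))
    (Q.face-on-edge o (EF w w 0 0 PG.refl) e)

  step-τ : ∀ {o} w g → Flag o w g → Flag o (w ++ [ tau ]) (g QG.∙ Q.τ)
  -- Crossing the edge twice gives back w, so the face across from w′ is that of w.
  step-τ {o} w g (flag v d c) = flag onV onE (face-step {o} w′ (g QG.∙ Q.τ) onE
      (Q.Fc.~-trans (F-cong (w′ ++ [ tau ]) w (P.Fc.~-refl ev-ττ)) (Q.Fc.~-trans c (Q.Fc.~-refl (Q.face-cong o (QG.sym (Q.gττ g)))))))
    where
    w′ = w ++ [ tau ]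
    ev-ττ : P.ev (w′ ++ [ tau ]) PG.≈ P.ev w
    ev-ττ = PG.trans (ev-τ w′) (PG.trans (PG.∙-congʳ (ev-τ w)) (P.gττ (P.ev w)))
    onE : Q.ev (fE w′) Q.Ed.~ g QG.∙ Q.τ
    onE = Q.Ed.~-trans (E-cong w′ w (P.Ed.~-sym (P.Ed.~-trans (P.Ed.~-step (P.ev w)) (P.Ed.~-refl (PG.sym (ev-τ w))))))
            (Q.Ed.~-trans d (Q.Ed.~-step g))
    onV : Q.ev (fV w′) Q.Vx.~ g QG.∙ Q.τ
    onV = fromInj₂
      (λ q → ⊥-elim (P.vertex-step (P.ev w) (P.Vx.~-trans (V-inj w w′ (Q.Vx.~-trans v (Q.Vx.~-sym q))) (P.Vx.~-refl (ev-τ w)))))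
      (Q.vertex-on-edge (VE w′ w 0 1 (PG.trans (PG.identityʳ _) (P.ev-++ w [ tau ]))) d)

  module _ (nd : Q.Nondegenerate) where

    corner : ∀ {o} w g i j k l → Flag o w g → ∀ e →
             P.ev w PG.∙ P.ρ ^P i PG.≈ P.ev e PG.∙ P.τ ^P j → P.ev e PG.∙ P.τ ^P k PG.≈ P.ev w PG.∙ P.a ^P l →
             Q.ev (fE e) Q.Ed.~ g ⊎ Q.ev (fE e) Q.Ed.~ g QG.∙ Q.ρ* o
    corner {o} w g i j k l (flag v d c) e q q′ = Q.corner nd o (VE w e i j q) (EF e w k l q′) v c

    step-ρ : ∀ {o} w g → Flag o w g → Flag o (w ++ [ rho ]) (g QG.∙ Q.ρ* o)
    step-ρ {o} w g f@(flag v d c) = flag onV onE (face-step {o} w′ (g QG.∙ Q.ρ* o) onE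
        (Q.Fc.~-trans (F-cong (w′ ++ [ tau ]) w (P.Fc.~-sym (P.Fc.~-trans (P.Fc.~-step (P.ev w)) (P.Fc.~-refl (PG.sym ev-a)))))
          (Q.Fc.~-trans c (Q.Fc.~-sym (Q.face-turn o g)))))
      where
      w′ = w ++ [ rho ]
      ev-a : P.ev (w′ ++ [ tau ]) PG.≈ P.ev w PG.∙ P.a
      ev-a = PG.trans (ev-τ w′) (PG.trans (PG.∙-congʳ (ev-ρ w)) (PG.assoc _ _ _))
      onV : Q.ev (fV w′) Q.Vx.~ g QG.∙ Q.ρ* o
      onV = Q.Vx.~-trans (V-cong w′ w (P.Vx.~-sym (P.Vx.~-trans (P.Vx.~-step (P.ev w)) (P.Vx.~-refl (PG.sym (ev-ρ w))))))
              (Q.Vx.~-trans v (Q.Vx.~-sym (Q.vertex-turn o g)))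
      ρ-edge : P.ev w PG.∙ P.ρ ^P 1 PG.≈ P.ev w′ PG.∙ P.τ ^P 0
      ρ-edge = PG.trans (PG.sym (P.ev-++ w [ rho ])) (PG.sym (PG.identityʳ _))
      ρ-face : P.ev w′ PG.∙ P.τ ^P 1 PG.≈ P.ev w PG.∙ P.a ^P 1
      ρ-face = PG.trans (PG.∙-congˡ (PG.identityʳ P.τ)) (PG.trans (PG.∙-congʳ (ev-ρ w)) (PG.trans (PG.assoc _ _ _) (PG.∙-congˡ (PG.sym (PG.identityʳ _)))))
      -- The new edge shares vertex and face with the old flag, so its image is one of the two edges
      -- at the corner, and by injectivity not the old one.
      onE : Q.ev (fE w′) Q.Ed.~ g QG.∙ Q.ρ* o
      onE = fromInj₂
        (λ q → ⊥-elim (P.edge-step (P.ev w) (P.Ed.~-trans (E-inj w w′ (Q.Ed.~-trans d (Q.Ed.~-sym q))) (P.Ed.~-refl (ev-ρ w)))))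
        (corner {o} w g 1 0 1 1 f w′ ρ-edge ρ-face)

    step-ρ^ : ∀ {o} n w g → Flag o w g → Flag o (w ++ powW [ rho ] n) (g QG.∙ Q.ρ* o ^Q n)
    step-ρ^ {o} zero w g f = Flag-resp (PG.sym (PG.trans (P.ev-++ w []) (PG.identityʳ _))) (QG.sym (QG.identityʳ g)) f
    step-ρ^ {o} (suc n) w g f = Flag-resp (PG.reflexive (≡.cong P.ev (Listₚ.++-assoc w [ rho ] (powW [ rho ] n)))) (QG.assoc _ _ _)
      (step-ρ^ {o} n (w ++ [ rho ]) (g QG.∙ Q.ρ* o) (step-ρ {o} w g f))

    M : ℕ
    M = pred (p ℕ.* 2)

    ρ*-inverse : ∀ o → Q.ρ* o ^Q M QG.≈ Q.ev [ orientL o rhoInv ]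
    ρ*-inverse true  = QG.trans (QG.sym (Powers.⁻¹-power Q.G M Q.ρ-order′)) (QG.sym (QG.identityʳ _))
    ρ*-inverse false = QG.trans (QG.sym (Powers.⁻¹-power Q.G M ρ⁻¹-order))
      (QG.trans (GroupProperties.⁻¹-involutive Q.G Q.ρ) (QG.sym (QG.identityʳ _)))
      where
      ρ⁻¹-order : (Q.ρ QG.⁻¹) ^Q suc M QG.≈ QG.ε
      ρ⁻¹-order = QG.trans (Powers.^-cong Q.G (suc M) (Powers.⁻¹-power Q.G M Q.ρ-order′))
        (QG.trans (QG.sym (Powers.^-* Q.G Q.ρ (suc M) M)) (QG.trans (QG.reflexive (≡.cong (Q.ρ ^Q_) (ℕₚ.*-comm (suc M) M))) (Powers.^-multiple Q.G Q.ρ M (suc M) Q.ρ-order′)))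

    step : ∀ {o} x w g → Flag o w g → Flag o (w ++ [ x ]) (g QG.∙ Q.ev [ orientL o x ])
    step {o} rho w g f = Flag-resp PG.refl (QG.∙-congˡ (eq o)) (step-ρ {o} w g f)
      where
      eq : ∀ o → Q.ρ* o QG.≈ Q.ev [ orientL o rho ]
      eq true  = QG.sym (QG.identityʳ _)
      eq false = QG.sym (QG.identityʳ _)
    -- ρ⁻¹ is the M-th power of ρ, so forward steps suffice.
    step {o} rhoInv w g f = Flag-resp eqP (QG.∙-congˡ (ρ*-inverse o)) (step-ρ^ {o} M w g f)
      where
      eqP : P.ev (w ++ powW [ rho ] M) PG.≈ P.ev (w ++ [ rhoInv ])
      eqP = PG.trans (P.ev-++ w _) (PG.trans (PG.∙-congˡ (PG.trans (P.ev-powW [ rho ] M)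
        (PG.trans (Powers.^-cong P.G M (PG.identityʳ _)) (PG.trans (PG.sym (Powers.⁻¹-power P.G M P.ρ-order′)) (PG.sym (PG.identityʳ _))))))
        (PG.sym (P.ev-++ w [ rhoInv ])))
    step {true}  tau w g f = Flag-resp PG.refl (QG.∙-congˡ (QG.sym (QG.identityʳ _))) (step-τ w g f)
    step {false} tau w g f = Flag-resp PG.refl (QG.∙-congˡ (QG.sym (QG.identityʳ _))) (step-τ w g f)

    transport : ∀ {o} w w₀ g → Flag o w₀ g → Flag o (w₀ ++ w) (g QG.∙ Q.ev (orient o w))
    transport {o} [] w₀ g f = Flag-resp (PG.reflexive (≡.cong P.ev (≡.sym (Listₚ.++-identityʳ w₀)))) (QG.sym (QG.identityʳ g)) f
    transport {o} (x ∷ w) w₀ g f = Flag-resp (PG.reflexive (≡.cong P.ev (Listₚ.++-assoc w₀ [ x ] w)))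
      (QG.trans (QG.assoc _ _ _) (QG.∙-congˡ (QG.sym (Q.ev-∷ (orientL o x) (orient o w)))))
      (transport {o} w (w₀ ++ [ x ]) _ (step {o} x w₀ g f))

    module _ (o₀ : Bool) (g₀ : QG.Carrier) (flag₀ : Flag o₀ [] g₀) where

      -- A word trivial in P fixes the base flag, so the transported word fixes the image edge and
      -- the image vertex. The edge leaves only 1 and τ, and τ moves the vertex.
      kernel-from : ∀ w → P.ev w PG.≈ PG.ε → Q.ev (orient o₀ w) QG.≈ QG.ε
      kernel-from w e = trivial w (transport {o₀} w [] g₀ flag₀) e
        where
        trivial : ∀ w → Flag o₀ w (g₀ QG.∙ Q.ev (orient o₀ w)) → P.ev w PG.≈ PG.ε → Q.ev (orient o₀ w) QG.≈ QG.ε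
        trivial w (flag v′ d′ c′) e = [ (λ q → GroupProperties.∙-cancelˡ Q.G g₀ _ _ (QG.trans q (QG.sym (QG.identityʳ g₀)))) ,
            (λ q → ⊥-elim (Q.τ∉⟨ρ⟩ (proj₁ in⟨ρ⟩) (GroupProperties.∙-cancelˡ Q.G g₀ _ _ (QG.trans (QG.sym q) (proj₂ in⟨ρ⟩))))) ]′
            (Q.Ed-cases (Q.Ed.~-trans (Q.Ed.~-sym (Flag.onE flag₀)) (Q.Ed.~-trans (E-cong [] w (P.Ed.~-refl (PG.sym e))) d′)))
          where
          in⟨ρ⟩ : g₀ Q.Vx.~ g₀ QG.∙ Q.ev (orient o₀ w)
          in⟨ρ⟩ = Q.Vx.~-trans (Q.Vx.~-sym (Flag.onV flag₀)) (Q.Vx.~-trans (V-cong [] w (P.Vx.~-refl (PG.sym e))) v′)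

      -- In a degenerate map more than two edges are incident with both the base vertex and the base face.
      nondegenerate-from : P.Nondegenerate
      nondegenerate-from i j e = [ first , second ]′ (corner {o₀} [] g₀ i 0 0 j flag₀ (powW [ rho ] i)
          (PG.trans (PG.identityˡ _) (PG.trans (PG.sym ρⁱ) (PG.sym (PG.identityʳ _))))
          (PG.trans (PG.identityʳ _) (PG.trans ρⁱ (PG.trans e (PG.sym (PG.identityˡ _))))))
        where
        ρⁱ : P.ev (powW [ rho ] i) PG.≈ P.ρ ^P i
        ρⁱ = PG.trans (P.ev-powW [ rho ] i) (Powers.^-cong P.G i (PG.identityʳ _))
        first : Q.ev (fE (powW [ rho ] i)) Q.Ed.~ g₀ → P.ρ ^P i PG.≈ PG.ε
        first q = [ (λ s → PG.trans (PG.sym ρⁱ) s) ,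
            (λ s → ⊥-elim (P.τ∉⟨ρ⟩ i (PG.trans (PG.sym (PG.trans s (PG.identityˡ _))) ρⁱ))) ]′
          (P.Ed-cases (E-inj [] (powW [ rho ] i) (Q.Ed.~-trans (Flag.onE flag₀) (Q.Ed.~-sym q))))
        ρ-even : ¬ (P.ρ PG.≈ P.a ^P j)
        ρ-even q with () ← ≡.trans (≡.sym P.sg-ρ) (P.⟨a⟩-sign j q)
        -- This edge is also the image of the one at ρ, so ρⁱ would be ρ or ρτ. The sign of ρⁱ = aʲ
        -- excludes the first, and the second puts τ into ⟨ρ⟩.
        second : Q.ev (fE (powW [ rho ] i)) Q.Ed.~ g₀ QG.∙ Q.ρ* o₀ → P.ρ ^P i PG.≈ PG.ε
        second q = ⊥-elim ([ (λ s → ρ-even (PG.trans (PG.sym (PG.trans (PG.sym ρⁱ) (PG.trans s (PG.identityʳ _)))) e)) ,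
            (λ s → P.τ∉⟨ρ⟩ (M ℕ.+ i) (PG.trans (PG.sym (GroupProperties.\\-leftDividesʳ P.G P.ρ P.τ))
              (PG.trans (PG.∙-cong (Powers.⁻¹-power P.G M P.ρ-order′) (PG.trans (PG.∙-congʳ (PG.sym (PG.identityʳ _))) (PG.trans (PG.sym s) ρⁱ)))
                (PG.sym (Powers.^-+ P.G P.ρ M i))))) ]′
          (P.Ed-cases (E-inj [ rho ] (powW [ rho ] i) (Q.Ed.~-trans (Flag.onE (step-ρ {o₀} [] g₀ flag₀)) (Q.Ed.~-sym q)))))

    kernel : ∃[ o ] ∀ w → P.ev w PG.≈ PG.ε → Q.ev (orient o w) QG.≈ QG.ε
    kernel = let o , g , f = base in o , kernel-from o g f

    nondegenerate : P.Nondegenerate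
    nondegenerate = let o , g , f = base in nondegenerate-from o g f

-- From equal kernels to isomorphic maps

powWℤ : Word → ℤ → Word
powWℤ w (+ n)     = powW w n
powWℤ w -[1+ n ] = invW (powW w (suc n))

module _ (G : Group 0ℓ 0ℓ) (ρ τ : Group.Carrier G) (τ² : Group._≈_ G (Group._∙_ G τ τ) (Group.ε G)) where
  open Group G
  open Powers G
  open Evaluation′ G ρ τ τ²

  ev-powWℤ : ∀ {x} w k → ev w ≈ x → ev (powWℤ w k) ≈ powℤ (groupOps G) x k
  ev-powWℤ w (+ n)    e = trans (ev-powW w n) (^-cong n e)
  ev-powWℤ w -[1+ n ] e = trans (ev-inv (powW w (suc n))) (⁻¹-cong (trans (ev-powW w (suc n)) (^-cong (suc n) e)))

module _ (G : Group 0ℓ 0ℓ) (ρ τ : Group.Carrier G) (τ² : Group._≈_ G (Group._∙_ G τ τ) (Group.ε G))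
         (H : Group 0ℓ 0ℓ) (ρ′ τ′ : Group.Carrier H) (τ′² : Group._≈_ H (Group._∙_ H τ′ τ′) (Group.ε H)) where
  private
    module G = Group G
    module H = Group H
    module EG = Evaluation′ G ρ τ τ²
    module EH = Evaluation′ H ρ′ τ′ τ′²

  KernelSubset : Set
  KernelSubset = ∀ w → EG.ev w G.≈ G.ε → EH.ev w H.≈ H.ε

  module _ (sub : KernelSubset) where

    ev-transfer : ∀ v w → EG.ev v G.≈ EG.ev w → EH.ev v H.≈ EH.ev w
    ev-transfer v w e = GroupProperties.x∙y⁻¹≈ε⇒x≈y H _ _ (H.trans (H.sym (H.trans (EH.ev-++ v (invW w)) (H.∙-congˡ (EH.ev-inv w))))
      (sub (v ++ invW w) (G.trans (EG.ev-++ v (invW w)) (G.trans (G.∙-congˡ (EG.ev-inv w)) (GroupProperties.x≈y⇒x∙y⁻¹≈ε G e)))))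

    sameCoset-transfer : ∀ {x x′} c → EG.ev c G.≈ x → EH.ev c H.≈ x′ → ∀ v w →
      sameCoset (groupOps G) x (EG.ev v) (EG.ev w) → sameCoset (groupOps H) x′ (EH.ev v) (EH.ev w)
    sameCoset-transfer c e e′ v w (k , q) = k , H.trans (H.∙-congʳ (H.sym (EH.ev-inv v))) (H.trans (H.sym (EH.ev-++ (invW v) w))
      (H.trans (ev-transfer (invW v ++ w) (powWℤ c k) (G.trans (EG.ev-++ (invW v) w) (G.trans (G.∙-congʳ (EG.ev-inv v))
        (G.trans q (G.sym (ev-powWℤ G ρ τ τ² c k e)))))) (ev-powWℤ H ρ′ τ′ τ′² c k e′)))

    meet-transfer : ∀ {x x′ y y′} c d → EG.ev c G.≈ x → EH.ev c H.≈ x′ → EG.ev d G.≈ y → EH.ev d H.≈ y′ → ∀ v w →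
      meet (groupOps G) x (EG.ev v) y (EG.ev w) → meet (groupOps H) x′ (EH.ev v) y′ (EH.ev w)
    meet-transfer c d e e′ f f′ v w (i , j , q) = i , j ,
      H.trans (H.∙-congˡ (H.sym (ev-powWℤ H ρ′ τ′ τ′² c i e′))) (H.trans (H.sym (EH.ev-++ v (powWℤ c i)))
      (H.trans (ev-transfer (v ++ powWℤ c i) (w ++ powWℤ d j)
        (G.trans (EG.ev-++ v (powWℤ c i)) (G.trans (G.∙-congˡ (ev-powWℤ G ρ τ τ² c i e)) (G.trans q
          (G.sym (G.trans (EG.ev-++ w (powWℤ d j)) (G.∙-congˡ (ev-powWℤ G ρ τ τ² d j f))))))))
      (H.trans (EH.ev-++ w (powWℤ d j)) (H.∙-congˡ (ev-powWℤ H ρ′ τ′ τ′² d j f′)))))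

module _ (G : Group 0ℓ 0ℓ) (ρ τ : Group.Carrier G) (τ² : Group._≈_ G (Group._∙_ G τ τ) (Group.ε G))
         (H : Group 0ℓ 0ℓ) (ρ′ τ′ : Group.Carrier H) (τ′² : Group._≈_ H (Group._∙_ H τ′ τ′) (Group.ε H)) where

  -- Cosets and incidences are equations between values of words, so the identity on words is an
  -- isomorphism.
  sameKernel⇒MapIso : KernelSubset G ρ τ τ² H ρ′ τ′ τ′² → KernelSubset H ρ′ τ′ τ′² G ρ τ τ² →
                      MapIso (RotaMap (groupOps G) ρ τ) (RotaMap (groupOps H) ρ′ τ′)
  sameKernel⇒MapIso s s′ = record
    { isoV = iso (rho ∷ []) (gρ G ρ) (gρ H ρ′)
    ; isoE = iso (tau ∷ []) (gρ G τ) (gρ H τ′)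
    ; isoF = iso aW (ga G ρ τ) (ga H ρ′ τ′)
    ; presVE = inc (rho ∷ []) (tau ∷ []) (gρ G ρ) (gρ H ρ′) (gρ G τ) (gρ H τ′)
    ; presVF = inc (rho ∷ []) aW (gρ G ρ) (gρ H ρ′) (ga G ρ τ) (ga H ρ′ τ′)
    ; presEF = inc (tau ∷ []) aW (gρ G τ) (gρ H τ′) (ga G ρ τ) (ga H ρ′ τ′) }
    where
    module G = Group G
    module H = Group H
    module EG = Evaluation′ G ρ τ τ²
    module EH = Evaluation′ H ρ′ τ′ τ′²
    gρ : (Γ : Group 0ℓ 0ℓ) (x : Group.Carrier Γ) → Group._≈_ Γ (Group._∙_ Γ x (Group.ε Γ)) x
    gρ Γ = Group.identityʳ Γ
    ga : (Γ : Group 0ℓ 0ℓ) (x y : Group.Carrier Γ) → Group._≈_ Γ (Group._∙_ Γ x (Group._∙_ Γ y (Group.ε Γ))) (Group._∙_ Γ x y)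
    ga Γ x y = Group.∙-congˡ Γ (Group.identityʳ Γ y)
    iso : ∀ {x x′} c → EG.ev c G.≈ x → EH.ev c H.≈ x′ →
          SetIso (λ v w → sameCoset (groupOps G) x (EG.ev v) (EG.ev w)) (λ v w → sameCoset (groupOps H) x′ (EH.ev v) (EH.ev w))
    iso c e e′ = record
      { to = λ w → w ; from = λ w → w
      ; to-cong = λ {v} {w} → sameCoset-transfer G ρ τ τ² H ρ′ τ′ τ′² s c e e′ v w
      ; from-cong = λ {v} {w} → sameCoset-transfer H ρ′ τ′ τ′² G ρ τ τ² s′ c e′ e v w
      ; to-from = λ w → + 0 , H.inverseˡ (EH.ev w)
      ; from-to = λ w → + 0 , G.inverseˡ (EG.ev w) }
    inc : ∀ {x x′ y y′} c d → EG.ev c G.≈ x → EH.ev c H.≈ x′ → EG.ev d G.≈ y → EH.ev d H.≈ y′ → ∀ v w →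
          (meet (groupOps G) x (EG.ev v) y (EG.ev w) → meet (groupOps H) x′ (EH.ev v) y′ (EH.ev w)) ×
          (meet (groupOps H) x′ (EH.ev v) y′ (EH.ev w) → meet (groupOps G) x (EG.ev v) y (EG.ev w))
    inc c d e e′ f f′ v w = meet-transfer G ρ τ τ² H ρ′ τ′ τ′² s c d e e′ f f′ v w
                          , meet-transfer H ρ′ τ′ τ′² G ρ τ τ² s′ c d e′ e f′ f v w

module _ {p r : ℕ} .{{_ : NonZero p}} .{{_ : NonZero r}} where

  single : Irr p r → Semi p r
  single K = record
    { pre = Irr.pre K ; ord = Irr.ord K ; m = 1 ; C = λ _ → K
    ; comp⁺ = λ w w′ e i → e ; comp⁻ = λ w w′ f → f zero }

  product : ∀ {m} → (Fin (suc m) → Irr p r) → Semi p r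
  product {m} K = record
    { pre = prodPre (λ i → Irr.pre (K i))
    ; ord = λ k v → Irr.ord (K zero) k (≡.subst (Pre.V (Irr.pre (K zero))) (powℕ-prod O _ k zero) (v zero))
    ; C = K
    ; comp⁺ = λ w w′ e i → ≡.subst₂ (Group._≈_ (Pre.G (Irr.pre (K i)))) (eval-prod O _ _ w i) (eval-prod O _ _ w′ i) (e i)
    ; comp⁻ = λ w w′ f i → ≡.subst₂ (Group._≈_ (Pre.G (Irr.pre (K i)))) (≡.sym (eval-prod O _ _ w i)) (≡.sym (eval-prod O _ _ w′ i)) (f i) }
    where
    O : Fin (suc m) → Ops
    O i = groupOps (Pre.G (Irr.pre (K i)))

-- From isomorphic maps to equal kernels

module Recognition {p r : ℕ} .{{_ : NonZero p}} .{{_ : NonZero r}} (pp : Prime p) (p≢2 : p ≢ 2) (3≤r : 3 ≤ r) where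
  open Comparison {p} {r} pp p≢2
  open Covering {p} {r} pp p≢2

  module _ (S : Semi p r) where
    open Semi S using (ord; m; C; comp⁺; comp⁻)
    open Rotary (Semi.pre S) ord 3≤r
    open Group G
    open GroupProperties G
    open Powers G

    flip-kernel : ∀ w → ev (flipW w) ≈ ε → ev w ≈ ε
    flip-kernel w e = comp⁻ w [] λ i → Group.trans (Pre.G (Irr.pre (C i))) (Group.sym (Pre.G (Irr.pre (C i))) (Mirror.ev-flip (Irr.pre (C i)) w))
      (proj₁ (mirror-same (C i) (flipW w)) (comp⁺ (flipW w) [] e i))

    orient-kernel : ∀ o w → ev (orient o w) ≈ ε → ev w ≈ ε
    orient-kernel true  w e = trans (reflexive (≡.cong ev (≡.sym (Listₚ.map-id w)))) e
    orient-kernel false w e = flip-kernel w e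

    even : ∀ k → sg (ρ ^ k) ≡ false → ∃[ k′ ] k ≡ k′ ℕ.* 2
    even zero          _ = 0 , ≡.refl
    even (suc zero)    e with () ← ≡.trans (≡.sym (≡.trans (sg-∙ ρ ε) (≡.cong₂ _xor_ sg-ρ sg-ε))) e
    even (suc (suc k)) e with even k (≡.trans (≡.sym (eq k)) e)
      where
      eq : ∀ k → sg (ρ ^ suc (suc k)) ≡ sg (ρ ^ k)
      eq k rewrite sg-∙ ρ (ρ ^ suc k) | sg-∙ ρ (ρ ^ k) | sg-ρ with sg (ρ ^ k)
      ... | true  = ≡.refl
      ... | false = ≡.refl
    ... | k′ , ≡.refl = suc k′ , ≡.refl

    ρ^-even : ∀ k → ρ ^ (k ℕ.* 2) ≈ (ρ ∙ ρ) ^ k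
    ρ^-even k = trans (^-* ρ k 2) (^-cong k (∙-congˡ (identityʳ ρ)))

    V-^ : ∀ {x} k → V x → V (x ^ k)
    V-^ zero    v = V-ε
    V-^ (suc k) v = V-∙ v (V-^ k v)

  fixed-power : (K : Irr p r) → let open PreProperties (Irr.pre K) in
    (F : 𝕍.Carrier → 𝕍.Carrier) → F 𝕍.ε 𝕍.≈ 𝕍.ε → (∀ x y → F (x 𝕍.∙ y) 𝕍.≈ (F x 𝕍.∙ F y)) →
    ∀ x n → F x 𝕍.≈ x → F (x 𝕍^.^ n) 𝕍.≈ (x 𝕍^.^ n)
  fixed-power K F Fε F∙ x zero    Fx = Fε
  fixed-power K F Fε F∙ x (suc n) Fx = Group.trans (Pre.G (Irr.pre K)) (F∙ x (x 𝕍^.^ n)) (Group.∙-cong (Pre.G (Irr.pre K)) Fx (fixed-power K F Fε F∙ x n Fx))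
    where
    open PreProperties (Irr.pre K)

  -- The common value is fixed by B as a multiple of u and by A as a multiple of t. It is not 0,
  -- since u = 0 would force t = 0 as well.
  uᵏ≈tˡ⇒central : (K : Irr p r) → let open PreProperties (Irr.pre K) in
    ∀ k l → ¬ p ∣ k → ¬ p ∣ l → (u 𝕍^.^ k) 𝕍.≈ (t 𝕍^.^ l) → Central K
  uᵏ≈tˡ⇒central K k l p∤k p∤l e = A-fixed , fixed-by-B A-fixed z z≉ε (fixed-power K B B-ε B-∙ u k Bu) , u≉ε
    where
    open IrrProperties pp p≢2 K
    module G = Group G
    z = u 𝕍^.^ k
    u≉ε : ¬ (u 𝕍.≈ 𝕍.ε)
    u≉ε u≈ε = t-nontrivial K u≈ε (Torsion.prime-torsion 𝕍.group {k = l} {x = t} pp p∤l (torsion t)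
      (G.trans (G.sym e) (G.trans (𝕍^.^-cong {u} {𝕍.ε} k u≈ε) (𝕍^.ε^ k))))
    z≉ε : ¬ (z 𝕍.≈ 𝕍.ε)
    z≉ε z≈ε = u≉ε (Torsion.prime-torsion 𝕍.group {k = k} {x = u} pp p∤k (torsion u) z≈ε)
    A-fixed : ∀ y → A y 𝕍.≈ y
    A-fixed = fixed-by-A z z≉ε (G.trans (A-cong {z} {t 𝕍^.^ l} e) (G.trans (fixed-power K A A-ε A-∙ t l At) (G.sym e)))

  module _ (S : Semi p r) where
    open Semi S using (ord; m; C; comp⁺; comp⁻)
    open Rotary (Semi.pre S) ord 3≤r
    open Group G
    open GroupProperties G
    open Powers G

    module _ (k l : ℕ) (e : ρ ^ (k ℕ.* 2) ≈ a ^ (l ℕ.* r)) (ne : ¬ (ρ ^ (k ℕ.* 2) ≈ ε)) where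

      p∤k : ¬ p ∣ k
      p∤k (divides q ≡.refl) = ne (trans (ρ^-even S (q ℕ.* p)) (^-multiple (ρ ∙ ρ) q p (V-tors ρ²∈V)))

      p∤l : ¬ p ∣ l
      p∤l (divides q ≡.refl) = ne (trans e (trans (^-* a (q ℕ.* p) r) (^-multiple (a ^ r) q p (V-tors aʳ∈V))))

      -- The common power is nontrivial in the whole group but a priori not in each component. What
      -- passes to a component is the relation itself, and p divides neither k nor l.
      component-central : ∀ i → Central (C i)
      component-central i = uᵏ≈tˡ⇒central (C i) k l p∤k p∤l eq
        where
        module K = PreProperties (Irr.pre (C i))
        module KG = Group K.G
        open Powers K.G using () renaming (_^_ to _^K_; ^-cong to ^K-cong; ^-* to ^K-*)
        words : ev (powW [ rho ] (k ℕ.* 2)) ≈ ev (powW aW (l ℕ.* r))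
        words = trans (ev-powW [ rho ] (k ℕ.* 2)) (trans (^-cong (k ℕ.* 2) (identityʳ ρ)) (trans e
          (sym (trans (ev-powW aW (l ℕ.* r)) (^-cong (l ℕ.* r) ev-aW)))))
        eq : (K.u K.𝕍^.^ k) K.𝕍.≈ (K.t K.𝕍^.^ l)
        eq = KG.trans (KG.reflexive (K.proj-^ K.u k)) (KG.trans (^K-cong k (KG.∙-congˡ (KG.sym (KG.identityʳ K.ρ))))
          (KG.trans (KG.sym (^K-* K.ρ k 2)) (KG.trans (KG.sym (KG.trans (K.ev-powW [ rho ] (k ℕ.* 2)) (^K-cong (k ℕ.* 2) (KG.identityʳ K.ρ))))
          (KG.trans (comp⁺ (powW [ rho ] (k ℕ.* 2)) (powW aW (l ℕ.* r)) words i)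
          (KG.trans (K.ev-powW aW (l ℕ.* r)) (KG.trans (^K-cong (l ℕ.* r) K.ev-aW) (KG.trans (^K-* K.a l r) (KG.reflexive (≡.sym (K.proj-^ K.t l))))))))))

    -- The sign makes the exponent of ρ even and `ord` makes that of a a multiple of r, so the
    -- relation is one between multiples of u and of t.
    degenerate⇒central : Degenerate → ∀ i → Central (C i)
    degenerate⇒central (i , j , e , ne) with even S i (⟨a⟩-sign j e)
    ... | k , ≡.refl with ord j (V-resp (trans (sym (ρ^-even S k)) e) (V-^ S k ρ²∈V))
    ... | divides l ≡.refl = component-central k l e ne

    -- Without components every word would have the value 1.
    degenerate-index : Degenerate → Fin m
    degenerate-index (i , j , e , ne) with Finₚ.any? {m} {P = λ _ → ⊤} (λ _ → yes tt)
    ... | yes (i , _) = i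
    ... | no none = contradiction (trans (sym (trans (ev-powW [ rho ] i) (^-cong i (identityʳ ρ))))
          (comp⁻ (powW [ rho ] i) [] λ i′ → ⊥-elim (none (i′ , tt)))) ne

  module _ (P Q : Semi p r) where
    private
      module P = Rotary (Semi.pre P) (Semi.ord P) 3≤r
      module Q = Rotary (Semi.pre Q) (Semi.ord Q) 3≤r
      module PG = Group P.G
      module QG = Group Q.G

    SameKernelˢ : Set
    SameKernelˢ = ∀ w → (P.ev w PG.≈ PG.ε → Q.ev w QG.≈ QG.ε) × (Q.ev w QG.≈ QG.ε → P.ev w PG.≈ PG.ε)

    degenerate-kernel : P.Degenerate → Q.Degenerate → ∀ w → P.ev w PG.≈ PG.ε → Q.ev w QG.≈ QG.ε
    degenerate-kernel dP dQ w e = Semi.comp⁻ Q w [] λ j →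
      proj₁ (central-same (Semi.C P i) (Semi.C Q j) (degenerate⇒central P dP i) (degenerate⇒central Q dQ j) w) (Semi.comp⁺ P w [] e i)
      where i = degenerate-index P dP

    nondegenerate-kernel : MapIso (Semi.rotaMap P) (Semi.rotaMap Q) → Q.Nondegenerate → ∀ w → P.ev w PG.≈ PG.ε → Q.ev w QG.≈ QG.ε
    nondegenerate-kernel iso nd w e = orient-kernel Q (proj₁ k) w (proj₂ k w e)
      where k = FlagTransport.kernel 3≤r P Q iso nd

    rotaMap-sym : MapIso (Semi.rotaMap P) (Semi.rotaMap Q) → MapIso (Semi.rotaMap Q) (Semi.rotaMap P)
    rotaMap-sym f = record
      { isoV = SetIso-sym isoV ; isoE = SetIso-sym isoE ; isoF = SetIso-sym isoF
      ; presVE = λ v e → incidence-sym Q.ρ Q.τ (Q.Vx.sameCoset-sym) (Q.Ed.sameCoset-sym)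
          (meet-resp Q.G Q.ρ (pred (p ℕ.* 2)) Q.ρ-order′ Q.τ 1 Q.τ-order) (SetIso.to-from isoV v) (SetIso.to-from isoE e) (presVE (SetIso.from isoV v) (SetIso.from isoE e))
      ; presVF = λ v e → incidence-sym Q.ρ Q.a (Q.Vx.sameCoset-sym) (Q.Fc.sameCoset-sym)
          (meet-resp Q.G Q.ρ (pred (p ℕ.* 2)) Q.ρ-order′ Q.a (pred (p ℕ.* r)) Q.a-order′) (SetIso.to-from isoV v) (SetIso.to-from isoF e) (presVF (SetIso.from isoV v) (SetIso.from isoF e))
      ; presEF = λ v e → incidence-sym Q.τ Q.a (Q.Ed.sameCoset-sym) (Q.Fc.sameCoset-sym)
          (meet-resp Q.G Q.τ 1 Q.τ-order Q.a (pred (p ℕ.* r)) Q.a-order′) (SetIso.to-from isoE v) (SetIso.to-from isoF e) (presEF (SetIso.from isoE v) (SetIso.from isoF e)) }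
      where
      open MapIso f
      O = groupOps Q.G
      incidence-sym : ∀ x y {I : Set} {g g′ h h′} →
        (∀ {g h} → sameCoset O x g h → sameCoset O x h g) → (∀ {g h} → sameCoset O y g h → sameCoset O y h g) →
        (∀ {g g′ h h′} → sameCoset O x g g′ → sameCoset O y h h′ → meet O x g y h → meet O x g′ y h′) →
        sameCoset O x g′ g → sameCoset O y h′ h → (I → meet O x g′ y h′) × (meet O x g′ y h′ → I) →
        (meet O x g y h → I) × (I → meet O x g y h)
      incidence-sym x y symx symy resp s s′ (to , from) = (λ i → from (resp (symx s) (symy s′) i)) , (λ i → resp s s′ (to i))

  MapIso⇒sameKernel : (P Q : Semi p r) → MapIso (Semi.rotaMap P) (Semi.rotaMap Q) → SameKernelˢ P Q
  MapIso⇒sameKernel P Q iso = go P.degenerate? Q.degenerate?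
    where
    module P = Rotary (Semi.pre P) (Semi.ord P) 3≤r
    module Q = Rotary (Semi.pre Q) (Semi.ord Q) 3≤r
    iso⁻¹ = rotaMap-sym P Q iso
    go : P.Degenerate ⊎ P.Nondegenerate → Q.Degenerate ⊎ Q.Nondegenerate → SameKernelˢ P Q
    go (inj₁ dP) (inj₁ dQ) w = degenerate-kernel P Q dP dQ w , degenerate-kernel Q P dQ dP w
    go (inj₂ nP) (inj₂ nQ) w = nondegenerate-kernel P Q iso nQ w , nondegenerate-kernel Q P iso⁻¹ nP w
    -- In the mixed cases the isomorphism would carry nondegeneracy over to the degenerate side.
    go (inj₁ (i , j , e , ne)) (inj₂ nQ) = contradiction (FlagTransport.nondegenerate 3≤r P Q iso nQ i j e) ne
    go (inj₂ nP) (inj₁ (i , j , e , ne)) = contradiction (FlagTransport.nondegenerate 3≤r Q P iso⁻¹ nP i j e) ne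

-- Semidirect products and valencies

module Modular (n : ℕ) .{{_ : NonZero n}} where
  open ≡.≡-Reasoning

  toℕ-addF : ∀ (a b : Fin n) → toℕ (addF a b) ≡ (toℕ a ℕ.+ toℕ b) % n
  toℕ-addF a b = toℕ-mod (toℕ a ℕ.+ toℕ b) n

  toℕ-% : ∀ (a : Fin n) → toℕ a % n ≡ toℕ a
  toℕ-% a = m<n⇒m%n≡m (Finₚ.toℕ<n a)

  %-+ˡ : ∀ a b → (a % n ℕ.+ b) % n ≡ (a ℕ.+ b) % n
  %-+ˡ a b = begin
    (a % n ℕ.+ b) % n           ≡⟨ %-distribˡ-+ (a % n) b n ⟩
    (a % n % n ℕ.+ b % n) % n   ≡⟨ ≡.cong (λ z → (z ℕ.+ b % n) % n) (m%n%n≡m%n a n) ⟩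
    (a % n ℕ.+ b % n) % n       ≡⟨ %-distribˡ-+ a b n ⟨
    (a ℕ.+ b) % n               ∎

  addF-comm : ∀ (a b : Fin n) → addF a b ≡ addF b a
  addF-comm a b = ≡.cong (_mod n) (ℕₚ.+-comm (toℕ a) (toℕ b))

  addF-assoc : ∀ (a b c : Fin n) → addF (addF a b) c ≡ addF a (addF b c)
  addF-assoc a b c = Finₚ.toℕ-injective (begin
    toℕ (addF (addF a b) c)                 ≡⟨ toℕ-addF (addF a b) c ⟩
    (toℕ (addF a b) ℕ.+ toℕ c) % n          ≡⟨ ≡.cong (λ z → (z ℕ.+ toℕ c) % n) (toℕ-addF a b) ⟩
    ((toℕ a ℕ.+ toℕ b) % n ℕ.+ toℕ c) % n   ≡⟨ %-+ˡ (toℕ a ℕ.+ toℕ b) (toℕ c) ⟩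
    (toℕ a ℕ.+ toℕ b ℕ.+ toℕ c) % n         ≡⟨ ≡.cong (_% n) (≡.trans (ℕₚ.+-assoc (toℕ a) (toℕ b) (toℕ c)) (ℕₚ.+-comm (toℕ a) _)) ⟩
    (toℕ b ℕ.+ toℕ c ℕ.+ toℕ a) % n         ≡⟨ %-+ˡ (toℕ b ℕ.+ toℕ c) (toℕ a) ⟨
    ((toℕ b ℕ.+ toℕ c) % n ℕ.+ toℕ a) % n   ≡⟨ ≡.cong (λ z → (z ℕ.+ toℕ a) % n) (toℕ-addF b c) ⟨
    (toℕ (addF b c) ℕ.+ toℕ a) % n          ≡⟨ toℕ-addF (addF b c) a ⟨
    toℕ (addF (addF b c) a)                 ≡⟨ ≡.cong toℕ (addF-comm (addF b c) a) ⟩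
    toℕ (addF a (addF b c))                 ∎)

  0%n : 0 % n ≡ 0
  0%n = m<n⇒m%n≡m (ℕ.>-nonZero⁻¹ n)

  addF-identityˡ : ∀ (a : Fin n) → addF zeroF a ≡ a
  addF-identityˡ a = Finₚ.toℕ-injective (begin
    toℕ (addF zeroF a)           ≡⟨ toℕ-addF zeroF a ⟩
    (toℕ (zeroF {n}) ℕ.+ toℕ a) % n  ≡⟨ ≡.cong (λ z → (z ℕ.+ toℕ a) % n) (≡.trans (toℕ-mod 0 n) 0%n) ⟩
    toℕ a % n                    ≡⟨ toℕ-% a ⟩
    toℕ a                        ∎)

  negF-inverseˡ : ∀ (a : Fin n) → addF (negF a) a ≡ zeroF
  negF-inverseˡ a = Finₚ.toℕ-injective (begin
    toℕ (addF (negF a) a)                ≡⟨ toℕ-addF (negF a) a ⟩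
    (toℕ (negF a) ℕ.+ toℕ a) % n         ≡⟨ ≡.cong (λ z → (z ℕ.+ toℕ a) % n) (toℕ-mod (n ∸ toℕ a) n) ⟩
    ((n ∸ toℕ a) % n ℕ.+ toℕ a) % n      ≡⟨ %-+ˡ (n ∸ toℕ a) (toℕ a) ⟩
    (n ∸ toℕ a ℕ.+ toℕ a) % n            ≡⟨ ≡.cong (_% n) (ℕₚ.m∸n+n≡m (ℕₚ.<⇒≤ (Finₚ.toℕ<n a))) ⟩
    n % n                                ≡⟨ n%n≡0 n ⟩
    0                                    ≡⟨ 0%n ⟨
    0 % n                                ≡⟨ toℕ-mod 0 n ⟨
    toℕ (zeroF {n})                      ∎)

  ℤₙ : AbelianGroup 0ℓ 0ℓ
  ℤₙ = record
    { Carrier = Fin n ; _≈_ = _≡_ ; _∙_ = addF ; ε = zeroF ; _⁻¹ = negF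
    ; isAbelianGroup = record
      { isGroup = record
        { isMonoid = record
          { isSemigroup = record
            { isMagma = record { isEquivalence = ≡.isEquivalence ; ∙-cong = ≡.cong₂ addF }
            ; assoc = addF-assoc }
          ; identity = addF-identityˡ , λ a → ≡.trans (addF-comm a zeroF) (addF-identityˡ a) }
        ; inverse = negF-inverseˡ , λ a → ≡.trans (addF-comm a (negF a)) (negF-inverseˡ a)
        ; ⁻¹-cong = ≡.cong negF }
      ; comm = addF-comm } }

  open AbelianGroup ℤₙ using (group; identityʳ; inverseʳ) public
  open Powers group public
  open GroupProperties group using (∙-cancelˡ) public

  toℕ-^ : ∀ (a : Fin n) k → toℕ (a ^ k) ≡ (k ℕ.* toℕ a) % n
  toℕ-^ a zero    = toℕ-mod 0 n
  toℕ-^ a (suc k) = begin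
    toℕ (addF a (a ^ k))                     ≡⟨ toℕ-addF a (a ^ k) ⟩
    (toℕ a ℕ.+ toℕ (a ^ k)) % n              ≡⟨ ≡.cong (λ z → (toℕ a ℕ.+ z) % n) (toℕ-^ a k) ⟩
    (toℕ a ℕ.+ (k ℕ.* toℕ a) % n) % n        ≡⟨ ≡.cong (_% n) (ℕₚ.+-comm (toℕ a) _) ⟩
    ((k ℕ.* toℕ a) % n ℕ.+ toℕ a) % n        ≡⟨ %-+ˡ (k ℕ.* toℕ a) (toℕ a) ⟩
    (k ℕ.* toℕ a ℕ.+ toℕ a) % n              ≡⟨ ≡.cong (_% n) (ℕₚ.+-comm (k ℕ.* toℕ a) (toℕ a)) ⟩
    (toℕ a ℕ.+ k ℕ.* toℕ a) % n              ∎

  mulF-^ : ∀ (c a : Fin n) → mulF c a ≡ a ^ toℕ c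
  mulF-^ c a = Finₚ.toℕ-injective (≡.trans (toℕ-mod (toℕ c ℕ.* toℕ a) n) (≡.sym (toℕ-^ a (toℕ c))))

  order-n : ∀ (a : Fin n) → a ^ n ≡ zeroF
  order-n a = Finₚ.toℕ-injective (≡.trans (toℕ-^ a n) (≡.trans (≡.cong (_% n) (ℕₚ.*-comm n (toℕ a)))
    (≡.trans (m*n%n≡0 (toℕ a) n) (≡.trans (≡.sym 0%n) (≡.sym (toℕ-mod 0 n))))))

  one^ : 2 ≤ n → ∀ k → oneF ^ k ≡ zeroF → n ∣ k
  one^ 2≤n k e = m%n≡0⇒n∣m k n (begin
    k % n                      ≡⟨ ≡.cong (_% n) (ℕₚ.*-identityʳ k) ⟨
    (k ℕ.* 1) % n              ≡⟨ ≡.cong (λ z → (k ℕ.* z) % n) (≡.trans (toℕ-mod 1 n) (m<n⇒m%n≡m 2≤n)) ⟨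
    (k ℕ.* toℕ (oneF {n})) % n ≡⟨ toℕ-^ oneF k ⟨
    toℕ (oneF ^ k)             ≡⟨ ≡.cong toℕ e ⟩
    toℕ (zeroF {n})            ≡⟨ toℕ-mod 0 n ⟩
    0 % n                      ≡⟨ 0%n ⟩
    0                          ∎)

  one≢zero : 2 ≤ n → oneF ≢ zeroF {n}
  one≢zero 2≤n e = ℕₚ.<⇒≱ 2≤n (∣⇒≤ (one^ 2≤n 1 (≡.trans (identityʳ oneF) e)))

module VectorSpace (p : ℕ) .{{_ : NonZero p}} where
  open Modular p

  addV-comm : ∀ {d} (u v : VecF p d) → addV u v ≡ addV v u
  addV-comm []      []      = ≡.refl
  addV-comm (a ∷ u) (b ∷ v) = ≡.cong₂ _∷_ (addF-comm a b) (addV-comm u v)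

  addV-identityˡ : ∀ {d} (v : VecF p d) → addV zeroV v ≡ v
  addV-identityˡ []      = ≡.refl
  addV-identityˡ (a ∷ v) = ≡.cong₂ _∷_ (addF-identityˡ a) (addV-identityˡ v)

  addV-identityʳ : ∀ {d} (v : VecF p d) → addV v zeroV ≡ v
  addV-identityʳ v = ≡.trans (addV-comm v zeroV) (addV-identityˡ v)

  infixr 8 _×V_
  _×V_ : ∀ {d} → ℕ → VecF p d → VecF p d
  zero  ×V v = zeroV
  suc k ×V v = addV v (k ×V v)

  ×V-∷ : ∀ {d} k a (v : VecF p d) → k ×V (a ∷ v) ≡ (a ^ k) ∷ (k ×V v)
  ×V-∷ zero    a v = ≡.refl
  ×V-∷ (suc k) a v = ≡.cong (addV (a ∷ v)) (×V-∷ k a v)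

  ×V-[] : ∀ k → k ×V [] ≡ []
  ×V-[] k with k ×V []
  ... | [] = ≡.refl

  -- Over 𝔽_p a scalar multiple is a repeated sum, so a predicate that contains 0 and is closed
  -- under addition is a subspace.
  scaleV-× : ∀ {d} c (v : VecF p d) → scaleV c v ≡ toℕ c ×V v
  scaleV-× c []      = ≡.sym (×V-[] (toℕ c))
  scaleV-× c (a ∷ v) = ≡.trans (≡.cong₂ _∷_ (mulF-^ c a) (scaleV-× c v)) (≡.sym (×V-∷ (toℕ c) a v))

  p×V : ∀ {d} (v : VecF p d) → p ×V v ≡ zeroV
  p×V []      = ×V-[] p
  p×V (a ∷ v) = ≡.trans (×V-∷ p a v) (≡.cong₂ _∷_ (order-n a) (p×V v))

xor-false : ∀ b → b xor false ≡ b
xor-false true  = ≡.refl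
xor-false false = ≡.refl

module Extraction {p r d : ℕ} .{{_ : NonZero p}} .{{_ : NonZero r}} (pp : Prime p) (3≤r : 3 ≤ r)
                  (R : Rep p r d) (irreducible : Irreducible R) (G : Group 0ℓ 0ℓ) (iso : GroupIsoSDP R G) where
  open Group G
  open GroupProperties G
  open Powers G
  open GroupIsoSDP iso
  open VectorSpace p
  module Zr = Modular r

  D : Carrier → Dih r
  D x = proj₂ (φ x)

  vec : Carrier → VecF p d
  vec x = proj₁ (φ x)

  V : Carrier → Set
  V x = D x ≡ did

  sg : Carrier → Bool
  sg x = proj₂ (D x)

  D-∙ : ∀ x y → D (x ∙ y) ≡ dmul (D x) (D y)
  D-∙ x y = ≡.cong proj₂ (φ-hom x y)

  D-cong : ∀ {x y} → x ≈ y → D x ≡ D y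
  D-cong e = ≡.cong proj₂ (φ-cong e)

  did-identityˡ : ∀ (g : Dih r) → dmul did g ≡ g
  did-identityˡ (k , e) = ≡.cong (_, e) (Zr.addF-identityˡ k)

  did-identityʳ : ∀ (g : Dih r) → dmul g did ≡ g
  did-identityʳ (k , e) = ≡.cong₂ _,_ (≡.trans (≡.cong (addF k) (eq e)) (Zr.identityʳ k)) (xor-false e)
    where
    eq : ∀ e → (if e then negF zeroF else zeroF) ≡ zeroF {r}
    eq true  = GroupProperties.ε⁻¹≈ε Zr.group
    eq false = ≡.refl

  vec-∙ : ∀ {x} y → V x → vec (x ∙ y) ≡ addV (vec x) (vec y)
  vec-∙ {x} y v = ≡.trans (≡.cong proj₁ (φ-hom x y)) (≡.cong (addV (vec x)) (≡.trans (≡.cong (λ g → mulMV (Rep.ψ R g) (vec y)) v) (Rep.ψ-id R (vec y))))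

  lift : SDP R → Carrier
  lift s = proj₁ (φ-surj s)

  φ-lift : ∀ s → φ (lift s) ≡ s
  φ-lift s = proj₂ (φ-surj s)

  -- φ is given as multiplicative; the preimage of the neutral element is idempotent, hence neutral.
  φ-ε : φ ε ≡ (zeroV , did)
  φ-ε = ≡.trans (φ-cong (sym (identityʳ-unique e e idem))) (φ-lift (zeroV , did))
    where
    e = lift (zeroV , did)
    De : D e ≡ did
    De = ≡.cong proj₂ (φ-lift (zeroV , did))
    ve : vec e ≡ zeroV
    ve = ≡.cong proj₁ (φ-lift (zeroV , did))
    idem : e ∙ e ≈ e
    idem = φ-inj (≡.cong₂ _,_ (≡.trans (vec-∙ e De) (≡.trans (≡.cong (λ z → addV z (vec e)) ve) (addV-identityˡ (vec e))))
      (≡.trans (D-∙ e e) (≡.trans (≡.cong (λ z → dmul z (D e)) De) (did-identityˡ (D e)))))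

  V-ε : V ε
  V-ε = ≡.cong proj₂ φ-ε

  V-∙ : ∀ {x y} → V x → V y → V (x ∙ y)
  V-∙ {x} {y} v w = ≡.trans (D-∙ x y) (≡.trans (≡.cong₂ dmul v w) (did-identityˡ did))

  V-⁻¹ : ∀ {x} → V x → V (x ⁻¹)
  V-⁻¹ {x} v = ≡.trans (≡.sym (did-identityˡ _)) (≡.trans (≡.cong (λ z → dmul z (D (x ⁻¹))) (≡.sym v))
    (≡.trans (≡.sym (D-∙ x (x ⁻¹))) (≡.trans (D-cong (inverseʳ x)) V-ε)))

  V-conj : ∀ g {x} → V x → V (conj g x)
  V-conj g {x} v = ≡.trans (D-∙ (g ∙ x) (g ⁻¹)) (≡.trans (≡.cong (λ z → dmul z (D (g ⁻¹))) (≡.trans (D-∙ g x) (≡.trans (≡.cong (dmul (D g)) v) (did-identityʳ (D g)))))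
    (≡.trans (≡.sym (D-∙ g (g ⁻¹))) (≡.trans (D-cong (inverseʳ g)) V-ε)))

  V-≈ : ∀ {x y} → V x → V y → vec x ≡ vec y → x ≈ y
  V-≈ v w e = φ-inj (≡.cong₂ _,_ e (≡.trans v (≡.sym w)))

  V-comm : ∀ {x y} → V x → V y → x ∙ y ≈ y ∙ x
  V-comm {x} {y} v w = V-≈ (V-∙ v w) (V-∙ w v) (≡.trans (vec-∙ y v) (≡.trans (addV-comm (vec x) (vec y)) (≡.sym (vec-∙ x w))))

  V-^ : ∀ {x} k → V x → V (x ^ k) × vec (x ^ k) ≡ k ×V vec x
  V-^ zero    v = V-ε , ≡.cong proj₁ φ-ε
  V-^ {x} (suc k) v = V-∙ v (proj₁ (V-^ k v)) , ≡.trans (vec-∙ (x ^ k) v) (≡.cong (addV (vec x)) (proj₂ (V-^ k v)))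

  V-tors : ∀ {x} → V x → x ^ p ≈ ε
  V-tors {x} v = V-≈ (proj₁ (V-^ p v)) V-ε (≡.trans (proj₂ (V-^ p v)) (≡.trans (p×V (vec x)) (≡.sym (≡.cong proj₁ φ-ε))))

  _≟_ : ∀ x y → Dec (x ≈ y)
  x ≟ y with Productₚ.≡-dec (Vecₚ.≡-dec Fin._≟_) (Productₚ.≡-dec Fin._≟_ Bool._≟_) (φ x) (φ y)
  ... | yes e = yes (φ-inj e)
  ... | no ¬e = no λ e → ¬e (φ-cong e)

  sg-∙ : ∀ x y → sg (x ∙ y) ≡ sg x xor sg y
  sg-∙ x y = ≡.cong proj₂ (D-∙ x y)

  rotation-^ : ∀ {x} k → sg x ≡ false → D (x ^ k) ≡ (proj₁ (D x) Zr.^ k , false)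
  rotation-^ zero e = V-ε
  rotation-^ {x} (suc k) e = ≡.trans (D-∙ x (x ^ k)) (≡.trans (≡.cong (dmul (D x)) (rotation-^ k e)) (eq (D x) e))
    where
    eq : ∀ g → proj₂ g ≡ false → dmul g (proj₁ (D x) Zr.^ k , false) ≡ (addF (proj₁ g) (proj₁ (D x) Zr.^ k) , false)
    eq (c , false) _ = ≡.refl

  rotation-order : ∀ {x} → sg x ≡ false → V (x ^ r)
  rotation-order {x} e = ≡.trans (rotation-^ r e) (≡.cong (_, false) (Zr.order-n (proj₁ (D x))))

  reflection-order : ∀ {x} → sg x ≡ true → V (x ∙ x)
  reflection-order {x} e = ≡.trans (D-∙ x x) (eq (D x) e)
    where
    eq : ∀ g → proj₂ g ≡ true → dmul g g ≡ did
    eq (c , true) _ = ≡.cong (_, false) (Zr.inverseʳ c)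

  2≤r : 2 ≤ r
  2≤r = ℕₚ.<⇒≤ 3≤r

  2≤p : 2 ≤ p
  2≤p = nonTrivial⇒n>1 p {{prime⇒nonTrivial pp}}

  module _ (ρ τ : Carrier) (τ² : τ ∙ τ ≈ ε) (sg-ρ : sg ρ ≡ true) (sg-τ : sg τ ≡ true) where

    toPre : Pre p r
    toPre = record
      { G = G ; ρ = ρ ; τ = τ ; _≟_ = _≟_ ; τ² = τ² ; V = V
      ; V-resp = λ e v → ≡.trans (≡.sym (D-cong e)) v
      ; V-ε = V-ε ; V-∙ = V-∙ ; V-⁻¹ = V-⁻¹ ; V-conj = V-conj ; V-comm = V-comm ; V-tors = V-tors
      ; sg = sg ; sg-cong = λ e → ≡.cong proj₂ (D-cong e) ; sg-∙ = sg-∙ ; sg-V = ≡.cong proj₂ ; sg-ρ = sg-ρ ; sg-τ = sg-τ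
      ; ρ²∈V = reflection-order sg-ρ
      ; aʳ∈V = rotation-order (≡.trans (sg-∙ ρ τ) (≡.cong₂ _xor_ sg-ρ sg-τ)) }

    open PreProperties toPre using (ev; a; Y; u; sg-a; module 𝕍; A; B; NormalForm; NF-word; τ^; conj-τ)

    module _ (gen : ∀ x → ∃[ w ] ev w ≈ x) where

      -- A preimage of the basic rotation has a normal form, from which its sign removes τ, leaving
      -- aᵏ modulo V.
      one-power : ∃[ k ] proj₁ (D a) Zr.^ k ≡ oneF
      one-power with lift (zeroV , oneF , false) | φ-lift (zeroV , oneF , false)
      ... | x | φx with gen x
      ... | w , ew with NF-word w
      ... | nform = NormalForm.k nform , go (NormalForm.e nform) (≡.trans (≡.sym Dx) (≡.cong proj₂ φx))
        where
        y = NormalForm.y nform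
        k = NormalForm.k nform
        e = NormalForm.e nform
        Dx : D x ≡ dmul (proj₁ (D a) Zr.^ k , false) (D (τ^ e))
        Dx = ≡.trans (D-cong (trans (sym ew) (NormalForm.nf nform))) (≡.trans (D-∙ _ _) (≡.trans (≡.cong (λ z → dmul z (D (a ^ k ∙ τ^ e))) (proj₂ (Y y u)))
          (≡.trans (did-identityˡ _) (≡.trans (D-∙ (a ^ k) (τ^ e)) (≡.cong (λ z → dmul z (D (τ^ e))) (rotation-^ k sg-a))))))
        go : ∀ e → dmul (proj₁ (D a) Zr.^ k , false) (D (τ^ e)) ≡ (oneF , false) → proj₁ (D a) Zr.^ k ≡ oneF
        go true  q with () ← ≡.trans (≡.sym sg-τ) (≡.cong proj₂ q)
        go false q = ≡.cong proj₁ (≡.trans (≡.sym (≡.trans (≡.cong (dmul (proj₁ (D a) Zr.^ k , false)) V-ε) (did-identityʳ (proj₁ (D a) Zr.^ k , false)))) q)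

      rotation-faithful : ∀ n → V (a ^ n) → r ∣ n
      rotation-faithful n v with one-power
      ... | k , e = Zr.one^ 2≤r n (begin
        oneF Zr.^ n                        ≡⟨ ≡.cong (Zr._^ n) e ⟨
        (proj₁ (D a) Zr.^ k) Zr.^ n        ≡⟨ Zr.^-* (proj₁ (D a)) n k ⟨
        proj₁ (D a) Zr.^ (n ℕ.* k)         ≡⟨ ≡.cong (proj₁ (D a) Zr.^_) (ℕₚ.*-comm n k) ⟩
        proj₁ (D a) Zr.^ (k ℕ.* n)         ≡⟨ Zr.^-multiple (proj₁ (D a)) k n (≡.cong proj₁ (≡.trans (≡.sym (rotation-^ n sg-a)) v)) ⟩
        zeroF                              ∎)
        where
        open ≡.≡-Reasoning

      elt : VecF p d → 𝕍.Carrier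
      elt v = lift (v , did) , ≡.cong proj₂ (φ-lift (v , did))

      vec-elt : ∀ v → vec (proj₁ (elt v)) ≡ v
      vec-elt v = ≡.cong proj₁ (φ-lift (v , did))

      elt-vec : ∀ x → elt (vec (proj₁ x)) 𝕍.≈ x
      elt-vec (x , v) = V-≈ (proj₂ (elt (vec x))) v (vec-elt (vec x))

      elt-zero : elt zeroV 𝕍.≈ 𝕍.ε
      elt-zero = φ-inj (≡.trans (φ-lift (zeroV , did)) (≡.sym φ-ε))

      elt-add : ∀ v w → elt (addV v w) 𝕍.≈ (elt v 𝕍.∙ elt w)
      elt-add v w = V-≈ (proj₂ (elt (addV v w))) (V-∙ (proj₂ (elt v)) (proj₂ (elt w)))
        (≡.trans (vec-elt (addV v w)) (≡.sym (≡.trans (vec-∙ _ (proj₂ (elt v))) (≡.cong₂ addV (vec-elt v) (vec-elt w)))))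

      elt-ψ : ∀ g v → conj (lift (zeroV , g)) (proj₁ (elt v)) ≈ proj₁ (elt (mulMV (Rep.ψ R g) v))
      elt-ψ g v = trans (∙-congʳ (φ-inj (≡.trans eqˡ (≡.sym eqʳ)))) (//-rightDividesʳ y _)
        where
        open ≡.≡-Reasoning
        y = lift (zeroV , g)
        z = proj₁ (elt (mulMV (Rep.ψ R g) v))
        eqˡ : φ (y ∙ proj₁ (elt v)) ≡ (mulMV (Rep.ψ R g) v , g)
        eqˡ = begin
          φ (y ∙ proj₁ (elt v))                     ≡⟨ φ-hom y _ ⟩
          sdmul R (φ y) (φ (proj₁ (elt v)))         ≡⟨ ≡.cong₂ (sdmul R) (φ-lift (zeroV , g)) (φ-lift (v , did)) ⟩
          sdmul R (zeroV , g) (v , did)             ≡⟨ ≡.cong₂ _,_ (addV-identityˡ _) (did-identityʳ g) ⟩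
          (mulMV (Rep.ψ R g) v , g)                 ∎
        eqʳ : φ (z ∙ y) ≡ (mulMV (Rep.ψ R g) v , g)
        eqʳ = begin
          φ (z ∙ y)                                              ≡⟨ φ-hom z y ⟩
          sdmul R (φ z) (φ y)                                    ≡⟨ ≡.cong₂ (sdmul R) (φ-lift (mulMV (Rep.ψ R g) v , did)) (φ-lift (zeroV , g)) ⟩
          sdmul R (mulMV (Rep.ψ R g) v , did) (zeroV , g)        ≡⟨ ≡.cong₂ _,_ (≡.trans (≡.cong (addV _) (Rep.ψ-id R zeroV)) (addV-identityʳ _)) (did-identityˡ g) ⟩
          (mulMV (Rep.ψ R g) v , g)                              ∎

      module _ (W : 𝕍.Carrier → Set) (W-resp : ∀ {x y} → x 𝕍.≈ y → W x → W y) (W-ε : W 𝕍.ε)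
               (W-∙ : ∀ x y → W x → W y → W (x 𝕍.∙ y)) (W-A : ∀ x → W x → W (A x)) (W-B : ∀ x → W x → W (B x)) where

        W-ρ⁻¹ : ∀ x → W x → W (conj (ρ ⁻¹) (proj₁ x) , V-conj (ρ ⁻¹) (proj₂ x))
        W-ρ⁻¹ x w = W-resp {B x} {conj (ρ ⁻¹) (proj₁ x) , V-conj (ρ ⁻¹) (proj₂ x)} (sym (Mirror.mirror-B toPre x)) (W-B x w)

        -- ρ acts as B and τ as BA, so W is invariant under conjugation by all words, and thereby
        -- under all ψ(g).
        W-conj : ∀ w x → W x → W (conj (ev w) (proj₁ x) , V-conj (ev w) (proj₂ x))
        W-conj [] x q = W-resp {x} (sym (trans (∙-congʳ (identityˡ _)) (trans (∙-congˡ ε⁻¹≈ε) (identityʳ _)))) q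
        W-conj (rho ∷ w) x q = W-resp {B (conj (ev w) (proj₁ x) , V-conj (ev w) (proj₂ x))} (conj-conj _ _ _) (W-B _ (W-conj w x q))
        W-conj (rhoInv ∷ w) x q = W-resp {conj (ρ ⁻¹) (conj (ev w) (proj₁ x)) , V-conj (ρ ⁻¹) (V-conj (ev w) (proj₂ x))} (conj-conj _ _ _) (W-ρ⁻¹ _ (W-conj w x q))
        W-conj (tau ∷ w) x q = W-resp {B (A (conj (ev w) (proj₁ x) , V-conj (ev w) (proj₂ x)))}
          (trans (sym (conj-τ (conj (ev w) (proj₁ x) , V-conj (ev w) (proj₂ x)))) (conj-conj _ _ _)) (W-B _ (W-A _ (W-conj w x q)))

        irreducible-V : ∀ x → W x → ¬ (x 𝕍.≈ 𝕍.ε) → ∀ y → ¬ W y → ⊥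
        irreducible-V x Wx x≉ε y ¬Wy = proj₂ irreducible ((λ v → W (elt v)) , (zero∈ , add∈ , scale∈) , invariant∈ ,
          (vec (proj₁ x) , W-resp {x} {elt (vec (proj₁ x))} (sym (elt-vec x)) Wx ,
            λ e → x≉ε (V-≈ (proj₂ x) V-ε (≡.trans e (≡.sym (≡.cong proj₁ φ-ε))))) ,
          (vec (proj₁ y) , λ w → ¬Wy (W-resp {elt (vec (proj₁ y))} {y} (elt-vec y) w)))
          where
          zero∈ : W (elt zeroV)
          zero∈ = W-resp {𝕍.ε} {elt zeroV} (sym elt-zero) W-ε
          add∈ : ∀ v w → W (elt v) → W (elt w) → W (elt (addV v w))
          add∈ v w q q′ = W-resp {elt v 𝕍.∙ elt w} {elt (addV v w)} (sym (elt-add v w)) (W-∙ _ _ q q′)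
          multiple∈ : ∀ k v → W (elt v) → W (elt (k ×V v))
          multiple∈ zero    v q = zero∈
          multiple∈ (suc k) v q = add∈ v (k ×V v) q (multiple∈ k v q)
          scale∈ : ∀ c v → W (elt v) → W (elt (scaleV c v))
          scale∈ c v q = ≡.subst (λ z → W (elt z)) (≡.sym (scaleV-× c v)) (multiple∈ (toℕ c) v q)
          invariant∈ : ∀ g v → W (elt v) → W (elt (mulMV (Rep.ψ R g) v))
          invariant∈ g v q = W-resp {conj (ev w) (proj₁ (elt v)) , V-conj (ev w) (proj₂ (elt v))} {elt (mulMV (Rep.ψ R g) v)}
              (trans (conj-cong (proj₂ (gen (lift (zeroV , g)))) refl) (elt-ψ g v)) (W-conj w (elt v) q)
            where w = proj₁ (gen (lift (zeroV , g)))

      nonzero : ∀ d → 1 ≤ d → Σ[ v ∈ VecF p d ] v ≢ zeroV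
      nonzero (suc d) _ = (oneF ∷ zeroV) , λ e → Modular.one≢zero p 2≤p (≡.cong Vec.head e)

      toIrr : Irr p r
      toIrr = record
        { pre = toPre
        ; ord = rotation-faithful
        ; gen = gen
        ; nontriv = let v , v≢0 = nonzero d (proj₁ irreducible) in elt v , λ e →
            v≢0 (≡.trans (≡.sym (vec-elt v)) (≡.trans (≡.cong proj₁ (φ-cong e)) (≡.cong proj₁ φ-ε)))
        ; irr = irreducible-V }

  module _ (ρ τ : Carrier) (τ² : τ ∙ τ ≈ ε) (gen : ∀ x → ∃[ w ] Evaluation.ev G ρ τ w ≈ x) where
    open Evaluation G ρ τ using (ev)

    sg-⁻¹ : ∀ x → sg (x ⁻¹) ≡ sg x
    sg-⁻¹ x with sg x | sg (x ⁻¹) | ≡.trans (≡.sym (sg-∙ x (x ⁻¹))) (≡.cong proj₂ (≡.trans (D-cong (inverseʳ x)) V-ε))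
    ... | true  | true  | _  = ≡.refl
    ... | false | false | _  = ≡.refl
    ... | true  | false | ()
    ... | false | true  | ()

    not-both-rotations : sg ρ ≡ false → sg τ ≡ false → ⊥
    not-both-rotations sρ sτ with gen (lift (zeroV , zeroF , true))
    ... | w , e = false≢true (≡.trans (≡.sym (all-false w)) (≡.cong proj₂ (≡.trans (D-cong e) (≡.cong proj₂ (φ-lift (zeroV , zeroF , true))))))
      where
      false≢true : false ≢ true
      false≢true ()
      all-false : ∀ w → sg (ev w) ≡ false
      all-false []           = ≡.cong proj₂ V-ε
      all-false (rho ∷ w)    = ≡.trans (sg-∙ ρ (ev w)) (≡.cong₂ _xor_ sρ (all-false w))
      all-false (rhoInv ∷ w) = ≡.trans (sg-∙ (ρ ⁻¹) (ev w)) (≡.cong₂ _xor_ (≡.trans (sg-⁻¹ ρ) sρ) (all-false w))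
      all-false (tau ∷ w)    = ≡.trans (sg-∙ τ (ev w)) (≡.cong₂ _xor_ sτ (all-false w))

    -- A reflection and a rotation of order two generate a Klein four-group.
    τ-not-rotation : sg ρ ≡ true → sg τ ≡ false → ⊥
    τ-not-rotation sρ sτ with gen (lift (zeroV , oneF , false))
    ... | w , ew = impossible (four w) (≡.trans (D-cong ew) (≡.cong proj₂ (φ-lift (zeroV , oneF , false))))
      where
      open AbelianGroup Zr.ℤₙ using () renaming (identityʳ to +-identityʳ; inverseʳ to +-inverseʳ)
      k = proj₁ (D ρ)
      l = proj₁ (D τ)
      Dρ : D ρ ≡ (k , true)
      Dρ = ≡.cong (k ,_) sρ
      Dτ : D τ ≡ (l , false)
      Dτ = ≡.cong (l ,_) sτ
      l+l : addF l l ≡ zeroF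
      l+l = ≡.cong proj₁ (≡.trans (≡.sym (≡.trans (D-∙ τ τ) (≡.cong₂ dmul Dτ Dτ))) (≡.trans (D-cong τ²) V-ε))
      -l : negF l ≡ l
      -l = ≡.sym (GroupProperties.inverseˡ-unique Zr.group l l l+l)
      pick : Bool → Fin r → Fin r
      pick true  x = x
      pick false _ = zeroF
      -- The images of 1, ρ, τ and ρτ: e is the exponent of ρ and δ that of τ.
      Four : Dih r → Set
      Four (c , e) = ∃[ δ ] c ≡ addF (pick e k) (pick δ l)
      -pick : ∀ δ → negF (pick δ l) ≡ pick δ l
      -pick true  = -l
      -pick false = GroupProperties.ε⁻¹≈ε Zr.group
      four-ρ : ∀ g → Four g → Four (dmul (k , true) g)
      four-ρ (c , false) (δ , e) = δ , ≡.cong (addF k) (≡.trans (≡.cong negF (≡.trans e (Zr.addF-identityˡ _))) (-pick δ))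
      four-ρ (c , true)  (δ , e) = δ , ≡.trans (≡.cong (λ z → addF k (negF z)) e)
        (≡.trans (≡.cong (addF k) (GroupProperties.⁻¹-anti-homo-∙ Zr.group k (pick δ l)))
        (≡.trans (≡.cong (λ z → addF k (addF z (negF k))) (-pick δ))
        (≡.trans (≡.cong (addF k) (Zr.addF-comm (pick δ l) (negF k)))
        (≡.trans (≡.sym (Zr.addF-assoc k (negF k) (pick δ l))) (≡.cong (λ z → addF z (pick δ l)) (+-inverseʳ k))))))
      four-τ : ∀ g → Four g → Four (dmul (l , false) g)
      four-τ (c , e) (false , q) = true , ≡.trans (≡.cong (addF l) (≡.trans q (+-identityʳ _))) (Zr.addF-comm l _)
      four-τ (c , e) (true  , q) = false , ≡.trans (≡.cong (addF l) (≡.trans q (Zr.addF-comm _ l)))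
        (≡.trans (≡.sym (Zr.addF-assoc l l _)) (≡.trans (≡.cong (λ z → addF z (pick e k)) l+l) (Zr.addF-comm zeroF _)))
      Dρ⁻¹ : D (ρ ⁻¹) ≡ (k , true)
      Dρ⁻¹ = ≡.trans (≡.sym (≡.trans (D-∙ (ρ ⁻¹) (ρ ∙ ρ)) (≡.trans (≡.cong (dmul (D (ρ ⁻¹))) (reflection-order sρ)) (did-identityʳ _))))
        (≡.trans (D-cong (\\-leftDividesʳ ρ ρ)) Dρ)
      four : ∀ w → Four (D (ev w))
      four []           = ≡.subst Four (≡.sym V-ε) (false , ≡.sym (+-identityʳ zeroF))
      four (rho ∷ w)    = ≡.subst Four (≡.sym (≡.trans (D-∙ ρ (ev w)) (≡.cong (λ z → dmul z (D (ev w))) Dρ))) (four-ρ (D (ev w)) (four w))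
      four (rhoInv ∷ w) = ≡.subst Four (≡.sym (≡.trans (D-∙ (ρ ⁻¹) (ev w)) (≡.cong (λ z → dmul z (D (ev w))) Dρ⁻¹))) (four-ρ (D (ev w)) (four w))
      four (tau ∷ w)    = ≡.subst Four (≡.sym (≡.trans (D-∙ τ (ev w)) (≡.cong (λ z → dmul z (D (ev w))) Dτ))) (four-τ (D (ev w)) (four w))
      -- Otherwise 1 would be 0 or l modulo r, and as 2l = 0 the latter gives r ∣ 2.
      impossible : ∀ {g} → Four g → g ≡ (oneF , false) → ⊥
      impossible (false , q) ≡.refl = Zr.one≢zero 2≤r (≡.trans q (+-identityʳ zeroF))
      impossible (true  , q) ≡.refl = ℕₚ.<⇒≱ 3≤r (∣⇒≤ (Zr.one^ 2≤r 2
        (≡.trans (≡.cong (addF oneF) (+-identityʳ oneF)) (≡.trans (≡.cong₂ addF 1≡l 1≡l) l+l))))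
        where
        1≡l : oneF ≡ l
        1≡l = ≡.trans q (Zr.addF-identityˡ l)

-- Degrees of the graphs and the order of ρ

record HasDegree (X : Graph) (v : Graph.Vt X) (n : ℕ) : Set where
  open Graph X
  field
    edge     : Fin n → Ed
    incident : ∀ c → Inc v (edge c)
    distinct : ∀ c c′ → edge c ≡ edge c′ → c ≡ c′
    complete : ∀ e → Inc v e → ∃[ c ] edge c ≡ e

initV-∷ʳ : ∀ {X : Set} {n} (x : Vec X n) c → initV (x Vec.∷ʳ c) ≡ x
initV-∷ʳ []          c = ≡.refl
initV-∷ʳ (a ∷ [])    c = ≡.refl
initV-∷ʳ (a ∷ b ∷ x) c = ≡.cong (a ∷_) (initV-∷ʳ (b ∷ x) c)

initV-last : ∀ {X : Set} {n} (y : Vec X (suc n)) → initV y Vec.∷ʳ Vec.last y ≡ y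
initV-last (a ∷ [])    = ≡.refl
initV-last (a ∷ b ∷ y) = ≡.cong (a ∷_) (≡.trans (≡.cong (initV (b ∷ y) Vec.∷ʳ_) (last-∷ a (b ∷ y))) (initV-last (b ∷ y)))
  where
  last-∷ : ∀ {X : Set} {n} (a : X) (y : Vec X (suc n)) → Vec.last (a ∷ y) ≡ Vec.last y
  last-∷ a (b ∷ [])    = ≡.refl
  last-∷ a (b ∷ c ∷ y) = ≡.refl

module _ {n : ℕ} .{{_ : NonZero n}} where
  open Modular n

  previous : Fin n → Fin n
  previous i = addF i (negF oneF)

  previous-next : ∀ i → i ≡ addF (previous i) oneF
  previous-next i = ≡.sym (≡.trans (addF-assoc i (negF oneF) oneF) (≡.trans (≡.cong (addF i) (negF-inverseˡ oneF)) (identityʳ i)))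

  next-previous : ∀ i j → i ≡ addF j oneF → previous i ≡ j
  next-previous i j ≡.refl = ≡.trans (addF-assoc j oneF (negF oneF)) (≡.trans (≡.cong (addF j) (inverseʳ oneF)) (identityʳ j))

  previous-≢ : 2 ≤ n → ∀ i → i ≢ previous i
  previous-≢ 2≤n i e = one≢zero 2≤n (≡.sym (∙-cancelˡ i _ _ (≡.trans (identityʳ i)
    (≡.trans (previous-next i) (≡.cong (λ z → addF z oneF) (≡.sym e))))))

-- The p edges to the next layer append a letter and the p edges from the previous layer prepend
-- one; r ≥ 2 keeps the two kinds apart.
PXgraph-degree : ∀ p r s .{{_ : NonZero r}} → 2 ≤ r → ∀ v → HasDegree (PXgraph p r s) v (p ℕ.+ p)
PXgraph-degree p r s 2≤r (i , x) = record
  { edge = λ c → enum (Fin.splitAt p c)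
  ; incident = λ c → inc (Fin.splitAt p c)
  ; distinct = λ c c′ e → splitAt-injective (enum-injective (Fin.splitAt p c) (Fin.splitAt p c′) e)
  ; complete = λ e q → let z , f = enum-complete e q in
      Fin.join p p z , ≡.trans (≡.cong enum (Finₚ.splitAt-join p p z)) f }
  where
  enum : Fin p ⊎ Fin p → Fin r × Vec (Fin p) (suc s)
  enum (inj₁ c) = i , x Vec.∷ʳ c
  enum (inj₂ c) = previous i , c ∷ x
  inc : ∀ z → Graph.Inc (PXgraph p r s) (i , x) (enum z)
  inc (inj₁ c) = inj₁ (≡.refl , ≡.sym (initV-∷ʳ x c))
  inc (inj₂ c) = inj₂ (previous-next i , ≡.refl)
  splitAt-injective : ∀ {c c′} → Fin.splitAt p c ≡ Fin.splitAt p c′ → c ≡ c′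
  splitAt-injective {c} {c′} e = ≡.trans (≡.sym (Finₚ.join-splitAt p p c)) (≡.trans (≡.cong (Fin.join p p) e) (Finₚ.join-splitAt p p c′))
  enum-injective : ∀ z z′ → enum z ≡ enum z′ → z ≡ z′
  enum-injective (inj₁ c) (inj₁ c′) e = ≡.cong inj₁ (Vecₚ.∷ʳ-injectiveʳ x x (≡.cong proj₂ e))
  enum-injective (inj₂ c) (inj₂ c′) e = ≡.cong inj₂ (≡.cong (λ e → Vec.head (proj₂ e)) e)
  enum-injective (inj₁ c) (inj₂ c′) e = contradiction (≡.cong proj₁ e) (previous-≢ 2≤r i)
  enum-injective (inj₂ c) (inj₁ c′) e = contradiction (≡.sym (≡.cong proj₁ e)) (previous-≢ 2≤r i)
  enum-complete : ∀ e → Graph.Inc (PXgraph p r s) (i , x) e → ∃[ z ] enum z ≡ e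
  enum-complete (j , y) (inj₁ (i≡j , x≡)) = inj₁ (Vec.last y) , ≡.cong₂ _,_ i≡j (≡.trans (≡.cong (Vec._∷ʳ Vec.last y) x≡) (initV-last y))
  enum-complete (j , (a ∷ y)) (inj₂ (i≡ , x≡)) = inj₂ a , ≡.cong₂ _,_ (next-previous i j i≡) (≡.cong (a ∷_) x≡)

cycleGraph-degree : ∀ n .{{_ : NonZero n}} → 2 ≤ n → ∀ v → HasDegree (cycleGraph n) v 2
cycleGraph-degree n 2≤n v = record { edge = enum ; incident = inc ; distinct = enum-injective ; complete = enum-complete }
  where
  enum : Fin 2 → Fin n
  enum zero    = v
  enum (suc _) = previous v
  inc : ∀ c → Graph.Inc (cycleGraph n) v (enum c)
  inc zero    = inj₁ ≡.refl
  inc (suc _) = inj₂ (previous-next v)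
  enum-injective : ∀ c c′ → enum c ≡ enum c′ → c ≡ c′
  enum-injective zero       zero       _ = ≡.refl
  enum-injective zero       (suc _)    e = contradiction e (previous-≢ 2≤n v)
  enum-injective (suc _)    zero       e = contradiction (≡.sym e) (previous-≢ 2≤n v)
  enum-injective (suc zero) (suc zero) _ = ≡.refl
  enum-complete : ∀ e → Graph.Inc (cycleGraph n) v e → ∃[ c ] enum c ≡ e
  enum-complete e (inj₁ v≡e) = zero , v≡e
  enum-complete e (inj₂ v≡)  = suc zero , next-previous v e v≡

-- The edges at the base vertex are the ρⁱ⟨τ⟩, and `separate` says that distinct powers of ρ give
-- distinct edges, so |ρ| can be read off from the degree.
module Valency (G : Group 0ℓ 0ℓ) (ρ τ : Group.Carrier G) (τ² : Group._≈_ G (Group._∙_ G τ τ) (Group.ε G))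
               (M : ℕ) (order : Group._≈_ G (powℕ (groupOps G) ρ (suc M)) (Group.ε G))
               (separate : ∀ i j → Cosets._~_ G τ 1 (Group.trans G (Group.∙-congˡ G (Group.identityʳ G τ)) τ²) (powℕ (groupOps G) ρ i) (powℕ (groupOps G) ρ j) →
                           Group._≈_ G (powℕ (groupOps G) ρ i) (powℕ (groupOps G) ρ j))
               (X : Graph) (X-≡ : ∀ {e e′} → Graph._≈E_ X e e′ → e ≡ e′)
               (iso : GraphIso (underlyingGraph (RotaMap (groupOps G) ρ τ)) X)
               (n : ℕ) (degree : HasDegree X (SetIso.to (GraphIso.isoV iso) []) n) where
  open Group G
  open GroupProperties G
  open Powers G
  open Evaluation′ G ρ τ τ²
  open HasDegree degree
  open GraphIso iso using (isoV; isoE; presInc)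
  module E = Cosets G τ 1 (trans (∙-congˡ (identityʳ τ)) τ²)

  spoke : ℕ → Word
  spoke i = powW [ rho ] i

  ev-spoke : ∀ i → ev (spoke i) ≈ ρ ^ i
  ev-spoke i = trans (ev-powW [ rho ] i) (^-cong i (identityʳ ρ))

  index : ℕ → Fin n
  index i = proj₁ (complete (SetIso.to isoE (spoke i)) (proj₁ (presInc [] (spoke i))
    (+ i , + 0 , trans (identityˡ _) (sym (trans (identityʳ _) (ev-spoke i))))))

  edge-index : ∀ i → edge (index i) ≡ SetIso.to isoE (spoke i)
  edge-index i = proj₂ (complete (SetIso.to isoE (spoke i)) _)

  index-injective : ∀ i j → index i ≡ index j → ρ ^ i ≈ ρ ^ j
  index-injective i j e = separate i j (E.~-trans (E.~-refl (sym (ev-spoke i))) (E.~-trans same (E.~-refl (ev-spoke j))))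
    where
    same : ev (spoke i) E.~ ev (spoke j)
    same = E.~-trans (E.~-sym (E.fromSameCoset (SetIso.from-to isoE (spoke i)))) (E.~-trans
      (E.~-refl (reflexive (≡.cong (λ z → ev (SetIso.from isoE z)) (≡.trans (≡.sym (edge-index i)) (≡.trans (≡.cong edge e) (edge-index j))))))
      (E.fromSameCoset (SetIso.from-to isoE (spoke j))))

  spoke-of : ∀ c → ∃[ i ] ρ ^ i E.~ ev (SetIso.from isoE (edge c))
  spoke-of c with meet-elim G (powℤ-power M order) (powℤ-power 1 (trans (∙-congˡ (identityʳ τ)) τ²))
                    (proj₂ (presInc [] (SetIso.from isoE (edge c))) (≡.subst (Graph.Inc X (SetIso.to isoV [])) (≡.sym (X-≡ (SetIso.to-from isoE (edge c)))) (incident c)))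
  ... | z , (i , zρ) , zτ = i , E.~-trans (E.~-refl (sym (trans zρ (identityˡ _)))) (E.~-sym zτ)

  module _ (o : ℕ) .{{_ : NonZero o}} (ρᵒ : ρ ^ o ≈ ε) where

    residue : Fin n → Fin o
    residue c = proj₁ (spoke-of c) mod o

    ρ^-residue : ∀ c → ρ ^ toℕ (residue c) ≈ ρ ^ proj₁ (spoke-of c)
    ρ^-residue c = trans (reflexive (≡.cong (ρ ^_) (toℕ-mod (proj₁ (spoke-of c)) o))) (^-% ρ (proj₁ (spoke-of c)) o ρᵒ)

    residue-injective : ∀ {c c′} → residue c ≡ residue c′ → c ≡ c′
    residue-injective {c} {c′} e = distinct c c′ (≡.trans (≡.sym (X-≡ (SetIso.to-from isoE (edge c))))
      (≡.trans (X-≡ (SetIso.to-cong isoE {SetIso.from isoE (edge c)} {SetIso.from isoE (edge c′)} (E.toSameCoset same))) (X-≡ (SetIso.to-from isoE (edge c′)))))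
      where
      same : ev (SetIso.from isoE (edge c)) E.~ ev (SetIso.from isoE (edge c′))
      same = E.~-trans (E.~-sym (proj₂ (spoke-of c))) (E.~-trans
        (E.~-refl (trans (sym (ρ^-residue c)) (trans (reflexive (≡.cong (λ z → ρ ^ toℕ z) e)) (ρ^-residue c′)))) (proj₂ (spoke-of c′)))

    degree≤ : n ≤ o
    degree≤ = Finₚ.injective⇒≤ {f = residue} residue-injective

  -- Among n + 1 powers of ρ two give the same edge, so ρᵒ = 1 for some o with 0 < o ≤ n. The n
  -- edges come from distinct residues modulo o, so n ≤ o.
  ρ^degree : ρ ^ n ≈ ε
  ρ^degree with Finₚ.pigeonhole (ℕₚ.n<1+n n) (λ i → index (toℕ i))
  ... | i , j , i<j , e = ≡.subst (λ k → ρ ^ k ≈ ε) (ℕₚ.≤-antisym o≤n (degree≤ o ρᵒ)) ρᵒ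
    where
    o = toℕ j ∸ toℕ i
    instance
      o≢0 : NonZero o
      o≢0 = ℕ.>-nonZero (ℕₚ.m<n⇒0<n∸m i<j)
    ρᵒ : ρ ^ o ≈ ε
    ρᵒ = ∙-cancelˡ (ρ ^ toℕ i) _ _ (trans (sym (^-+ ρ (toℕ i) o)) (trans (reflexive (≡.cong (ρ ^_) (ℕₚ.m+[n∸m]≡n (ℕₚ.<⇒≤ i<j))))
      (trans (sym (index-injective (toℕ i) (toℕ j) e)) (sym (identityʳ _)))))
    o≤n : o ≤ n
    o≤n = ℕₚ.≤-trans (ℕₚ.m∸n≤m (toℕ j) (toℕ i)) (ℕₚ.≤-pred (Finₚ.toℕ<n j))

-- The substitution that turns words in ρ and τ into words in σ = ρτ and τ, by ρ = στ and ρ⁻¹ =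
-- τσ⁻¹.
augWord : Letter → Word
augWord rho    = rho ∷ tau ∷ []
augWord rhoInv = tau ∷ rhoInv ∷ []
augWord tau    = tau ∷ []

module _ {p r : ℕ} .{{_ : NonZero p}} .{{_ : NonZero r}} (pp : Prime p) (3≤r : 3 ≤ r) (p∤r : ¬ p ∣ r) where

  r∤2 : ¬ r ∣ 2
  r∤2 r∣2 = ℕₚ.<⇒≱ 3≤r (∣⇒≤ r∣2)

  -- A divisor of 2p that is prime to p divides 2; this is where p ∤ r enters.
  r∤p+p : ¬ r ∣ (p ℕ.+ p)
  r∤p+p r∣ = r∤2 (coprime-divisor (prime-coprime pp p∤r) (≡.subst (r ∣_) eq r∣))
    where
    eq : p ℕ.+ p ≡ p ℕ.* 2
    eq = ≡.trans (≡.cong (p ℕ.+_) (≡.sym (ℕₚ.+-identityʳ p))) (ℕₚ.*-comm 2 p)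

  module _ (G : Group 0ℓ 0ℓ) (ρ τ : Group.Carrier G) (rota : IsRotaData (groupOps G) ρ τ) where
    open Group G
    open GroupProperties G
    open Powers G

    private
      τ² = proj₁ rota
      gen = proj₂ (proj₂ rota)

    -- Otherwise ρτ and τ are two reflections generating G, so r divides the order of ρ, which is the valency.
    ρ-not-rotation : IsAugPXMap p r G ρ τ → ∀ {d} (R : Rep p r d) (irreducible : Irreducible R) (iso : GroupIsoSDP R G) →
      let open Extraction pp 3≤r R irreducible G iso in sg ρ ≡ false → sg τ ≡ true → ⊥
    ρ-not-rotation (s , δ , giso) R irreducible iso sρ sτ = contra s δ giso
      where
      open Extraction pp 3≤r R irreducible G iso
      σ = ρ ∙ τ
      sσ : sg σ ≡ true
      sσ = ≡.trans (sg-∙ ρ τ) (≡.cong₂ _xor_ sρ sτ)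
      σττ : σ ∙ τ ≈ ρ
      σττ = trans (assoc _ _ _) (trans (∙-congˡ τ²) (identityʳ ρ))
      open Evaluation′ G σ τ τ² using () renaming (ev to ev′; ev-++ to ev′-++)
      open Evaluation G ρ τ using (ev)
      ev-aug : ∀ w → ev′ (List.concatMap augWord w) ≈ ev w
      ev-aug [] = refl
      ev-aug (rho ∷ w) = trans (sym (assoc _ _ _)) (∙-cong σττ (ev-aug w))
      ev-aug (rhoInv ∷ w) = trans (sym (assoc _ _ _)) (∙-cong
        (trans (∙-congˡ (⁻¹-anti-homo-∙ ρ τ)) (\\-leftDividesˡ τ (ρ ⁻¹))) (ev-aug w))
      ev-aug (tau ∷ w) = ∙-congˡ (ev-aug w)
      gen′ : ∀ x → ∃[ w ] ev′ w ≈ x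
      gen′ x = List.concatMap augWord (proj₁ (gen x)) , trans (ev-aug (proj₁ (gen x))) (proj₂ (gen x))
      P : Pre p r
      P = toPre σ τ τ² sσ sτ
      -- For the generators σ and τ the rotation is στ = ρ.
      faithful : ∀ n → V (ρ ^ n) → r ∣ n
      faithful n v = rotation-faithful σ τ τ² sσ sτ gen′ n (Pre.V-resp P (^-cong n (sym σττ)) v)
      open Rotary P (rotation-faithful σ τ τ² sσ sτ gen′) 3≤r using (Ed-cases; module Ed; a-order′)
      order : ρ ^ suc (pred (p ℕ.* r)) ≈ ε
      order = trans (^-cong (suc (pred (p ℕ.* r))) (sym σττ)) a-order′
      separate : ∀ i j → ρ ^ i Ed.~ ρ ^ j → ρ ^ i ≈ ρ ^ j
      separate i j q with Ed-cases q
      ... | inj₁ e = sym e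
      ... | inj₂ e = contradiction (≡.trans (≡.sym (≡.cong proj₂ (rotation-^ j sρ))) (≡.trans (≡.cong proj₂ (D-cong e))
              (≡.trans (sg-∙ (ρ ^ i) τ) (≡.cong₂ _xor_ (≡.cong proj₂ (rotation-^ i sρ)) sτ)))) λ ()
      bound : ∀ n X (X-≡ : ∀ {e e′} → Graph._≈E_ X e e′ → e ≡ e′) →
              GraphIso (underlyingGraph (RotaMap (groupOps G) ρ τ)) X → (∀ v → HasDegree X v n) → r ∣ n
      bound n X X-≡ f deg = faithful n (Pre.V-resp P (sym (Valency.ρ^degree G ρ τ τ² (pred (p ℕ.* r)) order separate X X-≡ f n (deg _))) V-ε)
      contra : ∀ s δ → GraphIso (underlyingGraph (RotaMap (groupOps G) ρ τ)) (AugPX p r s δ) → ⊥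
      contra zero minus f = r∤2 (bound 2 (cycleGraph (p ℕ.* r) {{ℕₚ.m*n≢0 p r}}) (λ e → e) f
        (cycleGraph-degree (p ℕ.* r) {{ℕₚ.m*n≢0 p r}} (ℕₚ.≤-trans 2≤r (ℕₚ.m≤n*m r p))))
      contra zero plus f = r∤p+p (bound (p ℕ.+ p) (PXgraph p r 0) (λ e → e) f (PXgraph-degree p r 0 2≤r))
      contra (suc s) δ f = r∤p+p (bound (p ℕ.+ p) (PXgraph p r (suc s)) (λ e → e) f (PXgraph-degree p r (suc s) 2≤r))


module _ {p r : ℕ} .{{_ : NonZero p}} .{{_ : NonZero r}} (pp : Prime p) (3≤r : 3 ≤ r) (p∤r : ¬ p ∣ r)
         (G : Group 0ℓ 0ℓ) (ρ τ : Group.Carrier G) (rota : IsRotaData (groupOps G) ρ τ) where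

  reflections : IsAugPXMap p r G ρ τ → ∀ {d} (R : Rep p r d) (irreducible : Irreducible R) (iso : GroupIsoSDP R G) →
    let open Extraction pp 3≤r R irreducible G iso in sg ρ ≡ true × sg τ ≡ true
  reflections aug R irreducible iso = go (sg ρ) (sg τ) ≡.refl ≡.refl
    where
    open Extraction pp 3≤r R irreducible G iso
    go : ∀ b c → sg ρ ≡ b → sg τ ≡ c → sg ρ ≡ true × sg τ ≡ true
    go true  true  e f = e , f
    go false true  e f = ⊥-elim (ρ-not-rotation pp 3≤r p∤r G ρ τ rota aug R irreducible iso e f)
    go true  false e f = ⊥-elim (τ-not-rotation ρ τ (proj₁ rota) (proj₂ (proj₂ rota)) e f)
    go false false e f = ⊥-elim (not-both-rotations ρ τ (proj₁ rota) (proj₂ (proj₂ rota)) e f)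

  model : IrredAugPXMap p r G ρ τ → Irr p r
  model (aug , d , R , irreducible , iso) = toIrr ρ τ (proj₁ rota) (proj₁ both) (proj₂ both) (proj₂ (proj₂ rota))
    where
    open Extraction pp 3≤r R irreducible G iso
    both = reflections aug R irreducible iso

-- Unique factorisation

module _ {p r : ℕ} .{{_ : NonZero p}} .{{_ : NonZero r}} (pp : Prime p) (p≢2 : p ≢ 2) (3≤r : 3 ≤ r) where
  open Comparison {p} {r} pp p≢2 using (SameKernel)
  open Covering {p} {r} pp p≢2 using (covered)
  open Recognition {p} {r} pp p≢2 3≤r using (MapIso⇒sameKernel; SameKernelˢ)

  irrMap : Irr p r → MapStr
  irrMap K = Semi.rotaMap (single K)

  SameKernel⇒MapIso : ∀ K L → SameKernel K L → MapIso (irrMap K) (irrMap L)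
  SameKernel⇒MapIso K L s = sameKernel⇒MapIso K.G K.ρ K.τ K.τ² L.G L.ρ L.τ L.τ² (λ w → proj₁ (s w)) (λ w → proj₂ (s w))
    where
    module K = Pre (Irr.pre K)
    module L = Pre (Irr.pre L)

  MapIso⇒SameKernel : ∀ K L → MapIso (irrMap K) (irrMap L) → SameKernel K L
  MapIso⇒SameKernel K L = MapIso⇒sameKernel (single K) (single L)

  SameKernel-sym : ∀ K L → SameKernel K L → SameKernel L K
  SameKernel-sym K L s w = proj₂ (s w) , proj₁ (s w)

  SameKernel-trans : ∀ K L M → SameKernel K L → SameKernel L M → SameKernel K M
  SameKernel-trans K L M s s′ w = (λ e → proj₁ (s′ w) (proj₁ (s w) e)) , (λ e → proj₂ (s w) (proj₂ (s′ w) e))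

  prodMap : ∀ {m} → (Fin m → Irr p r) → MapStr
  prodMap K = RotaMap (prodOps (λ i → groupOps (Pre.G (Irr.pre (K i))))) (λ i → Pre.ρ (Irr.pre (K i))) (λ i → Pre.τ (Irr.pre (K i)))

  module _ {m n : ℕ} (K : Fin m → Irr p r) (L : Fin n → Irr p r) where
    private
      module K i = Pre (Irr.pre (K i))
      module L j = Pre (Irr.pre (L j))

    MapIso-product : (σ : Fin m ↔ Fin n) → (∀ i → SameKernel (K i) (L (Inverse.to σ i))) → MapIso (prodMap K) (prodMap L)
    MapIso-product σ s = sameKernel⇒MapIso (prodGroup K.G) K.ρ K.τ K.τ² (prodGroup L.G) L.ρ L.τ L.τ² K⊆L L⊆K
      where
      OK : Fin m → Ops
      OK i = groupOps (K.G i)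
      OL : Fin n → Ops
      OL j = groupOps (L.G j)
      inL : Word → Fin n → Set
      inL w j = Group._≈_ (L.G j) (L.ev j w) (Group.ε (L.G j))
      K⊆L : KernelSubset (prodGroup K.G) K.ρ K.τ K.τ² (prodGroup L.G) L.ρ L.τ L.τ²
      K⊆L w e j = ≡.subst (λ z → Group._≈_ (L.G j) z (Group.ε (L.G j))) (≡.sym (eval-prod OL L.ρ L.τ w j))
        (≡.subst (inL w) (Inverse.strictlyInverseˡ σ j) (proj₁ (s i w) (≡.subst (λ z → Group._≈_ (K.G i) z (Group.ε (K.G i))) (eval-prod OK K.ρ K.τ w i) (e i))))
        where i = Inverse.from σ j
      L⊆K : KernelSubset (prodGroup L.G) L.ρ L.τ L.τ² (prodGroup K.G) K.ρ K.τ K.τ²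
      L⊆K w e i = ≡.subst (λ z → Group._≈_ (K.G i) z (Group.ε (K.G i))) (≡.sym (eval-prod OK K.ρ K.τ w i))
        (proj₂ (s i w) (≡.subst (λ z → Group._≈_ (L.G j) z (Group.ε (L.G j))) (eval-prod OL L.ρ L.τ w j) (e j)))
        where j = Inverse.to σ i

    -- Having the same kernel is an equivalence relation and the members of each family are
    -- inequivalent, so the two choices of partners are mutually inverse.
    matching : (∀ i i′ → i ≢ i′ → ¬ SameKernel (K i) (K i′)) → (∀ j j′ → j ≢ j′ → ¬ SameKernel (L j) (L j′)) →
               (∀ i → ∃[ j ] SameKernel (K i) (L j)) → (∀ j → ∃[ i ] SameKernel (L j) (K i)) →
               (m ≡ n) × (Σ[ σ ∈ Fin m ↔ Fin n ] (∀ i → SameKernel (K i) (L (Inverse.to σ i))))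
    matching distinctK distinctL f g =
      Finₚ.cantor-schröder-bernstein {f = to} {g = from} (λ {i} {i′} e → ≡.trans (≡.sym (from-to i)) (≡.trans (≡.cong from e) (from-to i′)))
                                     (λ {j} {j′} e → ≡.trans (≡.sym (to-from j)) (≡.trans (≡.cong to e) (to-from j′))) ,
      mk↔ₛ′ to from to-from from-to , (λ i → proj₂ (f i))
      where
      to : Fin m → Fin n
      to i = proj₁ (f i)
      from : Fin n → Fin m
      from j = proj₁ (g j)
      from-to : ∀ i → from (to i) ≡ i
      from-to i with from (to i) Fin.≟ i
      ... | yes e = e
      ... | no ne = contradiction (SameKernel-sym (K i) (K (from (to i))) (SameKernel-trans (K i) (L (to i)) (K (from (to i))) (proj₂ (f i)) (proj₂ (g (to i)))))
                      (distinctK (from (to i)) i ne)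
      to-from : ∀ j → to (from j) ≡ j
      to-from j with to (from j) Fin.≟ j
      ... | yes e = e
      ... | no ne = contradiction (SameKernel-sym (L j) (L (to (from j))) (SameKernel-trans (L j) (K (from j)) (L (to (from j))) (proj₂ (g j)) (proj₂ (f (from j)))))
                      (distinctL (to (from j)) j ne)

  ¬one-vertex : ∀ {n} (L : Fin (suc n) → Irr p r) →
    ¬ (∀ v w → MapStr._≈V_ (Semi.rotaMap (product L)) v w)
  ¬one-vertex L all = Q.vertex-step (Group.ε Q.G) (Q.Vx.~-trans (Q.Vx.fromSameCoset (all [] [ tau ])) (Q.Vx.~-refl
      (Group.trans Q.G (Group.identityʳ Q.G Q.τ) (Group.sym Q.G (Group.identityˡ Q.G Q.τ)))))
    where
    module Q = Rotary (Semi.pre (product L)) (Semi.ord (product L)) 3≤r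

  covers : ∀ {m n} (K : Fin (suc m) → Irr p r) (L : Fin (suc n) → Irr p r) → SameKernelˢ (product K) (product L) →
           ∀ i → ∃[ j ] SameKernel (K i) (L j)
  covers K L s i = covered (K i) L λ w e → Semi.comp⁺ (product K) w [] (proj₂ (s w) (Semi.comp⁻ (product L) w [] e)) i

  factors : ∀ {m n} (K : Fin m → Irr p r) (L : Fin n → Irr p r) → MapIso (prodMap K) (prodMap L) →
            (∀ i → ∃[ j ] SameKernel (K i) (L j)) × (∀ j → ∃[ i ] SameKernel (L j) (K i))
  factors {zero}  {zero}  K L f = (λ ()) , (λ ())
  -- In the empty product every equation holds, so it has a single vertex, whereas a nonempty
  -- product has an edge with two distinct ends.
  factors {zero}  {suc n} K L f = ⊥-elim (¬one-vertex L λ v w → Q.Vx.toSameCoset (Q.Vx.~-trans (Q.Vx.~-sym (Q.Vx.fromSameCoset (SetIso.to-from isoV v)))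
      (Q.Vx.~-trans (Q.Vx.fromSameCoset (SetIso.to-cong isoV {SetIso.from isoV v} {SetIso.from isoV w} (+ 0 , λ ()))) (Q.Vx.fromSameCoset (SetIso.to-from isoV w)))))
    where
    open MapIso f using (isoV)
    module Q = Rotary (Semi.pre (product L)) (Semi.ord (product L)) 3≤r
  factors {suc m} {zero}  K L f = ⊥-elim (¬one-vertex K λ v w → Q.Vx.toSameCoset (Q.Vx.~-trans (Q.Vx.~-sym (Q.Vx.fromSameCoset (SetIso.from-to isoV v)))
      (Q.Vx.~-trans (Q.Vx.fromSameCoset (SetIso.from-cong isoV {SetIso.to isoV v} {SetIso.to isoV w} (+ 0 , λ ()))) (Q.Vx.fromSameCoset (SetIso.from-to isoV w)))))
    where
    open MapIso f using (isoV)
    module Q = Rotary (Semi.pre (product K)) (Semi.ord (product K)) 3≤r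
  factors {suc m} {suc n} K L f = covers K L s , covers L K (λ w → proj₂ (s w) , proj₁ (s w))
    where s = MapIso⇒sameKernel (product K) (product L) f
theorem6p8 : (p r : ℕ) .{{_ : NonZero p}} .{{_ : NonZero r}} →
    Prime p → p ≢ 2 → 3 ≤ r → ¬ (p ∣ r) →
    (m n : ℕ) →
    (G : Fin m → Group 0ℓ 0ℓ) (ρ τ : (i : Fin m) → Group.Carrier (G i)) →
    (H : Fin n → Group 0ℓ 0ℓ) (ρ′ τ′ : (j : Fin n) → Group.Carrier (H j)) →
    (∀ i → IsRotaData (groupOps (G i)) (ρ i) (τ i)) →
    (∀ j → IsRotaData (groupOps (H j)) (ρ′ j) (τ′ j)) →
    (∀ i → IrredAugPXMap p r (G i) (ρ i) (τ i)) →
    (∀ j → IrredAugPXMap p r (H j) (ρ′ j) (τ′ j)) →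
    (∀ i i′ → i ≢ i′ → ¬ MapIso (RotaMap (groupOps (G i)) (ρ i) (τ i)) (RotaMap (groupOps (G i′)) (ρ i′) (τ i′))) →
    (∀ j j′ → j ≢ j′ → ¬ MapIso (RotaMap (groupOps (H j)) (ρ′ j) (τ′ j)) (RotaMap (groupOps (H j′)) (ρ′ j′) (τ′ j′))) →
    (MapIso (RotaMap (prodOps (λ i → groupOps (G i))) ρ τ) (RotaMap (prodOps (λ j → groupOps (H j))) ρ′ τ′)
    ⇔ ((m ≡ n) × (Σ[ σ ∈ Fin m ↔ Fin n ] (∀ i → MapIso (RotaMap (groupOps (G i)) (ρ i) (τ i)) (RotaMap (groupOps (H (Inverse.to σ i))) (ρ′ (Inverse.to σ i)) (τ′ (Inverse.to σ i)))))))
theorem6p8 p r pp p≢2 3≤r p∤r m n G ρ τ H ρ′ τ′ rota rota′ maps maps′ distinct distinct′ = mk⇔ forward backward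
  where
  K : Fin m → Irr p r
  K i = model pp 3≤r p∤r (G i) (ρ i) (τ i) (rota i) (maps i)
  L : Fin n → Irr p r
  L j = model pp 3≤r p∤r (H j) (ρ′ j) (τ′ j) (rota′ j) (maps′ j)
  -- The groups and generators stored in `K i` and `L j` are by computation the given ones, so these
  -- are the types of the statement.
  forward : MapIso (prodMap pp p≢2 3≤r K) (prodMap pp p≢2 3≤r L) →
            (m ≡ n) × (Σ[ σ ∈ Fin m ↔ Fin n ] (∀ i → MapIso (irrMap pp p≢2 3≤r (K i)) (irrMap pp p≢2 3≤r (L (Inverse.to σ i)))))
  forward f =
    let to , from = factors pp p≢2 3≤r K L f
        m≡n , σ , s = matching pp p≢2 3≤r K L
          (λ i i′ i≢i′ s → distinct i i′ i≢i′ (SameKernel⇒MapIso pp p≢2 3≤r (K i) (K i′) s))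
          (λ j j′ j≢j′ s → distinct′ j j′ j≢j′ (SameKernel⇒MapIso pp p≢2 3≤r (L j) (L j′) s)) to from
    in m≡n , σ , λ i → SameKernel⇒MapIso pp p≢2 3≤r (K i) (L (Inverse.to σ i)) (s i)
  backward : (m ≡ n) × (Σ[ σ ∈ Fin m ↔ Fin n ] (∀ i → MapIso (irrMap pp p≢2 3≤r (K i)) (irrMap pp p≢2 3≤r (L (Inverse.to σ i))))) →
             MapIso (prodMap pp p≢2 3≤r K) (prodMap pp p≢2 3≤r L)
  backward (_ , σ , f) = MapIso-product pp p≢2 3≤r K L σ (λ i → MapIso⇒SameKernel pp p≢2 3≤r (K i) (L (Inverse.to σ i)) (f i))
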